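{- For each $\varepsilon>0$, as $k\to\infty$, \[\Bigl\lvert\bigl\{t\in\{1,\ldots,2^k-2\}:P_{t,k}\notin(1/2-\varepsilon,\,1/2)\bigr\}\Bigr\rvert=O\!\left(\frac{2^k}{k}\right).\] In particular, \[\lim_{k\to\infty}\frac1{2^k}\Bigl\lvert\bigl\{t\in\{1,\ldots,2^k-2\}:1/2-\varepsilon<P_{t,k}<1/2\bigr\}\Bigr\rvert=1.\]
   Context: For a nonnegative integer $n$, $w(n)$ denotes the number of $1$s in the binary expansion of $n$ (the binary sum of digits / Hamming weight). For integers $k\ge1$ and $t\in\{1,\ldots,2^k-2\}$ define \[S_{t,k}=\Bigl\{(a,b)\in\{0,\ldots,2^k-2\}^2:\ a+b\equiv t \pmod{2^k-1},\ w(a)+w(b)<k\Bigr\},\qquad P_{t,k}=\frac{\lvert S_{t,k}\rvert}{2^k}.\] -}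

module Defs where

open import Data.Nat using (ℕ; zero; suc; _+_; _*_; _∸_; _^_; _<_; _≤_; _<ᵇ_)
open import Data.Nat.DivMod using (_%_; _/_)
open import Data.Nat.Properties using (_≟_; _<?_)
open import Data.List using (List; upTo; filter; length; map; concatMap)
open import Data.Product using (_×_; _,_; proj₁; proj₂)
open import Data.Sum using (_⊎_)
open import Relation.Nullary using (¬_)
open import Relation.Nullary.Decidable using (_×-dec_; _⊎-dec_; ¬?)
open import Relation.Binary.PropositionalEquality using (_≡_)

-- number of 1s in the binary expansion, computed with fuel (fuel ≥ n suffices)
weightFuel : ℕ → ℕ → ℕ
weightFuel zero    n = 0
weightFuel (suc f) zero = 0
weightFuel (suc f) (suc n) = (suc n % 2) + weightFuel f (suc n / 2)

w : ℕ → ℕ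
w n = weightFuel n n

-- the modulus 2^k - 1, written as suc (2^k ∸ 2) (equal to 2^k - 1 for k ≥ 1)
modK : ℕ → ℕ
modK k = suc (2 ^ k ∸ 2)

range : ℕ → List ℕ
range k = upTo (2 ^ k ∸ 1)

InS : ℕ → ℕ → ℕ × ℕ → Set
InS t k (a , b) = ((a + b) % modK k ≡ t % modK k) × (w a + w b < k)

pairs : ℕ → List (ℕ × ℕ)
pairs k = concatMap (λ a → map (λ b → (a , b)) (range k)) (range k)

sizeS : ℕ → ℕ → ℕ
sizeS t k = length (filter (λ ab → ((proj₁ ab + proj₂ ab) % modK k ≟ t % modK k)
                                   ×-dec (w (proj₁ ab) + w (proj₂ ab) <? k))
                           (pairs k))

tRange : ℕ → List ℕ
tRange k = map suc (upTo (2 ^ k ∸ 2))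

-- |{ t ∈ {1,…,2^k-2} : P_{t,k} ∉ (1/2 - p/q , 1/2) }|
badCount : ℕ → ℕ → ℕ → ℕ
badCount p q k = length (filter (λ t → ¬? ((q * 2 ^ k <? 2 * q * sizeS t k + 2 * p * 2 ^ k)
                                          ×-dec (2 * sizeS t k <? 2 ^ k)))
                                (tRange k))

{-# OPTIONS --safe #-}
module Submission where

-- Put x = 2^k - 1 - a.  Then P_{t,k} is the proportion of x for which cyclic addition of t lowers the
-- weight.  Read the digits from the bottom with x random: as long as the digit of t equals the carry
-- nothing happens, otherwise a fair coin flips the digit of x and becomes the new carry.  So the change
-- of weight D is a sum of fair signs, and 1 - 2 P is, up to O(1/k), the mean of sg D with sg 0 = 1.
--
-- Write D = D₁ + D₂ over the lower and the upper part of t.  Blocks 0,1,0 of t supply independent coins,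
-- so for all but few t averaging sg over either part gives a function whose j-th differences are
-- O(k^(-j/2)).  For such a function h, the mean α t h of h (D) is, as a function of the random digits of
-- t, a sum of orthogonal increments around L^n h, where L is the generator of the walk averaged over t.
-- If h is odd the increments are small enough that the variance is O(k^(-2)).  Splitting the mean of sg D
-- into parts odd in D₁ and in D₂, Chebyshev's inequality shows that it differs from L^k sg 0, which lies
-- between c k^(-1/2) and C k^(-1/2), by less than a fraction of k^(-1/2) for all but O(2^k / k) of the t.

open import Data.Bool using (Bool; true; false; not)
open import Data.Empty using (⊥-elim)
open import Data.Integer as ℤ using (ℤ)
import Data.Integer.Properties as ℤₚ
open import Data.List using (List; []; _∷_; _++_; length; map; filter; applyUpTo; upTo; concatMap)
import Data.List.Properties as Listₚ
open import Data.Nat as ℕ using (ℕ; zero; suc)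
import Data.Nat.DivMod as ℕ
import Data.Nat.Properties as ℕₚ
import Data.Nat.Tactic.RingSolver as ℕ-Solver
open import Data.Product using (Σ; _×_; _,_; proj₁; proj₂)
open import Data.Sum using (inj₁; inj₂)
open import Function using (_∘_; id)
open import Relation.Binary.PropositionalEquality
open import Relation.Nullary using (yes; no; ¬_; Dec)
open import Relation.Nullary.Decidable using (_×-dec_; ¬?; dec⇒maybe)

-- The obstacle: if `Δ h` is merely of order 1/k, the k orthogonal increments of `α t h` add up to a
-- variance of order 1/k. That is the order of the squared mean, and Chebyshev's inequality then
-- says nothing. One more factor k^(-1/2) per increment is needed. An increment is a mean of `Δ h`
-- weighted by the sign of the outgoing carry. That carry depends essentially on the last few
-- digits, so the weighted mean is close to the plain mean of `Δ h` times a bounded factor; and for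
-- odd h the expectation of the plain mean vanishes or is of the order of a third difference. As
-- `sg` is not smooth, one part of t has to smooth it while the other part supplies the randomness,
-- and then the roles are exchanged.
--
-- Square roots and probabilities of events are avoided: `r` = 1/ν with an integer ν of order
-- k^(1/2) stands for k^(-1/2), and the exceptional t are counted by one nonnegative function that
-- is at least 1 on each of them and has mean O(r²). Only the threshold for k depends on ε; the
-- constant does not.

module Operators where

  open import Data.Rational
  open import Data.Rational.Properties
  open import Tactic.RingSolver using (solve-∀)
  open import Tactic.RingSolver.Core.AlmostCommutativeRing using (AlmostCommutativeRing; fromCommutativeRing)

  ring : AlmostCommutativeRing _ _
  ring = fromCommutativeRing +-*-commutativeRing (λ x → dec⇒maybe (0ℚ ≟ x))

  ¼ : ℚ
  ¼ = ½ * ½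

  0≤+ : ∀ {p q} → 0ℚ ≤ p → 0ℚ ≤ q → 0ℚ ≤ p + q
  0≤+ a b = +-mono-≤ a b

  *-mono : ∀ {c p q} → 0ℚ ≤ c → p ≤ q → c * p ≤ c * q
  *-mono {c} a b = *-monoˡ-≤-nonNeg c {{nonNegative a}} b

  0≤* : ∀ {p q} → 0ℚ ≤ p → 0ℚ ≤ q → 0ℚ ≤ p * q
  0≤* {p} {q} a b = subst (_≤ p * q) (*-zeroʳ p) (*-mono a b)

  *-mono₂ : ∀ {a b c d} → 0ℚ ≤ a → 0ℚ ≤ d → a ≤ b → c ≤ d → a * c ≤ b * d
  *-mono₂ {a} {b} {c} {d} 0a 0d ab cd = ≤-trans (*-mono 0a cd)
    (subst₂ _≤_ (*-comm d a) (*-comm d b) (*-mono 0d ab))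

  private
    diff₁ : ∀ x y → x + (y - x) ≡ y
    diff₁ = solve-∀ ring

  ≤⇒0≤ : ∀ {x y} → x ≤ y → 0ℚ ≤ y - x
  ≤⇒0≤ {x} {y} p = subst (_≤ y - x) (+-inverseʳ x) (+-monoˡ-≤ (- x) p)

  ≤-by : ∀ {x y d} → 0ℚ ≤ d → y ≡ x + d → x ≤ y
  ≤-by {x} {y} {d} p eq = subst₂ _≤_ (+-identityʳ x) (sym eq) (+-monoʳ-≤ x p)

  0≤⇒≤ : ∀ {x y} → 0ℚ ≤ y - x → x ≤ y
  0≤⇒≤ {x} {y} p = ≤-by p (sym (diff₁ x y))

  0≤½ : 0ℚ ≤ ½
  0≤½ = ≤ᵇ⇒≤ _

  0≤¼ : 0ℚ ≤ ¼
  0≤¼ = ≤ᵇ⇒≤ _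

  0≤1 : 0ℚ ≤ 1ℚ
  0≤1 = ≤ᵇ⇒≤ _

  0≤sq : ∀ x → 0ℚ ≤ x * x
  0≤sq x with ≤-total 0ℚ x
  ... | inj₁ p = 0≤* p p
  ... | inj₂ p = subst (0ℚ ≤_) (eq x) (0≤* (neg-antimono-≤ p) (neg-antimono-≤ p))
    where
    eq : ∀ x → (- x) * (- x) ≡ x * x
    eq = solve-∀ ring

  abs-neg : ∀ {x B} → ∣ x ∣ ≤ B → ∣ - x ∣ ≤ B
  abs-neg {x} {B} = subst (_≤ B) (sym (∣-p∣≡∣p∣ x))

  abs-upper : ∀ {x B} → ∣ x ∣ ≤ B → x ≤ B
  abs-upper {x} p with ≤-total 0ℚ x
  ... | inj₁ q = ≤-trans (≤-reflexive (sym (0≤p⇒∣p∣≡p q))) p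
  ... | inj₂ q = ≤-trans q (≤-trans (0≤∣p∣ x) p)

  abs-lower : ∀ {x B} → ∣ x ∣ ≤ B → - x ≤ B
  abs-lower p = abs-upper (abs-neg p)

  abs⇒0≤ : ∀ {x B} → ∣ x ∣ ≤ B → 0ℚ ≤ B
  abs⇒0≤ {x} p = ≤-trans (0≤∣p∣ x) p

  abs-+ : ∀ {x y A B} → ∣ x ∣ ≤ A → ∣ y ∣ ≤ B → ∣ x + y ∣ ≤ A + B
  abs-+ {x} {y} p q = ≤-trans (∣p+q∣≤∣p∣+∣q∣ x y) (+-mono-≤ p q)

  abs-- : ∀ {x y A B} → ∣ x ∣ ≤ A → ∣ y ∣ ≤ B → ∣ x - y ∣ ≤ A + B
  abs-- p q = abs-+ p (abs-neg q)

  abs-* : ∀ {x y A B} → ∣ x ∣ ≤ A → ∣ y ∣ ≤ B → ∣ x * y ∣ ≤ A * B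
  abs-* {x} {y} p q = ≤-trans (≤-reflexive (∣p*q∣≡∣p∣*∣q∣ x y))
    (*-mono₂ (0≤∣p∣ x) (abs⇒0≤ q) p q)

  abs-scale : ∀ {c x B} → 0ℚ ≤ c → ∣ x ∣ ≤ B → ∣ c * x ∣ ≤ c * B
  abs-scale {c} p q = abs-* (≤-reflexive (0≤p⇒∣p∣≡p p)) q

  abs-subst : ∀ {x y B} → y ≡ x → ∣ x ∣ ≤ B → ∣ y ∣ ≤ B
  abs-subst {B = B} e = subst (λ z → ∣ z ∣ ≤ B) (sym e)

  abs-mono : ∀ {x B C} → B ≤ C → ∣ x ∣ ≤ B → ∣ x ∣ ≤ C
  abs-mono p q = ≤-trans q p

  half-double : ∀ b → ½ * (b + b) ≡ b
  half-double = solve-∀ ring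

  abs-avg : ∀ {x y B} → ∣ x ∣ ≤ B → ∣ y ∣ ≤ B → ∣ ½ * (x + y) ∣ ≤ B
  abs-avg {B = B} p q = subst (λ z → _ ≤ z) (half-double B) (abs-scale 0≤½ (abs-+ p q))

  avg-≤ : ∀ {x y B} → x ≤ B → y ≤ B → ½ * (x + y) ≤ B
  avg-≤ {B = B} p q = subst (_ ≤_) (half-double B) (*-mono 0≤½ (+-mono-≤ p q))

  sq-≤ : ∀ {x B} → ∣ x ∣ ≤ B → x * x ≤ B * B
  sq-≤ {x} {B} p = abs-upper (abs-* p p)

  -- Translation-invariant operators on functions on ℤ.

  infixr 7 _⊙_ _∙_
  infixl 6 _⊕_
  infixr 8 _^ᵒ_

  -- A syntax instead of arbitrary maps of functions: linearity and mutual commutation (`⟦⟧-comm`)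
  -- then hold for all operators at once, by induction.
  data Op : Set where
    I S S⁻ : Op
    _⊕_ _⊙_ : Op → Op → Op
    _∙_ : ℚ → Op → Op

  ⟦_⟧ : Op → (ℤ → ℚ) → ℤ → ℚ
  ⟦ I ⟧ f x = f x
  ⟦ S ⟧ f x = f (ℤ.suc x)
  ⟦ S⁻ ⟧ f x = f (ℤ.pred x)
  ⟦ P ⊕ Q ⟧ f x = ⟦ P ⟧ f x + ⟦ Q ⟧ f x
  ⟦ P ⊙ Q ⟧ f x = ⟦ P ⟧ (⟦ Q ⟧ f) x
  ⟦ q ∙ P ⟧ f x = q * ⟦ P ⟧ f x

  _^ᵒ_ : Op → ℕ → Op
  P ^ᵒ zero = I
  P ^ᵒ suc n = P ⊙ P ^ᵒ n

  -- `T` adds a fair coin with values 0 and 1. `L` = `I` + ½ `Δ` is the step of a lazy symmetric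
  -- walk, and `Δ` is half of a centred second difference.
  T ∇ Δ L : Op
  T = ½ ∙ (I ⊕ S)
  ∇ = S ⊕ (- 1ℚ) ∙ I
  Δ = ½ ∙ (S ⊕ S⁻) ⊕ (- 1ℚ) ∙ I
  L = ½ ∙ I ⊕ ¼ ∙ (S ⊕ S⁻)

  ⟦⟧-cong : ∀ P {f g} → (∀ x → f x ≡ g x) → ∀ x → ⟦ P ⟧ f x ≡ ⟦ P ⟧ g x
  ⟦⟧-cong I e x = e x
  ⟦⟧-cong S e x = e _
  ⟦⟧-cong S⁻ e x = e _
  ⟦⟧-cong (P ⊕ Q) e x = cong₂ _+_ (⟦⟧-cong P e x) (⟦⟧-cong Q e x)
  ⟦⟧-cong (P ⊙ Q) e x = ⟦⟧-cong P (⟦⟧-cong Q e) x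
  ⟦⟧-cong (q ∙ P) e x = cong (q *_) (⟦⟧-cong P e x)

  private
    lin₁ : ∀ a b x y u v → (a * x + b * y) + (a * u + b * v) ≡ a * (x + u) + b * (y + v)
    lin₁ = solve-∀ ring
    lin₂ : ∀ q a b x y → q * (a * x + b * y) ≡ a * (q * x) + b * (q * y)
    lin₂ = solve-∀ ring
    lin₃ : ∀ x y → 1ℚ * x + 1ℚ * y ≡ x + y
    lin₃ = solve-∀ ring
    lin₄ : ∀ q x → q * x + 0ℚ * x ≡ q * x
    lin₄ = solve-∀ ring

  ⟦⟧-linear : ∀ P a b f g x →
    ⟦ P ⟧ (λ y → a * f y + b * g y) x ≡ a * ⟦ P ⟧ f x + b * ⟦ P ⟧ g x
  ⟦⟧-linear I a b f g x = refl
  ⟦⟧-linear S a b f g x = refl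
  ⟦⟧-linear S⁻ a b f g x = refl
  ⟦⟧-linear (P ⊕ Q) a b f g x =
    trans (cong₂ _+_ (⟦⟧-linear P a b f g x) (⟦⟧-linear Q a b f g x))
          (lin₁ a b (⟦ P ⟧ f x) (⟦ P ⟧ g x) (⟦ Q ⟧ f x) (⟦ Q ⟧ g x))
  ⟦⟧-linear (P ⊙ Q) a b f g x =
    trans (⟦⟧-cong P (⟦⟧-linear Q a b f g) x) (⟦⟧-linear P a b (⟦ Q ⟧ f) (⟦ Q ⟧ g) x)
  ⟦⟧-linear (q ∙ P) a b f g x =
    trans (cong (q *_) (⟦⟧-linear P a b f g x)) (lin₂ q a b (⟦ P ⟧ f x) (⟦ P ⟧ g x))

  ⟦⟧-+ : ∀ P f g x → ⟦ P ⟧ (λ y → f y + g y) x ≡ ⟦ P ⟧ f x + ⟦ P ⟧ g x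
  ⟦⟧-+ P f g x = trans (⟦⟧-cong P (λ y → sym (lin₃ (f y) (g y))) x)
    (trans (⟦⟧-linear P 1ℚ 1ℚ f g x) (lin₃ (⟦ P ⟧ f x) (⟦ P ⟧ g x)))

  ⟦⟧-* : ∀ P q f x → ⟦ P ⟧ (λ y → q * f y) x ≡ q * ⟦ P ⟧ f x
  ⟦⟧-* P q f x = trans (⟦⟧-cong P (λ y → sym (lin₄ q (f y))) x)
    (trans (⟦⟧-linear P q 0ℚ f f x) (lin₄ q (⟦ P ⟧ f x)))

  suc-comm : ∀ P f x → ⟦ P ⟧ (λ y → f (ℤ.suc y)) x ≡ ⟦ P ⟧ f (ℤ.suc x)
  suc-comm I f x = refl
  suc-comm S f x = refl
  suc-comm S⁻ f x = cong f (trans (ℤₚ.suc-pred x) (sym (ℤₚ.pred-suc x)))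
  suc-comm (P ⊕ Q) f x = cong₂ _+_ (suc-comm P f x) (suc-comm Q f x)
  suc-comm (P ⊙ Q) f x = trans (⟦⟧-cong P (suc-comm Q f) x) (suc-comm P (⟦ Q ⟧ f) x)
  suc-comm (q ∙ P) f x = cong (q *_) (suc-comm P f x)

  pred-comm : ∀ P f x → ⟦ P ⟧ (λ y → f (ℤ.pred y)) x ≡ ⟦ P ⟧ f (ℤ.pred x)
  pred-comm I f x = refl
  pred-comm S f x = cong f (trans (ℤₚ.pred-suc x) (sym (ℤₚ.suc-pred x)))
  pred-comm S⁻ f x = refl
  pred-comm (P ⊕ Q) f x = cong₂ _+_ (pred-comm P f x) (pred-comm Q f x)
  pred-comm (P ⊙ Q) f x = trans (⟦⟧-cong P (pred-comm Q f) x) (pred-comm P (⟦ Q ⟧ f) x)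
  pred-comm (q ∙ P) f x = cong (q *_) (pred-comm P f x)

  ⟦⟧-comm : ∀ P Q f x → ⟦ P ⟧ (⟦ Q ⟧ f) x ≡ ⟦ Q ⟧ (⟦ P ⟧ f) x
  ⟦⟧-comm I Q f x = refl
  ⟦⟧-comm S Q f x = sym (suc-comm Q f x)
  ⟦⟧-comm S⁻ Q f x = sym (pred-comm Q f x)
  ⟦⟧-comm (P ⊕ P′) Q f x = trans (cong₂ _+_ (⟦⟧-comm P Q f x) (⟦⟧-comm P′ Q f x))
    (sym (⟦⟧-+ Q (⟦ P ⟧ f) (⟦ P′ ⟧ f) x))
  ⟦⟧-comm (P ⊙ P′) Q f x = trans (⟦⟧-cong P (⟦⟧-comm P′ Q f) x) (⟦⟧-comm P Q (⟦ P′ ⟧ f) x)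
  ⟦⟧-comm (q ∙ P) Q f x = trans (cong (q *_) (⟦⟧-comm P Q f x)) (sym (⟦⟧-* Q q (⟦ P ⟧ f) x))

  pow-+ : ∀ P m n f x → ⟦ P ^ᵒ (m ℕ.+ n) ⟧ f x ≡ ⟦ P ^ᵒ m ⟧ (⟦ P ^ᵒ n ⟧ f) x
  pow-+ P zero n f x = refl
  pow-+ P (suc m) n f x = ⟦⟧-cong P (pow-+ P m n f) x

  Bd : (ℤ → ℚ) → ℚ → Set
  Bd f B = ∀ x → ∣ f x ∣ ≤ B

  Contraction : Op → Set
  Contraction P = ∀ {f B} → Bd f B → Bd (⟦ P ⟧ f) B

  T-contraction : Contraction T
  T-contraction b x = abs-avg (b x) (b (ℤ.suc x))

  private
    L-form : ∀ x y z → ½ * x + ¼ * (y + z) ≡ ½ * (x + ½ * (y + z))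
    L-form = solve-∀ ring

  L-contraction : Contraction L
  L-contraction {f} b x = abs-subst (L-form (f x) (f (ℤ.suc x)) (f (ℤ.pred x)))
    (abs-avg (b x) (abs-avg (b (ℤ.suc x)) (b (ℤ.pred x))))

  pow-contraction : ∀ {P} → Contraction P → ∀ n → Contraction (P ^ᵒ n)
  pow-contraction c zero b = b
  pow-contraction c (suc n) b = c (pow-contraction c n b)

  Bd-resp : ∀ {f g B} → (∀ x → g x ≡ f x) → Bd f B → Bd g B
  Bd-resp e b x = abs-subst (e x) (b x)

  private
    ∇-form : ∀ x y → x + (- 1ℚ) * y ≡ x - y
    ∇-form = solve-∀ ring

  ∇-def : ∀ f x → ⟦ ∇ ⟧ f x ≡ f (ℤ.suc x) - f x
  ∇-def f x = ∇-form (f (ℤ.suc x)) (f x)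

  ∇-bd : ∀ {f B} → Bd f B → Bd (⟦ ∇ ⟧ f) (B + B)
  ∇-bd {f} b x = abs-subst (∇-def f x) (abs-- (b (ℤ.suc x)) (b x))

-- The walk of carry and weight driven by the digits of t.

module CarryWalk where

  open import Data.Rational
  open import Data.Rational.Properties
  open import Tactic.RingSolver using (solve-∀)
  open Operators

  St : Set
  St = Bool → ℤ → ℚ

  Bits : Set
  Bits = List Bool

  s : Bool → ℚ
  s false = 1ℚ
  s true = - 1ℚ

  -- The state is the carry c together with the current value x of w (X + t) - w X for random X.
  -- A digit τ equal to c leaves the digit of X alone and carries c on; otherwise the digit of X
  -- flips, and the old digit is the new carry.
  mix : St → ℤ → ℚ
  mix h x = ½ * (h false (ℤ.suc x) + h true (ℤ.pred x))

  step : Bool → St → St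
  step false h false x = h false x
  step false h true  x = mix h x
  step true  h true  x = h true x
  step true  h false x = mix h x

  -- The head of a bit string is its most significant digit, so it is processed last.
  U : Bits → St → St
  U [] h = h
  U (τ ∷ t) h = U t (step τ h)

  step-cong : ∀ τ {h g} → (∀ c x → h c x ≡ g c x) → ∀ c x → step τ h c x ≡ step τ g c x
  step-cong false e false x = e _ _
  step-cong false e true x = cong₂ (λ a b → ½ * (a + b)) (e _ _) (e _ _)
  step-cong true e true x = e _ _
  step-cong true e false x = cong₂ (λ a b → ½ * (a + b)) (e _ _) (e _ _)

  U-cong : ∀ t {h g} → (∀ c x → h c x ≡ g c x) → ∀ c x → U t h c x ≡ U t g c x
  U-cong [] e = e
  U-cong (τ ∷ t) e = U-cong t (step-cong τ e)

  private
    mix-lin : ∀ a b u v x y →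
      ½ * ((a * u + b * x) + (a * v + b * y)) ≡ a * (½ * (u + v)) + b * (½ * (x + y))
    mix-lin = solve-∀ ring

  step-linear : ∀ τ a b h g c x →
    step τ (λ c x → a * h c x + b * g c x) c x ≡ a * step τ h c x + b * step τ g c x
  step-linear false a b h g false x = refl
  step-linear false a b h g true x = mix-lin a b (h false _) (h true _) (g false _) (g true _)
  step-linear true a b h g true x = refl
  step-linear true a b h g false x = mix-lin a b (h false _) (h true _) (g false _) (g true _)

  U-linear : ∀ t a b h g c x →
    U t (λ c x → a * h c x + b * g c x) c x ≡ a * U t h c x + b * U t g c x
  U-linear [] a b h g c x = refl
  U-linear (τ ∷ t) a b h g c x = trans (U-cong t (step-linear τ a b h g) c x)
    (U-linear t a b (step τ h) (step τ g) c x)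

  BdS : St → ℚ → Set
  BdS h B = ∀ c x → ∣ h c x ∣ ≤ B

  step-bd : ∀ τ {h B} → BdS h B → BdS (step τ h) B
  step-bd false b false x = b _ _
  step-bd false b true x = abs-avg (b _ _) (b _ _)
  step-bd true b true x = b _ _
  step-bd true b false x = abs-avg (b _ _) (b _ _)

  U-bd : ∀ t {h B} → BdS h B → BdS (U t h) B
  U-bd [] b = b
  U-bd (τ ∷ t) b = U-bd t (step-bd τ b)

  infixr 5 _⟨$⟩_

  _⟨$⟩_ : Op → St → St
  (P ⟨$⟩ h) c = ⟦ P ⟧ (h c)

  private
    op-mix : ∀ P h x → ⟦ P ⟧ (mix h) x ≡ mix (P ⟨$⟩ h) x
    op-mix P h x = trans (⟦⟧-* P ½ (λ y → h false (ℤ.suc y) + h true (ℤ.pred y)) x)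
      (cong (½ *_) (trans (⟦⟧-+ P (λ y → h false (ℤ.suc y)) (λ y → h true (ℤ.pred y)) x)
        (cong₂ _+_ (suc-comm P (h false) x) (pred-comm P (h true) x))))

  step-op : ∀ τ P h c x → (P ⟨$⟩ step τ h) c x ≡ step τ (P ⟨$⟩ h) c x
  step-op false P h false x = refl
  step-op false P h true x = op-mix P h x
  step-op true P h true x = refl
  step-op true P h false x = op-mix P h x

  U-op : ∀ t P h c x → (P ⟨$⟩ U t h) c x ≡ U t (P ⟨$⟩ h) c x
  U-op [] P h c x = refl
  U-op (τ ∷ t) P h c x = trans (U-op t P (step τ h) c x)
    (U-cong t (step-op τ P h) c x)

  U-++ : ∀ t u h c x → U (t ++ u) h c x ≡ U u (U t h) c x
  U-++ [] u h c x = refl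
  U-++ (τ ∷ t) u h c x = U-++ t u (step τ h) c x

  const : (ℤ → ℚ) → St
  const f _ = f

  -- The carry into the lowest digit is a fair coin here; the cyclic condition that it equals the
  -- outgoing carry is handled separately, in `open-cycle`.
  Av : Bits → St → ℤ → ℚ
  Av t h x = ½ * (U t h false x + U t h true x)

  Av-cong : ∀ t {h g} → (∀ c x → h c x ≡ g c x) → ∀ x → Av t h x ≡ Av t g x
  Av-cong t e x = cong₂ (λ a b → ½ * (a + b)) (U-cong t e false x) (U-cong t e true x)

  Av-linear : ∀ t a b h g x →
    Av t (λ c x → a * h c x + b * g c x) x ≡ a * Av t h x + b * Av t g x
  Av-linear t a b h g x = trans
    (cong₂ (λ u v → ½ * (u + v)) (U-linear t a b h g false x) (U-linear t a b h g true x))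
    (mix-lin a b (U t h false x) (U t h true x) (U t g false x) (U t g true x))

  private
    lin₃ : ∀ x y → 1ℚ * x + 1ℚ * y ≡ x + y
    lin₃ = solve-∀ ring

  Av-+ : ∀ t h g x → Av t (λ c x → h c x + g c x) x ≡ Av t h x + Av t g x
  Av-+ t h g x = trans (Av-cong t (λ c y → sym (lin₃ (h c y) (g c y))) x)
    (trans (Av-linear t 1ℚ 1ℚ h g x) (lin₃ (Av t h x) (Av t g x)))

  Av-bd : ∀ t {h B} → BdS h B → Bd (Av t h) B
  Av-bd t b x = abs-avg (U-bd t b false x) (U-bd t b true x)

  Av-op : ∀ t P h x → ⟦ P ⟧ (Av t h) x ≡ Av t (P ⟨$⟩ h) x
  Av-op t P h x = trans (⟦⟧-* P ½ (λ y → U t h false y + U t h true y) x)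
    (cong (½ *_) (trans (⟦⟧-+ P (U t h false) (U t h true) x)
      (cong₂ _+_ (U-op t P h false x) (U-op t P h true x))))

  avg : ℕ → (Bits → ℚ) → ℚ
  avg zero X = X []
  avg (suc n) X = ½ * (avg n (λ t → X (false ∷ t)) + avg n (λ t → X (true ∷ t)))

  avg-cong : ∀ n {X Y} → (∀ t → X t ≡ Y t) → avg n X ≡ avg n Y
  avg-cong zero e = e []
  avg-cong (suc n) e =
    cong₂ (λ a b → ½ * (a + b)) (avg-cong n (λ t → e (false ∷ t))) (avg-cong n (λ t → e (true ∷ t)))

  avg-linear : ∀ n a b X Y → avg n (λ t → a * X t + b * Y t) ≡ a * avg n X + b * avg n Y
  avg-linear zero a b X Y = refl
  avg-linear (suc n) a b X Y = trans
    (cong₂ (λ u v → ½ * (u + v)) (avg-linear n a b _ _) (avg-linear n a b _ _))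
    (mix-lin a b (avg n (λ t → X (false ∷ t))) (avg n (λ t → X (true ∷ t)))
      (avg n (λ t → Y (false ∷ t))) (avg n (λ t → Y (true ∷ t))))

  avg-+ : ∀ n X Y → avg n (λ t → X t + Y t) ≡ avg n X + avg n Y
  avg-+ n X Y = trans (avg-cong n (λ t → sym (lin₃ (X t) (Y t))))
    (trans (avg-linear n 1ℚ 1ℚ X Y) (lin₃ (avg n X) (avg n Y)))

  private
    lin₄ : ∀ q x → q * x + 0ℚ * x ≡ q * x
    lin₄ = solve-∀ ring

  avg-* : ∀ n q X → avg n (λ t → q * X t) ≡ q * avg n X
  avg-* n q X = trans (avg-cong n (λ t → sym (lin₄ q (X t))))
    (trans (avg-linear n q 0ℚ X X) (lin₄ q (avg n X)))

  avg-mono : ∀ n {X Y} → (∀ t → X t ≤ Y t) → avg n X ≤ avg n Y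
  avg-mono zero p = p []
  avg-mono (suc n) p = *-mono 0≤½
    (+-mono-≤ (avg-mono n (λ t → p (false ∷ t))) (avg-mono n (λ t → p (true ∷ t))))

  avg-const : ∀ n c → avg n (λ _ → c) ≡ c
  avg-const zero c = refl
  avg-const (suc n) c = trans (cong (λ a → ½ * (a + a)) (avg-const n c)) (half-double c)

  avg-≤-const : ∀ n {X B} → (∀ t → X t ≤ B) → avg n X ≤ B
  avg-≤-const n {X} {B} p = subst (avg n X ≤_) (avg-const n B) (avg-mono n p)

  avg-++ : ∀ m n X → avg (m ℕ.+ n) X ≡ avg m (λ t → avg n (λ u → X (t ++ u)))
  avg-++ zero n X = refl
  avg-++ (suc m) n X = cong₂ (λ a b → ½ * (a + b)) (avg-++ m n _) (avg-++ m n _)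

  avg-swap : ∀ m n (X : Bits → Bits → ℚ) →
    avg m (λ t → avg n (X t)) ≡ avg n (λ u → avg m (λ t → X t u))
  avg-swap zero n X = refl
  avg-swap (suc m) n X = trans
    (cong₂ (λ a b → ½ * (a + b)) (avg-swap m n _) (avg-swap m n _))
    (trans (cong (½ *_) (sym (avg-+ n _ _))) (sym (avg-* n ½ _)))

  -- `α` is the mean of h at the end of the walk. In `κ` the outgoing carry enters through its sign:
  -- up to a factor ½ and a sign, `κ t` of `Δ h` is the increment of `α` caused by a new top digit
  -- (see `α-∷`).
  α κ : Bits → (ℤ → ℚ) → ℤ → ℚ
  α t h = Av t (const h)
  κ t h = Av t (λ c x → s c * h x)

  private
    stay : ∀ x y z → x ≡ (½ * x + ¼ * (y + z)) + (- ½) * (½ * (y + z) + - 1ℚ * x)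
    stay = solve-∀ ring
    flip : ∀ x y z → ½ * (y + z) ≡ (½ * x + ¼ * (y + z)) + ½ * (½ * (y + z) + - 1ℚ * x)
    flip = solve-∀ ring
    s-ff : ∀ w → (- ½) * w ≡ ((- ½) * 1ℚ) * (1ℚ * w)
    s-ff = solve-∀ ring
    s-ft : ∀ w → ½ * w ≡ ((- ½) * 1ℚ) * (- 1ℚ * w)
    s-ft = solve-∀ ring
    s-tf : ∀ w → ½ * w ≡ ((- ½) * - 1ℚ) * (1ℚ * w)
    s-tf = solve-∀ ring
    s-tt : ∀ w → (- ½) * w ≡ ((- ½) * - 1ℚ) * (- 1ℚ * w)
    s-tt = solve-∀ ring

    one : ∀ x → x ≡ 1ℚ * x
    one = solve-∀ ring

    -- A digit equal to the carry gives h = `L` h - ½ `Δ` h, a different digit gives the mean of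
    -- both neighbours, `L` h + ½ `Δ` h; the product of the two signs tells the cases apart.
    step-const : ∀ τ h c x →
      step τ (const h) c x ≡ 1ℚ * ⟦ L ⟧ h x + ((- ½) * s τ) * (s c * ⟦ Δ ⟧ h x)
    step-const false h false x = trans (stay (h x) (h (ℤ.suc x)) (h (ℤ.pred x)))
      (cong₂ _+_ (one (⟦ L ⟧ h x)) (s-ff (⟦ Δ ⟧ h x)))
    step-const false h true x = trans (flip (h x) (h (ℤ.suc x)) (h (ℤ.pred x)))
      (cong₂ _+_ (one (⟦ L ⟧ h x)) (s-ft (⟦ Δ ⟧ h x)))
    step-const true h false x = trans (flip (h x) (h (ℤ.suc x)) (h (ℤ.pred x)))
      (cong₂ _+_ (one (⟦ L ⟧ h x)) (s-tf (⟦ Δ ⟧ h x)))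
    step-const true h true x = trans (stay (h x) (h (ℤ.suc x)) (h (ℤ.pred x)))
      (cong₂ _+_ (one (⟦ L ⟧ h x)) (s-tt (⟦ Δ ⟧ h x)))

  α-∷ : ∀ τ t h x →
    α (τ ∷ t) h x ≡ 1ℚ * α t (⟦ L ⟧ h) x + ((- ½) * s τ) * κ t (⟦ Δ ⟧ h) x
  α-∷ τ t h x = trans (Av-cong t (step-const τ h) x)
    (Av-linear t 1ℚ ((- ½) * s τ) (const (⟦ L ⟧ h)) (λ c y → s c * ⟦ Δ ⟧ h y) x)

  ∣s∣≤1 : ∀ c → ∣ s c ∣ ≤ 1ℚ
  ∣s∣≤1 false = ≤-refl
  ∣s∣≤1 true = ≤-refl

  κ-bd : ∀ t {h B} → Bd h B → Bd (κ t h) B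
  κ-bd t {h} {B} b = Av-bd t (λ c x → abs-mono (≤-reflexive (*-identityˡ B)) (abs-* (∣s∣≤1 c) (b x)))

  private
    pyth : ∀ a k m → ½ * (((1ℚ * a + ((- ½) * 1ℚ) * k) - m) * ((1ℚ * a + ((- ½) * 1ℚ) * k) - m)
        + ((1ℚ * a + ((- ½) * - 1ℚ) * k) - m) * ((1ℚ * a + ((- ½) * - 1ℚ) * k) - m))
      ≡ (a - m) * (a - m) + ¼ * (k * k)
    pyth = solve-∀ ring

  sq : ℚ → ℚ
  sq x = x * x

  -- The increments of α t h over the random bits of t are orthogonal.
  second-moment-suc : ∀ n h x m →
    avg (suc n) (λ t → sq (α t h x - m))
      ≡ avg n (λ t → sq (α t (⟦ L ⟧ h) x - m)) + ¼ * avg n (λ t → sq (κ t (⟦ Δ ⟧ h) x))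
  second-moment-suc n h x m =
    trans (cong (½ *_) (sym (avg-+ n _ _)))
    (trans (sym (avg-* n ½ _))
    (trans (avg-cong n (λ t → trans
        (cong₂ (λ a b → ½ * (sq (a - m) + sq (b - m))) (α-∷ false t h x) (α-∷ true t h x))
        (pyth (α t (⟦ L ⟧ h) x) (κ t (⟦ Δ ⟧ h) x) m)))
    (trans (avg-+ n _ _) (cong (avg n (λ t → sq (α t (⟦ L ⟧ h) x - m)) +_) (avg-* n ¼ _)))))

-- Second moments over random t.

module Variance where

  open import Data.Rational
  open import Data.Rational.Properties
  open import Tactic.RingSolver using (solve-∀)
  open Operators
  open CarryWalk

  ι : ℕ → ℚ
  ι zero = 0ℚ
  ι (suc n) = 1ℚ + ι n

  0≤ι : ∀ n → 0ℚ ≤ ι n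
  0≤ι zero = ≤-refl
  0≤ι (suc n) = 0≤+ 0≤1 (0≤ι n)

  ι-+ : ∀ m n → ι (m ℕ.+ n) ≡ ι m + ι n
  ι-+ zero n = sym (+-identityˡ (ι n))
  ι-+ (suc m) n = trans (cong (1ℚ +_) (ι-+ m n)) (sym (+-assoc 1ℚ (ι m) (ι n)))

  private
    mul-suc : ∀ m n → n + m * n ≡ (1ℚ + m) * n
    mul-suc = solve-∀ ring

  ι-* : ∀ m n → ι (m ℕ.* n) ≡ ι m * ι n
  ι-* zero n = sym (*-zeroˡ (ι n))
  ι-* (suc m) n = trans (ι-+ n (m ℕ.* n))
    (trans (cong (ι n +_) (ι-* m n)) (mul-suc (ι m) (ι n)))

  ι-mono : ∀ {m n} → m ℕ.≤ n → ι m ≤ ι n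
  ι-mono {n = n} ℕ.z≤n = 0≤ι n
  ι-mono (ℕ.s≤s p) = +-monoʳ-≤ 1ℚ (ι-mono p)

  private
    v₁ : ∀ a n b → (a + n * b) + b ≡ a + (1ℚ + n) * b
    v₁ = solve-∀ ring

  L-op-bd : ∀ P h {B} → Bd (⟦ P ⟧ h) B → Bd (⟦ P ⟧ (⟦ L ⟧ h)) B
  L-op-bd P h b = Bd-resp (⟦⟧-comm P L h) (L-contraction b)

  -- Each digit replaces h by `L` h, which does not enlarge `Δ h`, and adds at most ¼ B². The centre
  -- m is free: it is 0 in one use and the mean in another.
  α-variance : ∀ n h x m B → Bd (⟦ Δ ⟧ h) B →
    avg n (λ t → sq (α t h x - m)) ≤ sq (⟦ L ^ᵒ n ⟧ h x - m) + ι n * (¼ * (B * B))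
  α-variance zero h x m B b = ≤-reflexive (base (h x) m (¼ * (B * B)))
    where
    base : ∀ a m c → (½ * (a + a) - m) * (½ * (a + a) - m) ≡ (a - m) * (a - m) + 0ℚ * c
    base = solve-∀ ring
  α-variance (suc n) h x m B b = ≤-trans (≤-reflexive (second-moment-suc n h x m))
    (≤-trans (+-mono-≤ (α-variance n (⟦ L ⟧ h) x m B (L-op-bd Δ h b))
                       (*-mono 0≤¼ (avg-≤-const n (λ t → sq-≤ (κ-bd t b x)))))
    (≤-reflexive (trans (v₁ (sq (⟦ L ^ᵒ n ⟧ (⟦ L ⟧ h) x - m)) (ι n) (¼ * (B * B)))
      (cong (λ z → sq (z - m) + (1ℚ + ι n) * (¼ * (B * B))) (⟦⟧-comm (L ^ᵒ n) L h x)))))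

  -- The mean sign of the carry out of t for a fair carry in: the digit τ sends the sign of a carry
  -- c to ½ (`s τ` + `s c`) on average.
  σ : Bits → ℚ
  σ [] = 0ℚ
  σ (τ ∷ t) = ½ * (s τ + σ t)

  ∣σ∣≤1 : ∀ t → ∣ σ t ∣ ≤ 1ℚ
  ∣σ∣≤1 [] = 0≤1
  ∣σ∣≤1 (τ ∷ t) = abs-avg (∣s∣≤1 τ) (∣σ∣≤1 t)

  private
    -- What `step-s` leaves over. It involves first differences of h only, since without it the
    -- identity is exact for constant h.
    rem : Bool → ℚ → (ℤ → ℚ) → St
    rem false q h false x = 0ℚ
    rem true q h true x = 0ℚ
    rem false q h true x = ½ * (⟦ ∇ ⟧ h x + ⟦ ∇ ⟧ h (ℤ.pred x)) - q * (½ * (⟦ ∇ ⟧ h x - ⟦ ∇ ⟧ h (ℤ.pred x)))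
    rem true q h false x = ½ * (⟦ ∇ ⟧ h x + ⟦ ∇ ⟧ h (ℤ.pred x)) - q * (½ * (⟦ ∇ ⟧ h x - ⟦ ∇ ⟧ h (ℤ.pred x)))

    k-ff : ∀ a u → 1ℚ * a ≡ ½ * (1ℚ * a) + (- ½ * u) * a + 0ℚ + (½ * (1ℚ + u)) * a
    k-ff = solve-∀ ring
    k-tt : ∀ a u → - 1ℚ * a ≡ ½ * (- 1ℚ * a) + (- ½ * u) * a + 0ℚ + (½ * (- 1ℚ + u)) * a
    k-tt = solve-∀ ring
    k-ft : ∀ a y z u → ½ * (1ℚ * y + - 1ℚ * z) ≡ ½ * (- 1ℚ * a) + (- ½ * u) * a
      + (½ * ((y + - 1ℚ * a) + (a + - 1ℚ * z)) - (½ * (1ℚ + u)) * (½ * ((y + - 1ℚ * a) - (a + - 1ℚ * z))))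
      + (½ * (1ℚ + u)) * (½ * (y + z))
    k-ft = solve-∀ ring
    k-tf : ∀ a y z u → ½ * (1ℚ * y + - 1ℚ * z) ≡ ½ * (1ℚ * a) + (- ½ * u) * a
      + (½ * ((y + - 1ℚ * a) + (a + - 1ℚ * z)) - (½ * (- 1ℚ + u)) * (½ * ((y + - 1ℚ * a) - (a + - 1ℚ * z))))
      + (½ * (- 1ℚ + u)) * (½ * (y + z))
    k-tf = solve-∀ ring

    -- With u = `σ t` the factor ½ (`s τ` + u) is `σ (τ ∷ t)`. Moving the last term to the left
    -- shows that the error κ - σ α of t is halved by a new digit, up to `rem`.
    step-s : ∀ τ u h c x → step τ (λ c x → s c * h x) c x ≡
      ½ * (s c * h x) + (- ½ * u) * h x + rem τ (½ * (s τ + u)) h c x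
        + (½ * (s τ + u)) * step τ (const h) c x
    step-s false u h false x = k-ff (h x) u
    step-s true u h true x = k-tt (h x) u
    step-s false u h true x = trans (k-ft (h x) (h (ℤ.suc x)) (h (ℤ.pred x)) u)
      (cong (λ w → ½ * (- 1ℚ * h x) + (- ½ * u) * h x
        + (½ * ((h (ℤ.suc x) + - 1ℚ * h x) + (w + - 1ℚ * h (ℤ.pred x))) - (½ * (1ℚ + u)) * (½ * ((h (ℤ.suc x) + - 1ℚ * h x) - (w + - 1ℚ * h (ℤ.pred x)))))
        + (½ * (1ℚ + u)) * (½ * (h (ℤ.suc x) + h (ℤ.pred x)))) (cong h (sym (ℤₚ.suc-pred x))))
    step-s true u h false x = trans (k-tf (h x) (h (ℤ.suc x)) (h (ℤ.pred x)) u)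
      (cong (λ w → ½ * (1ℚ * h x) + (- ½ * u) * h x
        + (½ * ((h (ℤ.suc x) + - 1ℚ * h x) + (w + - 1ℚ * h (ℤ.pred x))) - (½ * (- 1ℚ + u)) * (½ * ((h (ℤ.suc x) + - 1ℚ * h x) - (w + - 1ℚ * h (ℤ.pred x)))))
        + (½ * (- 1ℚ + u)) * (½ * (h (ℤ.suc x) + h (ℤ.pred x)))) (cong h (sym (ℤₚ.suc-pred x))))

    rem-val : ∀ {q a b G} → ∣ q ∣ ≤ 1ℚ → ∣ a ∣ ≤ G → ∣ b ∣ ≤ G →
      ∣ ½ * (a + b) - q * (½ * (a - b)) ∣ ≤ G + G
    rem-val {q} {a} {b} {G} hq ha hb = abs-- (abs-avg ha hb)
      (abs-mono (≤-reflexive (*-identityˡ G)) (abs-* hq (abs-avg ha (abs-neg hb))))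

    rem-bd : ∀ τ q h {G} → ∣ q ∣ ≤ 1ℚ → Bd (⟦ ∇ ⟧ h) G → BdS (rem τ q h) (G + G)
    rem-bd false q h hq b false x = 0≤+ (abs⇒0≤ (b x)) (abs⇒0≤ (b x))
    rem-bd true q h hq b true x = 0≤+ (abs⇒0≤ (b x)) (abs⇒0≤ (b x))
    rem-bd false q h hq b true x = rem-val hq (b x) (b (ℤ.pred x))
    rem-bd true q h hq b false x = rem-val hq (b x) (b (ℤ.pred x))

    κ-∷ : ∀ τ t h x → κ (τ ∷ t) h x ≡
      ½ * κ t h x + (- ½ * σ t) * α t h x + Av t (rem τ (σ (τ ∷ t)) h) x + σ (τ ∷ t) * α (τ ∷ t) h x
    κ-∷ τ t h x =
      trans (Av-cong t (λ c y → trans (step-s τ u h c y) (c₁ (½ * (s c * h y) + (- ½ * u) * h y + rem τ q h c y) (q * step τ (const h) c y))) x)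
      (trans (Av-linear t 1ℚ 1ℚ (λ c y → ½ * (s c * h y) + (- ½ * u) * h y + rem τ q h c y) (λ c y → q * step τ (const h) c y) x)
      (trans (sym (c₁ (Av t (λ c y → ½ * (s c * h y) + (- ½ * u) * h y + rem τ q h c y) x) (Av t (λ c y → q * step τ (const h) c y) x))) (cong₂ _+_
        (trans (Av-+ t (λ c y → ½ * (s c * h y) + (- ½ * u) * h y) (rem τ q h) x)
          (cong (_+ Av t (rem τ q h) x) (Av-linear t ½ (- ½ * u) (λ c y → s c * h y) (const h) x)))
        (trans (Av-cong t (λ c y → c₂ q (step τ (const h) c y)) x)
          (trans (Av-linear t q 0ℚ (step τ (const h)) (step τ (const h)) x)
            (sym (c₂ q (α (τ ∷ t) h x))))))))
      where
      u = σ t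
      q = σ (τ ∷ t)
      c₁ : ∀ a b → a + b ≡ 1ℚ * a + 1ℚ * b
      c₁ = solve-∀ ring
      c₂ : ∀ q a → q * a ≡ q * a + 0ℚ * a
      c₂ = solve-∀ ring

  -- The last carry is a short-range function of the bits, so it decouples from a slowly varying h.
  κ≈σα : ∀ t h x G → Bd (⟦ ∇ ⟧ h) G →
    ∣ κ t h x - σ t * α t h x ∣ ≤ (G + G) + (G + G)
  κ≈σα [] h x G b = abs-subst (z (h x)) (0≤+ (0≤+ 0≤G 0≤G) (0≤+ 0≤G 0≤G))
    where
    0≤G = abs⇒0≤ (b x)
    z : ∀ a → ½ * (1ℚ * a + - 1ℚ * a) - 0ℚ * (½ * (a + a)) ≡ 0ℚ
    z = solve-∀ ring
  κ≈σα (τ ∷ t) h x G b = abs-subst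
    (trans (cong (_- σ (τ ∷ t) * α (τ ∷ t) h x) (κ-∷ τ t h x))
      (e (κ t h x) (α t h x) (σ t) (Av t (rem τ (σ (τ ∷ t)) h) x) (σ (τ ∷ t) * α (τ ∷ t) h x)))
    -- 4 G is the fixed point of e ↦ ½ e + 2 G.
    (abs-mono (≤-reflexive (f G))
      (abs-+ (abs-scale 0≤½ (κ≈σα t h x G b))
             (Av-bd t (rem-bd τ (σ (τ ∷ t)) h (∣σ∣≤1 (τ ∷ t)) b) x)))
    where
    e : ∀ k a u r m → (½ * k + (- ½ * u) * a + r + m) - m ≡ ½ * (k - u * a) + r
    e = solve-∀ ring
    f : ∀ G → ½ * ((G + G) + (G + G)) + (G + G) ≡ (G + G) + (G + G)
    f = solve-∀ ring

  private
    sq-+ : ∀ a b → a * a + a * a + (b * b + b * b) ≡ (a + b) * (a + b) + (a - b) * (a - b)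
    sq-+ = solve-∀ ring

  sq-+-≤ : ∀ {a b A B} → sq a ≤ A → sq b ≤ B → sq (a + b) ≤ A + A + (B + B)
  sq-+-≤ {a} {b} p q = ≤-trans (≤-by (0≤sq (a - b)) (sq-+ a b))
    (+-mono-≤ (+-mono-≤ p p) (+-mono-≤ q q))

  quad : ℚ → ℚ
  quad G = (G + G) + (G + G)

  κ-sq : ∀ t h x G → Bd (⟦ ∇ ⟧ h) G →
    sq (κ t h x) ≤ sq (quad G) + sq (quad G) + (sq (α t h x) + sq (α t h x))
  κ-sq t h x G b = subst (λ z → sq z ≤ sq (quad G) + sq (quad G) + (sq (α t h x) + sq (α t h x))) (e (κ t h x) (σ t * α t h x))
    (sq-+-≤ {κ t h x - σ t * α t h x} {σ t * α t h x} (sq-≤ (κ≈σα t h x G b))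
      (≤-trans (≤-reflexive (f (σ t) (α t h x)))
      (≤-trans (*-mono₂ (0≤sq (σ t)) (0≤sq (α t h x)) (sq-≤ (∣σ∣≤1 t)) ≤-refl)
        (≤-reflexive (*-identityˡ (sq (α t h x)))))))
    where
    e : ∀ a b → a - b + b ≡ a
    e = solve-∀ ring
    f : ∀ a b → (a * b) * (a * b) ≡ (a * a) * (b * b)
    f = solve-∀ ring

  -- Bounds the second moment of one increment: 2 (4 G)² for replacing κ by σ α, and 2 `M`, where
  -- `M` bounds the second moment of `α t` of `Δ h` by `α-variance` with centre 0.
  incr : ℕ → ℚ → ℚ → ℚ
  incr N G B = ¼ * (sq (quad G) + sq (quad G) + (M + M))
    where M = sq G + ι N * (¼ * (B * B))

  -- Smallness of the mean of `Δ h` at the single point x replaces a uniform bound on `Δ h`. It is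
  -- asked for every p because the induction passes from h to `L` h; `N` stays fixed so that all
  -- increments share one bound.
  α-variance-odd : ∀ n N h x G B → n ℕ.≤ N → (∀ p → ∣ ⟦ L ^ᵒ p ⟧ (⟦ Δ ⟧ h) x ∣ ≤ G) →
    Bd (⟦ ∇ ⟧ (⟦ Δ ⟧ h)) G → Bd (⟦ Δ ⟧ (⟦ Δ ⟧ h)) B →
    avg n (λ t → sq (α t h x - ⟦ L ^ᵒ n ⟧ h x)) ≤ ι n * incr N G B
  α-variance-odd zero N h x G B n≤N c g b = ≤-reflexive (z (h x) (incr N G B))
    where
    z : ∀ a b → (½ * (a + a) - a) * (½ * (a + a) - a) ≡ 0ℚ * b
    z = solve-∀ ring
  α-variance-odd (suc n) N h x G B n<N c g b =
    ≤-trans (≤-reflexive (second-moment-suc n h x (⟦ L ⟧ (⟦ L ^ᵒ n ⟧ h) x)))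
    (≤-trans (+-mono-≤
      (≤-trans (≤-reflexive (avg-cong n (λ t → cong (λ z → sq (α t (⟦ L ⟧ h) x - z)) (⟦⟧-comm L (L ^ᵒ n) h x))))
        (α-variance-odd n N (⟦ L ⟧ h) x G B n≤N
          (λ p → abs-subst (trans (⟦⟧-cong (L ^ᵒ p) (⟦⟧-comm Δ L h) x) (⟦⟧-comm (L ^ᵒ p) L (⟦ Δ ⟧ h) x)) (c (suc p)))
          (Bd-resp (⟦⟧-cong ∇ (⟦⟧-comm Δ L h)) (L-op-bd ∇ (⟦ Δ ⟧ h) g))
          (Bd-resp (⟦⟧-cong Δ (⟦⟧-comm Δ L h)) (L-op-bd Δ (⟦ Δ ⟧ h) b))))
      (*-mono 0≤¼ κ²))
    (≤-reflexive (d (ι n) (incr N G B))))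
    where
    n≤N : n ℕ.≤ N
    n≤N = ℕₚ.≤-trans (ℕₚ.n≤1+n n) n<N
    d : ∀ n w → n * w + w ≡ (1ℚ + n) * w
    d = solve-∀ ring
    0≤B² : 0ℚ ≤ ¼ * (B * B)
    0≤B² = 0≤* 0≤¼ (0≤sq B)
    M = sq G + ι N * (¼ * (B * B))
    sub0 : ∀ z → z - 0ℚ ≡ z
    sub0 = solve-∀ ring
    α² : avg n (λ t → sq (α t (⟦ Δ ⟧ h) x)) ≤ M
    α² = ≤-trans (≤-reflexive (avg-cong n (λ t → cong sq (sym (sub0 (α t (⟦ Δ ⟧ h) x))))))
      (≤-trans (α-variance n (⟦ Δ ⟧ h) x 0ℚ B b)
        (+-mono-≤ (sq-≤ (abs-subst (sub0 _) (c n)))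
          (*-mono₂ (0≤ι n) 0≤B² (ι-mono n≤N) ≤-refl)))
    κ² : avg n (λ t → sq (κ t (⟦ Δ ⟧ h) x)) ≤ sq (quad G) + sq (quad G) + (M + M)
    κ² = ≤-trans (avg-mono n (λ t → κ-sq t (⟦ Δ ⟧ h) x G g))
      (≤-trans (≤-reflexive (trans (avg-+ n (λ _ → sq (quad G) + sq (quad G)) (λ t → sq (α t (⟦ Δ ⟧ h) x) + sq (α t (⟦ Δ ⟧ h) x))) (cong₂ _+_ (avg-const n (sq (quad G) + sq (quad G))) (avg-+ n _ _))))
        (+-monoʳ-≤ (sq (quad G) + sq (quad G)) (+-mono-≤ α² α²)))

-- Smoothing by fair coins.

module Coins where

  open import Data.Rational
  open import Data.Rational.Properties
  open import Tactic.RingSolver using (solve-∀)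
  open Operators
  open CarryWalk
  open Variance

  -- Coupling by reflection: two walkers at distance d, moving in opposite directions, meet before
  -- time m and before reaching distance n, except with probability at most φ n m d / n².
  φ : ℕ → ℕ → ℕ → ℚ
  φ n m d = ι n * ι n - ι m + (ι d * ι n + ι d * ι n) - ι d * ι d

  private
    0≤nonneg-φ : ∀ {n m d} → 0ℚ ≤ n * n - m → 0ℚ ≤ d → d ≤ n →
      0ℚ ≤ n * n - m + (d * n + d * n) - d * d
    0≤nonneg-φ {n} {m} {d} a b c = subst (0ℚ ≤_) (e n m d)
      (0≤+ a (0≤+ (0≤* b (≤⇒0≤ c)) (0≤* b (≤-trans b c))))
      where
      e : ∀ n m d → n * n - m + (d * (n - d) + d * n) ≡ n * n - m + (d * n + d * n) - d * d
      e = solve-∀ ring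

  -- `φ` solves the recursion of the coupling exactly: its mean over the distances d and d + 2 at
  -- time m is its value at d + 1 and m + 1. By m ≤ n² it is nonnegative at distance 0 and at least
  -- n² at distance n, where the trivial bound takes over.
  shift-gap : ∀ n m d f B → d ℕ.≤ n → m ℕ.≤ n ℕ.* n → Bd f B → ∀ x →
    ∣ ι n * ι n * (⟦ S ^ᵒ d ⟧ (⟦ T ^ᵒ m ⟧ f) x - ⟦ T ^ᵒ m ⟧ f x) ∣ ≤ (B + B) * φ n m d
  shift-gap n m d f B d≤n m≤nn b x = go m d d≤n m≤nn x
    where
    0≤B : 0ℚ ≤ B
    0≤B = abs⇒0≤ (b x)
    S-bd : ∀ d {g} → Bd g B → Bd (⟦ S ^ᵒ d ⟧ g) B
    S-bd zero p = p
    S-bd (suc d) p y = S-bd d p (ℤ.suc y)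
    trivial : ∀ m d y → ∣ ι n * ι n * (⟦ S ^ᵒ d ⟧ (⟦ T ^ᵒ m ⟧ f) y - ⟦ T ^ᵒ m ⟧ f y) ∣ ≤ ι n * ι n * (B + B)
    trivial m d y = abs-scale (0≤sq (ι n)) (abs-- (S-bd d Tb y) (Tb y))
      where Tb = pow-contraction T-contraction m b
    room : ∀ {m} → m ℕ.≤ n ℕ.* n → 0ℚ ≤ ι n * ι n - ι m
    room {m} p = ≤⇒0≤ (subst (ι m ≤_) (ι-* n n) (ι-mono p))
    go : ∀ m d → d ℕ.≤ n → m ℕ.≤ n ℕ.* n → ∀ y →
      ∣ ι n * ι n * (⟦ S ^ᵒ d ⟧ (⟦ T ^ᵒ m ⟧ f) y - ⟦ T ^ᵒ m ⟧ f y) ∣ ≤ (B + B) * φ n m d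
    go zero d d≤n m≤ y = ≤-trans (trivial 0 d y)
      (≤-by (0≤* (0≤+ 0≤B 0≤B) (0≤+ (0≤* (0≤ι d) (≤⇒0≤ (ι-mono d≤n))) (0≤* (0≤ι d) (0≤ι n))))
        (e (ι n) (ι d) (B + B)))
      where
      e : ∀ n d B → B * (n * n - 0ℚ + (d * n + d * n) - d * d)
        ≡ n * n * B + B * (d * (n - d) + d * n)
      e = solve-∀ ring
    go (suc m) zero d≤n m≤ y =
      abs-subst (e (ι n * ι n) (⟦ T ^ᵒ suc m ⟧ f y)) (0≤* (0≤+ 0≤B 0≤B) (0≤nonneg-φ (room m≤) ≤-refl (0≤ι n)))
      where
      e : ∀ a b → a * (b - b) ≡ 0ℚ
      e = solve-∀ ring
    go (suc m) (suc d) d≤n m≤ y with suc d ℕ.≟ n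
    ... | yes refl = ≤-trans (trivial (suc m) n y)
      (≤-by (0≤* (0≤+ 0≤B 0≤B) (room m≤)) (e (ι n) (ι (suc m)) (B + B)))
      where
      e : ∀ n m B → B * (n * n - m + (n * n + n * n) - n * n) ≡ n * n * B + B * (n * n - m)
      e = solve-∀ ring
    -- Opposite coins change the distance d + 1 to d + 2 or to d.
    ... | no d≢n = abs-subst
      (trans (cong (λ z → ι n * ι n * (z - ⟦ T ^ᵒ suc m ⟧ f y)) (⟦⟧-comm (S ^ᵒ suc d) T h y))
        (e₁ (ι n * ι n) (⟦ S ^ᵒ d ⟧ h (ℤ.suc y)) (⟦ S ^ᵒ suc d ⟧ h (ℤ.suc y)) (h y) (h (ℤ.suc y))))
      (≤-trans (abs-scale 0≤½ (abs-+
        (go m (suc (suc d)) (ℕₚ.≤∧≢⇒< d≤n d≢n) m≤′ y)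
        (go m d (ℕₚ.≤-trans (ℕₚ.n≤1+n d) d≤n) m≤′ (ℤ.suc y))))
      (≤-reflexive (e₂ (ι n) (ι m) (ι d) (B + B))))
      where
      h = ⟦ T ^ᵒ m ⟧ f
      m≤′ : m ℕ.≤ n ℕ.* n
      m≤′ = ℕₚ.≤-trans (ℕₚ.n≤1+n m) m≤
      e₁ : ∀ c p q u v → c * (½ * (p + q) - ½ * (u + v)) ≡ ½ * (c * (q - u) + c * (p - v))
      e₁ = solve-∀ ring
      e₂ : ∀ n m d B → ½ * (B * (n * n - m + ((1ℚ + (1ℚ + d)) * n + (1ℚ + (1ℚ + d)) * n) - (1ℚ + (1ℚ + d)) * (1ℚ + (1ℚ + d)))
          + B * (n * n - m + (d * n + d * n) - d * d))
        ≡ B * (n * n - (1ℚ + m) + ((1ℚ + d) * n + (1ℚ + d) * n) - (1ℚ + d) * (1ℚ + d))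
      e₂ = solve-∀ ring

  pow : ℚ → ℕ → ℚ
  pow q zero = 1ℚ
  pow q (suc n) = q * pow q n

  0≤pow : ∀ {q} → 0ℚ ≤ q → ∀ n → 0ℚ ≤ pow q n
  0≤pow p zero = 0≤1
  0≤pow p (suc n) = 0≤* p (0≤pow p n)

  pow-exp-+ : ∀ q m n → pow q (m ℕ.+ n) ≡ pow q m * pow q n
  pow-exp-+ q zero n = sym (*-identityˡ (pow q n))
  pow-exp-+ q (suc m) n = trans (cong (q *_) (pow-exp-+ q m n)) (sym (*-assoc q (pow q m) (pow q n)))

  pow-exp-* : ∀ q m n → pow q (m ℕ.* n) ≡ pow (pow q n) m
  pow-exp-* q zero n = refl
  pow-exp-* q (suc m) n = trans (pow-exp-+ q n (m ℕ.* n)) (cong (pow q n *_) (pow-exp-* q m n))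

  pow-mono : ∀ {p q} → 0ℚ ≤ p → p ≤ q → ∀ n → pow p n ≤ pow q n
  pow-mono 0≤p p≤q zero = ≤-refl
  pow-mono 0≤p p≤q (suc n) = *-mono₂ 0≤p (0≤pow (≤-trans 0≤p p≤q) n) p≤q (pow-mono 0≤p p≤q n)

  pow-≤1 : ∀ {q} → 0ℚ ≤ q → q ≤ 1ℚ → ∀ n → pow q n ≤ 1ℚ
  pow-≤1 a b zero = ≤-refl
  pow-≤1 {q} a b (suc n) = ≤-trans (*-mono₂ a 0≤1 b (pow-≤1 a b n)) (≤-reflexive (*-identityˡ 1ℚ))

  pow-antimono : ∀ {q} → 0ℚ ≤ q → q ≤ 1ℚ → ∀ {m n} → m ℕ.≤ n → pow q n ≤ pow q m
  pow-antimono a b {n = n} ℕ.z≤n = pow-≤1 a b n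
  pow-antimono a b (ℕ.s≤s p) = *-mono a (pow-antimono a b p)

  pow-mul : ∀ p q n → pow (p * q) n ≡ pow p n * pow q n
  pow-mul p q zero = refl
  pow-mul p q (suc n) = trans (cong (p * q *_) (pow-mul p q n)) (e p q (pow p n) (pow q n))
    where
    e : ∀ p q a b → p * q * (a * b) ≡ p * a * (q * b)
    e = solve-∀ ring

  2ℚ 4ℚ : ℚ
  2ℚ = 1ℚ + 1ℚ
  4ℚ = 2ℚ + 2ℚ

  -- A block 0,1,0 of t adds an independent fair coin to the digit sum difference.
  cnt : Bits → ℕ
  cnt [] = 0
  cnt (_ ∷ []) = 0
  cnt (_ ∷ _ ∷ []) = 0
  cnt (false ∷ true ∷ false ∷ t) = suc (cnt t)
  cnt (false ∷ true ∷ true ∷ t) = cnt t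
  cnt (false ∷ false ∷ _ ∷ t) = cnt t
  cnt (true ∷ _ ∷ _ ∷ t) = cnt t

  ⅛ ¾ ⅞ : ℚ
  ⅛ = ¼ * ½
  ¾ = ½ + ¼
  ⅞ = ¾ + ⅛

  0≤⅛ : 0ℚ ≤ ⅛
  0≤⅛ = ≤ᵇ⇒≤ _

  0≤⅞ : 0ℚ ≤ ⅞
  0≤⅞ = ≤ᵇ⇒≤ _

  private
    -- `coin` is the share ¼ of a block 0,1,0 in which a fair coin shows, shifted by one if the
    -- incoming carry is 1; `rest` is the remaining mass ¾, of which only boundedness is used.
    coin rest : St → St
    coin h false = h false
    coin h true = ⟦ S ⟧ (h false)
    rest h false = λ x → ⟦ (⅛ + ¼) ∙ S ⊕ ⅛ ∙ I ⟧ (h false) x + ⟦ ¼ ∙ (S⁻ ⊙ S⁻) ⟧ (h true) x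
    rest h true = λ x → ⟦ ⅛ ∙ (S ⊙ S) ⊕ ¼ ∙ I ⟧ (h false) x + ⟦ ⅛ ∙ S⁻ ⊕ ¼ ∙ (S⁻ ⊙ S⁻) ⟧ (h true) x

    blk-f : ∀ a b c → ½ * (a + ½ * (b + c)) ≡
      ¼ * (½ * (b + a)) + 1ℚ * (((⅛ + ¼) * a + ⅛ * b) + ¼ * c)
    blk-f = solve-∀ ring
    blk-t : ∀ a b c d e → ½ * (½ * (a + ½ * (b + c)) + ½ * (d + e)) ≡
      ¼ * (½ * (b + a)) + 1ℚ * ((⅛ * a + ¼ * d) + (⅛ * c + ¼ * e))
    blk-t = solve-∀ ring

    block : ∀ h c x → step false (step true (step false h)) c x ≡
      ¼ * ⟦ T ⟧ (coin h c) x + 1ℚ * rest h c x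
    block h false x rewrite ℤₚ.suc-pred x =
      blk-f (h false (ℤ.suc x)) (h false x) (h true (ℤ.pred (ℤ.pred x)))
    block h true x rewrite ℤₚ.pred-suc x | ℤₚ.suc-pred x =
      blk-t (h false (ℤ.suc (ℤ.suc x))) (h false (ℤ.suc x)) (h true (ℤ.pred x))
        (h false x) (h true (ℤ.pred (ℤ.pred x)))

    coin-bd : ∀ P {h B} → BdS (P ⟨$⟩ h) B → BdS (P ⟨$⟩ coin h) B
    coin-bd P b false x = b false x
    coin-bd P {h} b true x = abs-subst (suc-comm P (h false) x) (b false (ℤ.suc x))

    w-f : ∀ B → ((⅛ + ¼) * B + ⅛ * B) + ¼ * B ≡ ¾ * B
    w-f = solve-∀ ring
    w-t : ∀ B → (⅛ * B + ¼ * B) + (⅛ * B + ¼ * B) ≡ ¾ * B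
    w-t = solve-∀ ring

    ⟦⟧-pair : ∀ P Q R f g x → ⟦ P ⟧ (λ y → ⟦ Q ⟧ f y + ⟦ R ⟧ g y) x ≡
      ⟦ Q ⟧ (⟦ P ⟧ f) x + ⟦ R ⟧ (⟦ P ⟧ g) x
    ⟦⟧-pair P Q R f g x = trans (⟦⟧-+ P (⟦ Q ⟧ f) (⟦ R ⟧ g) x)
      (cong₂ _+_ (⟦⟧-comm P Q f x) (⟦⟧-comm P R g x))

    rest-bd : ∀ P {h B} → BdS (P ⟨$⟩ h) B → BdS (P ⟨$⟩ rest h) (¾ * B)
    rest-bd P {h} {B} b false x = abs-subst
      (⟦⟧-pair P ((⅛ + ¼) ∙ S ⊕ ⅛ ∙ I) (¼ ∙ (S⁻ ⊙ S⁻)) (h false) (h true) x)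
      (abs-mono (≤-reflexive (w-f B)) (abs-+ (abs-+ (abs-scale (0≤+ 0≤⅛ 0≤¼) (b false _)) (abs-scale 0≤⅛ (b false _)))
        (abs-scale 0≤¼ (b true _))))
    rest-bd P {h} {B} b true x = abs-subst
      (⟦⟧-pair P (⅛ ∙ (S ⊙ S) ⊕ ¼ ∙ I) (⅛ ∙ S⁻ ⊕ ¼ ∙ (S⁻ ⊙ S⁻)) (h false) (h true) x)
      (abs-mono (≤-reflexive (w-t B)) (abs-+ (abs-+ (abs-scale 0≤⅛ (b false _)) (abs-scale 0≤¼ (b false _)))
        (abs-+ (abs-scale 0≤⅛ (b true _)) (abs-scale 0≤¼ (b true _)))))

  step-op-bd : ∀ P τ {h B} → BdS (P ⟨$⟩ h) B → BdS (P ⟨$⟩ step τ h) B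
  step-op-bd P τ {h} b c x = abs-subst (step-op τ P h c x) (step-bd τ b c x)

  -- A potential argument. A block 0,1,0 lowers the number M of missing coins by one with weight ¼
  -- and leaves it alone with weight ¾, so 2^M is multiplied by ¼ · ½ + ¾ = 7/8. The potential thus
  -- bounds the mass that sees fewer than M coins; on the remaining mass v applies.
  coin-bound : ∀ t M h B v → 0ℚ ≤ B → 0ℚ ≤ v → (∀ m → BdS (T ^ᵒ m ⟨$⟩ h) B) →
    (∀ m → M ℕ.≤ m → BdS (T ^ᵒ m ⟨$⟩ h) v) →
    BdS (U t h) (v + B * pow 2ℚ M * pow ⅞ (cnt t))
  coin-bound t zero h B v 0≤B 0≤v b₁ b₂ c x = ≤-trans (U-bd t (b₂ 0 ℕ.z≤n) c x)
    (≤-by (0≤* (0≤* 0≤B 0≤1) (0≤pow 0≤⅞ (cnt t))) refl)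
  coin-bound (false ∷ true ∷ false ∷ t) (suc M) h B v 0≤B 0≤v b₁ b₂ c x = abs-subst
    (trans (U-cong t (block h) c x) (U-linear t ¼ 1ℚ (T ⟨$⟩ coin h) (rest h) c x))
    (abs-mono (≤-reflexive (e v B (pow 2ℚ M) (pow ⅞ (cnt t))))
      (abs-+ (abs-scale 0≤¼ (coin-bound t M (T ⟨$⟩ coin h) B v 0≤B 0≤v
               (λ m → shifted m (b₁ (suc m)))
               (λ m p → shifted m (b₂ (suc m) (ℕ.s≤s p))) c x))
             (abs-scale 0≤1 (coin-bound t (suc M) (rest h) (¾ * B) (¾ * v)
               (0≤* 0≤¾ 0≤B) (0≤* 0≤¾ 0≤v)
               (λ m → rest-bd (T ^ᵒ m) (b₁ m)) (λ m p → rest-bd (T ^ᵒ m) (b₂ m p)) c x))))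
    where
    0≤¾ : 0ℚ ≤ ¾
    0≤¾ = 0≤+ 0≤½ 0≤¼
    shifted : ∀ m {w} → BdS (T ^ᵒ suc m ⟨$⟩ h) w → BdS (T ^ᵒ m ⟨$⟩ (T ⟨$⟩ coin h)) w
    shifted m b c x = abs-subst (⟦⟧-comm (T ^ᵒ m) T (coin h c) x) (coin-bd (T ^ᵒ suc m) {h} b c x)
    e : ∀ v B p q → ¼ * (v + B * p * q) + 1ℚ * (¾ * v + ¾ * B * (2ℚ * p) * q)
      ≡ v + B * (2ℚ * p) * (⅞ * q)
    e = solve-∀ ring
  coin-bound [] M h B v 0≤B 0≤v b₁ b₂ = λ c x → ≤-trans (b₁ 0 c x) (last M)
    where
    last : ∀ M → B ≤ v + B * pow 2ℚ M * 1ℚ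
    last M = ≤-trans (≤-by 0≤v (e v B)) (+-monoʳ-≤ v (*-mono₂ 0≤B 0≤1 (≤-trans (≤-reflexive (sym (*-identityʳ B))) (*-mono 0≤B (1≤2^ M))) ≤-refl))
      where
      e : ∀ v B → v + B * 1ℚ ≡ B + v
      e = solve-∀ ring
      1≤2^ : ∀ M → 1ℚ ≤ pow 2ℚ M
      1≤2^ zero = ≤-refl
      1≤2^ (suc M) = ≤-trans (1≤2^ M) (≤-by (0≤pow (0≤+ 0≤1 0≤1) M) (f (pow 2ℚ M)))
        where
        f : ∀ p → (1ℚ + 1ℚ) * p ≡ p + p
        f = solve-∀ ring
  coin-bound (τ ∷ []) (suc M) h B v 0≤B 0≤v b₁ b₂ =
    coin-bound [] (suc M) (step τ h) B v 0≤B 0≤v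
      (λ m → step-op-bd (T ^ᵒ m) τ (b₁ m)) (λ m p → step-op-bd (T ^ᵒ m) τ (b₂ m p))
  coin-bound (τ ∷ τ′ ∷ []) (suc M) h B v 0≤B 0≤v b₁ b₂ =
    coin-bound [] (suc M) (step τ′ (step τ h)) B v 0≤B 0≤v
      (λ m → step-op-bd (T ^ᵒ m) τ′ {step τ h} (step-op-bd (T ^ᵒ m) τ (b₁ m)))
      (λ m p → step-op-bd (T ^ᵒ m) τ′ {step τ h} (step-op-bd (T ^ᵒ m) τ (b₂ m p)))
  coin-bound (true ∷ τ′ ∷ τ″ ∷ t) (suc M) h B v 0≤B 0≤v b₁ b₂ =
    coin-bound t (suc M) (step τ″ (step τ′ (step true h))) B v 0≤B 0≤v
      (λ m → three m (b₁ m)) (λ m p → three m (b₂ m p))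
    where
    three : ∀ m {w} → BdS (T ^ᵒ m ⟨$⟩ h) w → BdS (T ^ᵒ m ⟨$⟩ step τ″ (step τ′ (step true h))) w
    three m b = step-op-bd (T ^ᵒ m) τ″ {step τ′ (step true h)}
      (step-op-bd (T ^ᵒ m) τ′ {step true h} (step-op-bd (T ^ᵒ m) true b))
  coin-bound (false ∷ false ∷ τ″ ∷ t) (suc M) h B v 0≤B 0≤v b₁ b₂ =
    coin-bound t (suc M) (step τ″ (step false (step false h))) B v 0≤B 0≤v
      (λ m → three m (b₁ m)) (λ m p → three m (b₂ m p))
    where
    three : ∀ m {w} → BdS (T ^ᵒ m ⟨$⟩ h) w → BdS (T ^ᵒ m ⟨$⟩ step τ″ (step false (step false h))) w
    three m b = step-op-bd (T ^ᵒ m) τ″ {step false (step false h)}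
      (step-op-bd (T ^ᵒ m) false {step false h} (step-op-bd (T ^ᵒ m) false b))
  coin-bound (false ∷ true ∷ true ∷ t) (suc M) h B v 0≤B 0≤v b₁ b₂ =
    coin-bound t (suc M) (step true (step true (step false h))) B v 0≤B 0≤v
      (λ m → three m (b₁ m)) (λ m p → three m (b₂ m p))
    where
    three : ∀ m {w} → BdS (T ^ᵒ m ⟨$⟩ h) w → BdS (T ^ᵒ m ⟨$⟩ step true (step true (step false h))) w
    three m b = step-op-bd (T ^ᵒ m) true {step true (step false h)}
      (step-op-bd (T ^ᵒ m) true {step false h} (step-op-bd (T ^ᵒ m) false b))

-- Differences measured in powers of r.

module Scales where

  open import Data.Rational
  open import Data.Rational.Properties
  open import Tactic.RingSolver using (solve-∀)
  open Operators
  open CarryWalk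
  open Variance
  open Coins

  pow-inflate : ∀ {q} → 1ℚ ≤ q → ∀ {m n} → m ℕ.≤ n → pow q m ≤ pow q n
  pow-inflate {q} p {n = n} ℕ.z≤n = go n
    where
    go : ∀ n → 1ℚ ≤ pow q n
    go zero = ≤-refl
    go (suc n) = ≤-trans (≤-reflexive (sym (*-identityˡ 1ℚ)))
      (*-mono₂ 0≤1 (0≤pow (≤-trans 0≤1 p) n) p (go n))
  pow-inflate p (ℕ.s≤s m≤n) = *-mono (≤-trans 0≤1 p) (pow-inflate p m≤n)

  1≤2 : 1ℚ ≤ 2ℚ
  1≤2 = ≤ᵇ⇒≤ _

  1≤4 : 1ℚ ≤ 4ℚ
  1≤4 = ≤ᵇ⇒≤ _

  0≤4 : 0ℚ ≤ 4ℚ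
  0≤4 = ≤ᵇ⇒≤ _

  ½≤1 : ½ ≤ 1ℚ
  ½≤1 = ≤ᵇ⇒≤ _

  ⅞⁶≤½ : pow ⅞ 6 ≤ ½
  ⅞⁶≤½ = ≤ᵇ⇒≤ _

  ⅞≤1 : ⅞ ≤ 1ℚ
  ⅞≤1 = ≤ᵇ⇒≤ _

  pow-1 : ∀ n → pow 1ℚ n ≡ 1ℚ
  pow-1 zero = refl
  pow-1 (suc n) = trans (*-identityˡ (pow 1ℚ n)) (pow-1 n)

  2^-½^ : ∀ n → pow 2ℚ n * pow ½ n ≡ 1ℚ
  2^-½^ n = trans (sym (pow-mul 2ℚ ½ n)) (pow-1 n)

  ι-*-½^ : ∀ n → ι n * pow ½ n ≤ 1ℚ
  ι-*-½^ zero = ≤ᵇ⇒≤ _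
  ι-*-½^ (suc n) = ≤-trans (≤-reflexive (e (ι n) (pow ½ n)))
    (avg-≤ (pow-≤1 0≤½ ½≤1 n) (ι-*-½^ n))
    where
    e : ∀ n p → (1ℚ + n) * (½ * p) ≡ ½ * (p + n * p)
    e = solve-∀ ring

  -- A coin with values -1 and 0. One step of `L` is a step of `T` and a step of `T⁻`, so powers of
  -- `L` smooth at least as well as powers of `T`.
  T⁻ : Op
  T⁻ = T ⊙ S⁻

  T⁻-contraction : Contraction T⁻
  T⁻-contraction b = T-contraction (λ x → b (ℤ.pred x))

  L≡TT⁻ : ∀ f x → ⟦ L ⟧ f x ≡ ⟦ T ⟧ (⟦ T⁻ ⟧ f) x
  L≡TT⁻ f x rewrite ℤₚ.pred-suc x | ℤₚ.pred-suc (ℤ.suc x) = e (f x) (f (ℤ.suc x)) (f (ℤ.pred x))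
    where
    e : ∀ a b c → ½ * a + ¼ * (b + c) ≡ ½ * (½ * (c + a) + ½ * (a + b))
    e = solve-∀ ring

  L^≡T^T⁻^ : ∀ n f x → ⟦ L ^ᵒ n ⟧ f x ≡ ⟦ T ^ᵒ n ⟧ (⟦ T⁻ ^ᵒ n ⟧ f) x
  L^≡T^T⁻^ zero f x = refl
  L^≡T^T⁻^ (suc n) f x = trans (⟦⟧-cong L (L^≡T^T⁻^ n f) x)
    (trans (L≡TT⁻ (⟦ T ^ᵒ n ⟧ (⟦ T⁻ ^ᵒ n ⟧ f)) x)
      (⟦⟧-cong T (⟦⟧-comm T⁻ (T ^ᵒ n) (⟦ T⁻ ^ᵒ n ⟧ f)) x))

  ∇^-bd : ∀ j {f B} → Bd f B → Bd (⟦ ∇ ^ᵒ j ⟧ f) (pow 2ℚ j * B)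
  ∇^-bd zero {f} {B} b x = abs-mono (≤-reflexive (sym (*-identityˡ B))) (b x)
  ∇^-bd (suc j) {f} {B} b x = abs-mono (≤-reflexive (e (pow 2ℚ j) B)) (∇-bd (∇^-bd j b) x)
    where
    e : ∀ p B → p * B + p * B ≡ 2ℚ * p * B
    e = solve-∀ ring

  module Scale (ν : ℕ) (1≤ν : 1 ℕ.≤ ν) (r : ℚ) (0≤r : 0ℚ ≤ r) (rν≡1 : r * ι ν ≡ 1ℚ) where

    -- The unit in which coins and digits are counted: `N` coins buy one factor of order `r`.
    N : ℕ
    N = ν ℕ.* ν

    1≤N : 1 ℕ.≤ N
    1≤N = ℕₚ.*-mono-≤ 1≤ν 1≤ν

    1≤ιν : 1ℚ ≤ ι ν
    1≤ιν = ≤-trans (≤-reflexive (sym (+-identityʳ 1ℚ))) (ι-mono 1≤ν)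

    r≤1 : r ≤ 1ℚ
    r≤1 = ≤-trans (≤-reflexive (sym (*-identityʳ r))) (≤-trans (*-mono 0≤r 1≤ιν) (≤-reflexive rν≡1))

    -- `shift-gap` at distance 1, n = ν and time ν²: there `φ` is 2 ν - 1, and 2 B · 2 ν / ν² = 4 r
    -- B.
    ∇T-bd : ∀ {f B} → Bd f B → Bd (⟦ ∇ ⟧ (⟦ T ^ᵒ N ⟧ f)) (4ℚ * r * B)
    ∇T-bd {f} {B} b x = abs-subst
      (trans (∇-def (⟦ T ^ᵒ N ⟧ f) x) (scale gap))
      (≤-trans (abs-scale (0≤* 0≤r 0≤r)
          (≤-trans (shift-gap ν N 1 f B 1≤ν ℕₚ.≤-refl b x)
            (*-mono (0≤+ 0≤B 0≤B) φ≤)))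
        (≤-reflexive (trans (e₂ r (ι ν) B) (trans (cong (_* (4ℚ * r * B)) rν≡1) (*-identityˡ (4ℚ * r * B))))))
      where
      0≤B : 0ℚ ≤ B
      0≤B = abs⇒0≤ (b x)
      gap : ℚ
      gap = ⟦ T ^ᵒ N ⟧ f (ℤ.suc x) - ⟦ T ^ᵒ N ⟧ f x
      e₁ : ∀ r n a → r * r * (n * n * a) ≡ (r * n) * ((r * n) * a)
      e₁ = solve-∀ ring
      scale : ∀ a → a ≡ r * r * (ι ν * ι ν * a)
      scale a = sym (trans (e₁ r (ι ν) a) (trans (cong (λ z → z * (z * a)) rν≡1)
        (trans (*-identityˡ (1ℚ * a)) (*-identityˡ a))))
      e₂ : ∀ r n B → r * r * ((B + B) * (n + n)) ≡ (r * n) * (4ℚ * r * B)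
      e₂ = solve-∀ ring
      e₃ : ∀ n → n + n ≡ n * n - n * n + ((1ℚ + 0ℚ) * n + (1ℚ + 0ℚ) * n) - (1ℚ + 0ℚ) * (1ℚ + 0ℚ) + 1ℚ
      e₃ = solve-∀ ring
      φ≤ : φ ν N 1 ≤ ι ν + ι ν
      φ≤ = ≤-by 0≤1 (trans (e₃ (ι ν)) (cong (λ z → ι ν * ι ν - z + ((1ℚ + 0ℚ) * ι ν + (1ℚ + 0ℚ) * ι ν) - (1ℚ + 0ℚ) * (1ℚ + 0ℚ) + 1ℚ) (sym (ι-* ν ν))))

    -- As all operators commute, each of the j differences can be given its own `N` coins.
    T^∇^-bd : ∀ j m {f B} → j ℕ.* N ℕ.≤ m → Bd f B → Bd (⟦ T ^ᵒ m ⟧ (⟦ ∇ ^ᵒ j ⟧ f)) (pow (4ℚ * r) j * B)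
    T^∇^-bd zero m {f} {B} p b x = abs-mono (≤-reflexive (sym (*-identityˡ B))) (pow-contraction T-contraction m b x)
    T^∇^-bd (suc j) m {f} {B} p b x = abs-subst
      (trans (cong (λ z → ⟦ T ^ᵒ z ⟧ g x) (sym (ℕₚ.m+[n∸m]≡n N≤m)))
      (trans (pow-+ T N m′ g x)
      (trans (⟦⟧-cong (T ^ᵒ N) (⟦⟧-comm (T ^ᵒ m′) ∇ (⟦ ∇ ^ᵒ j ⟧ f)) x)
        (⟦⟧-comm (T ^ᵒ N) ∇ (⟦ T ^ᵒ m′ ⟧ (⟦ ∇ ^ᵒ j ⟧ f)) x))))
      (abs-mono (≤-reflexive (sym (*-assoc (4ℚ * r) (pow (4ℚ * r) j) B)))
        (∇T-bd (T^∇^-bd j m′ jN≤m′ b) x))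
      where
      g = ⟦ ∇ ⟧ (⟦ ∇ ^ᵒ j ⟧ f)
      m′ = m ℕ.∸ N
      N≤m : N ℕ.≤ m
      N≤m = ℕₚ.≤-trans (ℕₚ.m≤m+n N (j ℕ.* N)) p
      jN≤m′ : j ℕ.* N ℕ.≤ m′
      jN≤m′ = ℕₚ.m+n≤o⇒m≤o∸n (j ℕ.* N) (subst (ℕ._≤ m) (ℕₚ.+-comm N (j ℕ.* N)) p)

    ∇^L^-bd : ∀ j m {f B} → j ℕ.* N ℕ.≤ m → Bd f B → Bd (⟦ ∇ ^ᵒ j ⟧ (⟦ L ^ᵒ m ⟧ f)) (pow (4ℚ * r) j * B)
    ∇^L^-bd j m {f} p b = Bd-resp (λ x → trans (⟦⟧-cong (∇ ^ᵒ j) (L^≡T^T⁻^ m f) x)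
        (⟦⟧-comm (∇ ^ᵒ j) (T ^ᵒ m) (⟦ T⁻ ^ᵒ m ⟧ f) x))
      (T^∇^-bd j m p (pow-contraction T⁻-contraction m b))

    ½^N≤r² : pow ½ N ≤ r * r
    ½^N≤r² = ≤-trans (≤-reflexive (sym (trans (cong (λ z → r * r * (z * pow ½ N)) (ι-* ν ν))
        (trans (e r (ι ν) (pow ½ N)) (trans (cong (λ z → z * (z * pow ½ N)) rν≡1)
          (trans (*-identityˡ (1ℚ * pow ½ N)) (*-identityˡ (pow ½ N))))))))
      (≤-trans (*-mono (0≤* 0≤r 0≤r) (ι-*-½^ N)) (≤-reflexive (*-identityʳ (r * r))))
      where
      e : ∀ r n a → r * r * (n * n * a) ≡ (r * n) * ((r * n) * a)
      e = solve-∀ ring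

    -- 4 N coins pay for four derivatives; since (7/8)⁶ ≤ 1/2, the factor (7/8)^(60 N) beats 2^(4 N).
    tail-bd : ∀ c → 60 ℕ.* N ℕ.≤ c → pow 2ℚ 4 * pow 2ℚ (4 ℕ.* N) * pow ⅞ c ≤ pow r 4
    tail-bd c p = ≤-trans (*-mono (0≤* (0≤pow 0≤2 4) (0≤pow 0≤2 (4 ℕ.* N))) ⅞^c)
      (≤-trans (≤-reflexive (e₁ (pow 2ℚ 4) (pow 2ℚ (4 ℕ.* N)) (pow ½ (4 ℕ.* N)) (pow ½ (4 ℕ.* N)) (pow ½ N)))
      (≤-trans (*-mono₂ (0≤* (0≤pow 0≤2 4) (0≤pow 0≤½ (4 ℕ.* N))) (0≤* 0≤r² 0≤r²)
          (≤-trans (*-mono (0≤pow 0≤2 4) (pow-antimono 0≤½ ½≤1 (ℕₚ.*-monoʳ-≤ 4 1≤N)))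
            (≤-reflexive (2^-½^ 4)))
          (≤-trans (≤-reflexive (trans (cong (_* (pow ½ N * pow ½ N)) (2^-½^ (4 ℕ.* N))) (*-identityˡ (pow ½ N * pow ½ N))))
            (*-mono₂ (0≤pow 0≤½ N) 0≤r² ½^N≤r² ½^N≤r²)))
        (≤-reflexive (e₂ r))))
      where
      0≤2 : 0ℚ ≤ 2ℚ
      0≤2 = ≤-trans 0≤1 1≤2
      0≤r² : 0ℚ ≤ r * r
      0≤r² = 0≤* 0≤r 0≤r
      e₁ : ∀ a p q q′ x → a * p * (q * (q′ * (x * x))) ≡ (a * q) * (p * q′ * (x * x))
      e₁ = solve-∀ ring
      e₂ : ∀ r → 1ℚ * (r * r * (r * r)) ≡ r * (r * (r * (r * 1ℚ)))
      e₂ = solve-∀ ring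
      -- 10 = 4 + 4 + 1 + 1: one factor cancels 2^(4 N), one absorbs the constant 2⁴, and ½^N ≤ r²
      -- is used twice.
      split : pow ½ (10 ℕ.* N) ≡ pow ½ (4 ℕ.* N) * (pow ½ (4 ℕ.* N) * (pow ½ N * pow ½ N))
      split = trans (cong (pow ½) (trans (ℕₚ.*-distribʳ-+ N 4 6)
          (cong (4 ℕ.* N ℕ.+_) (trans (ℕₚ.*-distribʳ-+ N 4 2) (cong (4 ℕ.* N ℕ.+_) (cong (N ℕ.+_) (ℕₚ.+-identityʳ N)))))))
        (trans (pow-exp-+ ½ (4 ℕ.* N) (4 ℕ.* N ℕ.+ (N ℕ.+ N)))
          (cong (pow ½ (4 ℕ.* N) *_) (trans (pow-exp-+ ½ (4 ℕ.* N) (N ℕ.+ N)) (cong (pow ½ (4 ℕ.* N) *_) (pow-exp-+ ½ N N)))))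
      60N : 60 ℕ.* N ≡ 10 ℕ.* N ℕ.* 6
      60N = trans (ℕₚ.*-assoc 6 10 N) (ℕₚ.*-comm 6 (10 ℕ.* N))
      ⅞^c : pow ⅞ c ≤ pow ½ (4 ℕ.* N) * (pow ½ (4 ℕ.* N) * (pow ½ N * pow ½ N))
      ⅞^c = ≤-trans (pow-antimono 0≤⅞ ⅞≤1 p)
        (≤-trans (≤-reflexive (trans (cong (pow ⅞) 60N) (pow-exp-* ⅞ (10 ℕ.* N) 6)))
        (≤-trans (pow-mono (0≤pow 0≤⅞ 6) ⅞⁶≤½ (10 ℕ.* N)) (≤-reflexive split)))

    -- 4⁴ for up to four differences at 4 r each, and 1 for the tail with too few coins.
    A : ℚ
    A = pow 4ℚ 4 + 1ℚ

    0≤A : 0ℚ ≤ A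
    0≤A = 0≤+ (0≤pow 0≤4 4) 0≤1

    -- `coin-bound` with M = 4 N. The weights c admit functions such as `negAt a`, which look at the
    -- outgoing carry.
    smooth : ∀ j t (c : Bool → ℚ) g → j ℕ.≤ 4 → 60 ℕ.* N ℕ.≤ cnt t → (∀ b → ∣ c b ∣ ≤ 1ℚ) → Bd g 1ℚ →
      BdS (U t (λ b x → c b * ⟦ ∇ ^ᵒ j ⟧ g x)) (A * pow r j)
    smooth j t c g j≤4 p c≤1 g≤1 b x = ≤-trans
      (coin-bound t (4 ℕ.* N) h (pow 2ℚ 4) (pow (4ℚ * r) j)
        (0≤pow (≤-trans 0≤1 1≤2) 4) (0≤pow (0≤* 0≤4 0≤r) j)
        (λ m b x → weight b m x (≤-trans (≤-reflexive (*-identityʳ (pow 2ℚ j))) (pow-inflate 1≤2 j≤4))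
          (pow-contraction T-contraction m (∇^-bd j g≤1) x))
        (λ m q b x → weight b m x (≤-reflexive (*-identityʳ (pow (4ℚ * r) j)))
          (T^∇^-bd j m (ℕₚ.≤-trans (ℕₚ.*-monoˡ-≤ N j≤4) q) g≤1 x))
        b x)
      (≤-trans (+-mono-≤ (≤-trans (≤-reflexive (pow-mul 4ℚ r j))
          (*-mono₂ (0≤pow 0≤4 j) (0≤pow 0≤r j) (pow-inflate 1≤4 j≤4) ≤-refl))
          (≤-trans (tail-bd (cnt t) p) (pow-antimono 0≤r r≤1 j≤4)))
        (≤-reflexive (e (pow 4ℚ 4) (pow r j))))
      where
      h : St
      h b x = c b * ⟦ ∇ ^ᵒ j ⟧ g x
      e : ∀ a p → a * p + p ≡ (a + 1ℚ) * p
      e = solve-∀ ring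
      weight : ∀ b m x {v w} → v ≤ w → ∣ ⟦ T ^ᵒ m ⟧ (⟦ ∇ ^ᵒ j ⟧ g) x ∣ ≤ v → ∣ ⟦ T ^ᵒ m ⟧ (h b) x ∣ ≤ w
      weight b m x {v} v≤w q = abs-subst (⟦⟧-* (T ^ᵒ m) (c b) (⟦ ∇ ^ᵒ j ⟧ g) x)
        (abs-mono (≤-trans (≤-reflexive (*-identityˡ v)) v≤w) (abs-* (c≤1 b) q))

-- Loss of memory of the carry, reflections, and the mean of sg.

module Symmetry where

  open import Data.Rational
  open import Data.Rational.Properties
  open import Tactic.RingSolver using (solve-∀)
  open Operators
  open CarryWalk
  open Variance
  open Coins
  open Scales

  private
    gap-t : ∀ a b c d → a - ½ * (d + c) ≡ - (½ * (b + c) + - 1ℚ * a) + ½ * (b - d)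
    gap-t = solve-∀ ring
    gap-f : ∀ a b c d → ½ * (b + d) - a ≡ (½ * (b + c) + - 1ℚ * a) + ½ * (d - c)
    gap-f = solve-∀ ring

  -- One carry is kept, and the other is replaced by a fair coin that agrees with the kept one half
  -- of the time. So half of the gap survives, at the price of one `Δ`.
  step-gap : ∀ τ h B V → (∀ c → Bd (⟦ Δ ⟧ (h c)) B) → Bd (λ x → h true x - h false x) V →
    Bd (λ x → step τ h true x - step τ h false x) (B + ½ * V)
  step-gap true h B V d v x = abs-subst
    (gap-t (h true x) (h true (ℤ.suc x)) (h true (ℤ.pred x)) (h false (ℤ.suc x)))
    (abs-+ (abs-neg (d true x)) (abs-scale 0≤½ (v (ℤ.suc x))))
  step-gap false h B V d v x = abs-subst
    (gap-f (h false x) (h false (ℤ.suc x)) (h false (ℤ.pred x)) (h true (ℤ.pred x)))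
    (abs-+ (d false x) (abs-scale 0≤½ (v (ℤ.pred x))))

  -- 2 B is the fixed point of the recursion in `step-gap`; the excess V over it halves with every
  -- digit.
  forget : ∀ t h B V → (∀ c → Bd (⟦ Δ ⟧ (h c)) B) → Bd (λ x → h true x - h false x) (B + B + V) →
    Bd (λ x → U t h true x - U t h false x) (B + B + pow ½ (length t) * V)
  forget [] h B V d v x = abs-mono (≤-reflexive (cong (B + B +_) (sym (*-identityˡ V)))) (v x)
  forget (τ ∷ t) h B V d v x = abs-mono (≤-reflexive (e₂ B (pow ½ (length t)) V))
    (forget t (step τ h) B (½ * V) (λ c x → step-op-bd Δ τ {h} d c x)
      (λ x → abs-mono (≤-reflexive (e₁ B V)) (step-gap τ h B (B + B + V) d v x)) x)
    where
    e₁ : ∀ B V → B + ½ * (B + B + V) ≡ B + B + ½ * V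
    e₁ = solve-∀ ring
    e₂ : ∀ B p V → B + B + p * (½ * V) ≡ B + B + ½ * p * V
    e₂ = solve-∀ ring

  -- 1 - ⅛ · ½: three random digits form 0,1,0 with probability ⅛, and then ½^`cnt` loses a factor
  -- ½.
  15/16 : ℚ
  15/16 = ⅞ + ⅛ * ½

  0≤15/16 : 0ℚ ≤ 15/16
  0≤15/16 = ≤ᵇ⇒≤ _

  15/16^11≤½ : pow 15/16 11 ≤ ½
  15/16^11≤½ = ≤ᵇ⇒≤ _

  avg-cnt : ∀ m → avg (m ℕ.* 3) (λ t → pow ½ (cnt t)) ≡ pow 15/16 m
  avg-cnt zero = refl
  avg-cnt (suc m) = trans
    (cong (λ z → ½ * (½ * (½ * (p + p) + ½ * (z + p)) + ½ * (½ * (p + p) + ½ * (p + p))))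
      (avg-* (m ℕ.* 3) ½ (λ t → pow ½ (cnt t))))
    (trans (e p) (cong (15/16 *_) (avg-cnt m)))
    where
    p = avg (m ℕ.* 3) (λ t → pow ½ (cnt t))
    e : ∀ p → ½ * (½ * (½ * (p + p) + ½ * (½ * p + p)) + ½ * (½ * (p + p) + ½ * (p + p))) ≡ 15/16 * p
    e = solve-∀ ring

  sg : ℤ → ℚ
  sg (ℤ.+ n) = 1ℚ
  sg ℤ.-[1+ n ] = - 1ℚ

  ∣sg∣≤1 : Bd sg 1ℚ
  ∣sg∣≤1 (ℤ.+ n) = ≤-refl
  ∣sg∣≤1 ℤ.-[1+ n ] = ≤-refl

  record Reflection (ρ : ℤ → ℤ) : Set where
    field
      ρ-suc : ∀ x → ρ (ℤ.suc x) ≡ ℤ.pred (ρ x)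
      ρ-pred : ∀ x → ρ (ℤ.pred x) ≡ ℤ.suc (ρ x)

  open Reflection

  opp : ℤ → ℤ
  opp x = ℤ.- x

  opp-reflection : Reflection opp
  opp-reflection .ρ-suc x = ℤₚ.neg-distrib-+ (ℤ.+ 1) x
  opp-reflection .ρ-pred x = ℤₚ.neg-distrib-+ ℤ.-[1+ 0 ] x

  -- The reflection about -½, the centre of symmetry of `sg`.
  mirror : ℤ → ℤ
  mirror x = ℤ.pred (ℤ.- x)

  mirror-reflection : Reflection mirror
  mirror-reflection .ρ-suc x = cong ℤ.pred (ρ-suc opp-reflection x)
  mirror-reflection .ρ-pred x = trans (cong ℤ.pred (ρ-pred opp-reflection x))
    (trans (ℤₚ.pred-suc (ℤ.- x)) (sym (ℤₚ.suc-pred (ℤ.- x))))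

  L-reflect : ∀ {ρ} → Reflection ρ → ∀ f x → ⟦ L ⟧ f (ρ x) ≡ ⟦ L ⟧ (λ y → f (ρ y)) x
  L-reflect {ρ} R f x = cong (λ z → ½ * f (ρ x) + ¼ * z)
    (trans (+-comm (f (ℤ.suc (ρ x))) (f (ℤ.pred (ρ x))))
      (cong₂ _+_ (cong f (sym (ρ-suc R x))) (cong f (sym (ρ-pred R x)))))

  L^-reflect : ∀ {ρ} → Reflection ρ → ∀ n f x → ⟦ L ^ᵒ n ⟧ f (ρ x) ≡ ⟦ L ^ᵒ n ⟧ (λ y → f (ρ y)) x
  L^-reflect R zero f x = refl
  L^-reflect R (suc n) f x = trans (L-reflect R (⟦ L ^ᵒ n ⟧ f) x) (⟦⟧-cong L (L^-reflect R n f) x)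

  Δ-reflect : ∀ {ρ} → Reflection ρ → ∀ f x → ⟦ Δ ⟧ f (ρ x) ≡ ⟦ Δ ⟧ (λ y → f (ρ y)) x
  Δ-reflect {ρ} R f x = cong (λ z → ½ * z + - 1ℚ * f (ρ x))
    (trans (+-comm (f (ℤ.suc (ρ x))) (f (ℤ.pred (ρ x))))
      (cong₂ _+_ (cong f (sym (ρ-suc R x))) (cong f (sym (ρ-pred R x)))))

  Odd : (ℤ → ℤ) → (ℤ → ℚ) → Set
  Odd ρ f = ∀ x → f (ρ x) ≡ - f x

  ⟦⟧-neg : ∀ P f x → ⟦ P ⟧ (λ y → - f y) x ≡ - ⟦ P ⟧ f x
  ⟦⟧-neg P f x = trans (⟦⟧-cong P (λ y → e (f y)) x) (trans (⟦⟧-* P (- 1ℚ) f x) (sym (e (⟦ P ⟧ f x))))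
    where
    e : ∀ a → - a ≡ - 1ℚ * a
    e = solve-∀ ring

  L-odd : ∀ {ρ} → Reflection ρ → ∀ {f} → Odd ρ f → Odd ρ (⟦ L ⟧ f)
  L-odd R {f} o x = trans (L-reflect R f x) (trans (⟦⟧-cong L o x) (⟦⟧-neg L f x))

  L^-odd : ∀ {ρ} → Reflection ρ → ∀ n {f} → Odd ρ f → Odd ρ (⟦ L ^ᵒ n ⟧ f)
  L^-odd R zero o = o
  L^-odd R (suc n) {f} o = L-odd R {⟦ L ^ᵒ n ⟧ f} (L^-odd R n o)

  Δ-odd : ∀ {ρ} → Reflection ρ → ∀ {f} → Odd ρ f → Odd ρ (⟦ Δ ⟧ f)
  Δ-odd R {f} o x = trans (Δ-reflect R f x) (trans (⟦⟧-cong Δ o x) (⟦⟧-neg Δ f x))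

  private
    half-diff : ∀ a → a ≡ ½ * (a - - a)
    half-diff = solve-∀ ring
    ½≤ : ∀ {G} → 0ℚ ≤ G → ½ * G ≤ G
    ½≤ {G} p = ≤-trans (*-mono₂ 0≤½ p ½≤1 ≤-refl) (≤-reflexive (*-identityˡ G))

  odd-opp-0 : ∀ f → Odd opp f → f ℤ.0ℤ ≡ 0ℚ
  odd-opp-0 f o = trans (e (f ℤ.0ℤ)) (trans (cong (λ z → ½ * (f ℤ.0ℤ + z)) (o ℤ.0ℤ)) (z (f ℤ.0ℤ)))
    where
    e : ∀ a → a ≡ ½ * (a + a)
    e = solve-∀ ring
    z : ∀ a → ½ * (a - a) ≡ 0ℚ
    z = solve-∀ ring

  -- `mirror` exchanges 0 and -1, so f 0 is half of the difference f 0 - f (-1).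
  odd-mirror-0 : ∀ f G → Odd mirror f → Bd (⟦ ∇ ⟧ f) G → ∣ f ℤ.0ℤ ∣ ≤ G
  odd-mirror-0 f G o b = abs-subst
    (trans (half-diff (f ℤ.0ℤ)) (cong (½ *_) (trans (cong (λ z → f ℤ.0ℤ - z) (sym (o ℤ.0ℤ))) (sym (∇-def f ℤ.-1ℤ)))))
    (abs-mono (½≤ (abs⇒0≤ (b ℤ.0ℤ))) (abs-scale 0≤½ (b ℤ.-1ℤ)))

  sg-odd : Odd mirror sg
  sg-odd (ℤ.+ zero) = refl
  sg-odd (ℤ.+ suc n) = refl
  sg-odd ℤ.-[1+ n ] = refl

  -- 2 x + 1, the coordinate that `mirror` negates.
  odd# : ℤ → ℚ
  odd# (ℤ.+ n) = 1ℚ + (ι n + ι n)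
  odd# ℤ.-[1+ n ] = - (1ℚ + (ι n + ι n))

  odd#-suc : ∀ x → odd# (ℤ.suc x) ≡ odd# x + 2ℚ
  odd#-suc (ℤ.+ n) = e (ι n)
    where
    e : ∀ n → 1ℚ + ((1ℚ + n) + (1ℚ + n)) ≡ 1ℚ + (n + n) + 2ℚ
    e = solve-∀ ring
  odd#-suc ℤ.-[1+ zero ] = refl
  odd#-suc ℤ.-[1+ suc n ] = e (ι n)
    where
    e : ∀ n → - (1ℚ + (n + n)) ≡ - (1ℚ + ((1ℚ + n) + (1ℚ + n))) + 2ℚ
    e = solve-∀ ring

  odd#-pred : ∀ x → odd# (ℤ.pred x) ≡ odd# x - 2ℚ
  odd#-pred x = trans (e (odd# (ℤ.pred x)))
    (cong (_- 2ℚ) (trans (sym (odd#-suc (ℤ.pred x))) (cong odd# (ℤₚ.suc-pred x))))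
    where
    e : ∀ a → a ≡ a + 2ℚ - 2ℚ
    e = solve-∀ ring

  odd#-odd : Odd mirror odd#
  odd#-odd (ℤ.+ zero) = refl
  odd#-odd (ℤ.+ suc n) = refl
  odd#-odd ℤ.-[1+ n ] = e (ι n)
    where
    e : ∀ n → 1ℚ + (n + n) ≡ - - (1ℚ + (n + n))
    e = solve-∀ ring

  cubic : ℚ → ℚ → ℤ → ℚ
  cubic a b x = a * odd# x - b * (odd# x * (odd# x * odd# x))

  cubic-odd : ∀ a b → Odd mirror (cubic a b)
  cubic-odd a b x = trans (cong (λ z → a * z - b * (z * (z * z))) (odd#-odd x)) (e a b (odd# x))
    where
    e : ∀ a b z → a * (- z) - b * ((- z) * ((- z) * (- z))) ≡ - (a * z - b * (z * (z * z)))
    e = solve-∀ ring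

  6ℚ : ℚ
  6ℚ = 4ℚ + 2ℚ

  -- In z = 2 x + 1 the walk moves by ±2, so `L` fixes z and sends z³ to z³ + 6 z.
  L-cubic : ∀ a b x → ⟦ L ⟧ (cubic a b) x ≡ cubic (a - 6ℚ * b) b x
  L-cubic a b x = trans
    (cong₂ (λ u v → ½ * cubic a b x + ¼ * ((a * u - b * (u * (u * u))) + (a * v - b * (v * (v * v)))))
      (odd#-suc x) (odd#-pred x))
    (e a b (odd# x))
    where
    e : ∀ a b z → ½ * (a * z - b * (z * (z * z))) + ¼ * ((a * (z + 2ℚ) - b * ((z + 2ℚ) * ((z + 2ℚ) * (z + 2ℚ))))
        + (a * (z - 2ℚ) - b * ((z - 2ℚ) * ((z - 2ℚ) * (z - 2ℚ)))))
      ≡ (a - 6ℚ * b) * z - b * (z * (z * z))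
    e = solve-∀ ring

  L^-cubic : ∀ n a b x → ⟦ L ^ᵒ n ⟧ (cubic a b) x ≡ cubic (a - 6ℚ * ι n * b) b x
  L^-cubic zero a b x = cong (λ c → cubic c b x) (e a b)
    where
    e : ∀ a b → a ≡ a - 6ℚ * 0ℚ * b
    e = solve-∀ ring
  L^-cubic (suc n) a b x = trans (⟦⟧-cong L (L^-cubic n a b) x)
    (trans (L-cubic (a - 6ℚ * ι n * b) b x) (cong (λ c → cubic c b x) (e a b (ι n))))
    where
    e : ∀ a b n → a - 6ℚ * n * b - 6ℚ * b ≡ a - 6ℚ * (1ℚ + n) * b
    e = solve-∀ ring

  -- Only 0 has a negative neighbour, -1, which is its own mirror image: the loss ¼ f 0 is covered
  -- by ½ f 0.
  L^-positive : ∀ n f → Odd mirror f → (∀ m → 0ℚ ≤ f (ℤ.+ m)) → ∀ m → 0ℚ ≤ ⟦ L ^ᵒ n ⟧ f (ℤ.+ m)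
  L^-positive zero f o p m = p m
  L^-positive (suc n) f o p zero = subst (0ℚ ≤_)
    (trans (e (g ℤ.0ℤ) (g ℤ.1ℤ)) (cong (λ z → ½ * g ℤ.0ℤ + ¼ * (g ℤ.1ℤ + z)) (sym (L^-odd mirror-reflection n o ℤ.0ℤ))))
    (0≤* 0≤¼ (0≤+ (L^-positive n f o p 0) (L^-positive n f o p 1)))
    where
    g = ⟦ L ^ᵒ n ⟧ f
    e : ∀ a b → ¼ * (a + b) ≡ ½ * a + ¼ * (b + - a)
    e = solve-∀ ring
  L^-positive (suc n) f o p (suc m) =
    0≤+ (0≤* 0≤½ (ih (suc m))) (0≤* 0≤¼ (0≤+ (ih (suc (suc m))) (ih m)))
    where ih = L^-positive n f o p

  0≤odd# : ∀ m → 0ℚ ≤ odd# (ℤ.+ m)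
  0≤odd# m = 0≤+ 0≤1 (0≤+ (0≤ι m) (0≤ι m))

  -- sg dominates the cubic 3w/2 - w³/2, w = q (2x + 1), on x ≥ 0, and L moves only the linear
  -- coefficient of the cubic.
  L^sg-lower : ∀ n q → 0ℚ ≤ q → (6ℚ * ι n + 1ℚ) * (q * q) ≤ 1ℚ → q ≤ ⟦ L ^ᵒ n ⟧ sg ℤ.0ℤ
  L^sg-lower n q 0≤q small = ≤-trans
    (≤-by (0≤* (0≤* 0≤½ 0≤q) (≤⇒0≤ small)) (e₁ q (ι n)))
    (0≤⇒≤ (subst (0ℚ ≤_) diff (L^-positive n f f-odd f-pos 0)))
    where
    a b : ℚ
    a = (1ℚ + ½) * q
    b = ½ * (q * (q * q))
    f : ℤ → ℚ
    f x = 1ℚ * sg x + - 1ℚ * cubic a b x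
    -- At x = 0 the moved cubic has the value 3q/2 - (6n + 1) q³/2.
    e₁ : ∀ q n → ((1ℚ + ½) * q - 6ℚ * n * (½ * (q * (q * q)))) * (1ℚ + (0ℚ + 0ℚ))
        - (½ * (q * (q * q))) * ((1ℚ + (0ℚ + 0ℚ)) * ((1ℚ + (0ℚ + 0ℚ)) * (1ℚ + (0ℚ + 0ℚ))))
      ≡ q + ½ * q * (1ℚ - (6ℚ * n + 1ℚ) * (q * q))
    e₁ = solve-∀ ring
    e₂ : ∀ x y → 1ℚ * (- x) + - 1ℚ * (- y) ≡ - (1ℚ * x + - 1ℚ * y)
    e₂ = solve-∀ ring
    f-odd : Odd mirror f
    f-odd x = trans (cong₂ (λ u v → 1ℚ * u + - 1ℚ * v) (sg-odd x) (cubic-odd a b x)) (e₂ (sg x) (cubic a b x))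
    -- The cubic touches 1 at w = 1, a double root of the difference.
    e₃ : ∀ q z → 1ℚ * 1ℚ + - 1ℚ * ((1ℚ + ½) * q * z - ½ * (q * (q * q)) * (z * (z * z)))
      ≡ ½ * ((q * z - 1ℚ) * (q * z - 1ℚ) * (q * z + 2ℚ))
    e₃ = solve-∀ ring
    f-pos : ∀ m → 0ℚ ≤ f (ℤ.+ m)
    f-pos m = subst (0ℚ ≤_) (sym (e₃ q (odd# (ℤ.+ m))))
      (0≤* 0≤½ (0≤* (0≤sq (q * odd# (ℤ.+ m) - 1ℚ)) (0≤+ (0≤* 0≤q (0≤odd# m)) (≤-trans 0≤1 1≤2))))
    e₄ : ∀ x y → 1ℚ * x + - 1ℚ * y ≡ x - y
    e₄ = solve-∀ ring
    diff : ⟦ L ^ᵒ n ⟧ f ℤ.0ℤ ≡ ⟦ L ^ᵒ n ⟧ sg ℤ.0ℤ - cubic (a - 6ℚ * ι n * b) b ℤ.0ℤ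
    diff = trans (⟦⟧-linear (L ^ᵒ n) 1ℚ (- 1ℚ) sg (cubic a b) ℤ.0ℤ)
      (trans (e₄ (⟦ L ^ᵒ n ⟧ sg ℤ.0ℤ) (⟦ L ^ᵒ n ⟧ (cubic a b) ℤ.0ℤ))
        (cong (λ z → ⟦ L ^ᵒ n ⟧ sg ℤ.0ℤ - z) (L^-cubic n a b ℤ.0ℤ)))

  private
    +-suc : ∀ x y → x ℤ.+ ℤ.suc y ≡ ℤ.suc (x ℤ.+ y)
    +-suc x y = trans (sym (ℤₚ.+-assoc x (ℤ.+ 1) y))
      (trans (cong (ℤ._+ y) (ℤₚ.+-comm x (ℤ.+ 1))) (ℤₚ.+-assoc (ℤ.+ 1) x y))
    +-pred : ∀ x y → x ℤ.+ ℤ.pred y ≡ ℤ.pred (x ℤ.+ y)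
    +-pred x y = trans (sym (ℤₚ.+-assoc x ℤ.-1ℤ y))
      (trans (cong (ℤ._+ y) (ℤₚ.+-comm x ℤ.-1ℤ)) (ℤₚ.+-assoc ℤ.-1ℤ x y))

    mix-translate : ∀ h x y → mix (λ c z → h c (x ℤ.+ z)) y ≡ mix h (x ℤ.+ y)
    mix-translate h x y = cong₂ (λ a b → ½ * (h false a + h true b)) (+-suc x y) (+-pred x y)

    step-translate : ∀ τ h x c y → step τ (λ c z → h c (x ℤ.+ z)) c y ≡ step τ h c (x ℤ.+ y)
    step-translate false h x false y = refl
    step-translate false h x true y = mix-translate h x y
    step-translate true h x true y = refl
    step-translate true h x false y = mix-translate h x y

  U-translate : ∀ t h x c y → U t (λ c z → h c (x ℤ.+ z)) c y ≡ U t h c (x ℤ.+ y)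
  U-translate [] h x c y = refl
  U-translate (τ ∷ t) h x c y = trans (U-cong t (step-translate τ h x) c y) (U-translate t (step τ h) x c y)

  Av-translate : ∀ t f x → Av t (const (λ z → f (x ℤ.+ z))) ℤ.0ℤ ≡ Av t (const f) x
  Av-translate t f x = trans
    (cong₂ (λ a b → ½ * (a + b)) (U-translate t (const f) x false ℤ.0ℤ) (U-translate t (const f) x true ℤ.0ℤ))
    (cong (Av t (const f)) (ℤₚ.+-identityʳ x))

  private
    c₁ : ∀ a b → ½ * (a + b) ≡ ½ * a + ½ * b
    c₁ = solve-∀ ring

    mix-Av : ∀ u (K : Bool → ℤ → St) z x →
      mix (λ c x → Av u (K c x) z) x ≡ Av u (λ c′ y → mix (λ c x → K c x c′ y) x) z
    mix-Av u K z x = trans (c₁ (Av u (K false (ℤ.suc x)) z) (Av u (K true (ℤ.pred x)) z))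
      (trans (sym (Av-linear u ½ ½ (K false (ℤ.suc x)) (K true (ℤ.pred x)) z))
        (Av-cong u (λ c y → sym (c₁ (K false (ℤ.suc x) c y) (K true (ℤ.pred x) c y))) z))

    step-Av : ∀ τ u (K : Bool → ℤ → St) z c x →
      step τ (λ c x → Av u (K c x) z) c x ≡ Av u (λ c′ y → step τ (λ c x → K c x c′ y) c x) z
    step-Av false u K z false x = refl
    step-Av false u K z true x = mix-Av u K z x
    step-Av true u K z true x = refl
    step-Av true u K z false x = mix-Av u K z x

    U-Av : ∀ t u (K : Bool → ℤ → St) z c x →
      U t (λ c x → Av u (K c x) z) c x ≡ Av u (λ c′ y → U t (λ c x → K c x c′ y) c x) z
    U-Av [] u K z c x = refl
    U-Av (τ ∷ t) u K z c x = trans (U-cong t (step-Av τ u K z) c x)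
      (U-Av t u (λ c x c′ y → step τ (λ c x → K c x c′ y) c x) z c x)

  -- Fubini for the independent random digits added to t and to u.
  Av-swap : ∀ t u (K : ℤ → ℤ → ℚ) x z →
    Av t (const (λ x → Av u (const (K x)) z)) x ≡ Av u (const (λ y → Av t (const (λ x → K x y)) x)) z
  Av-swap t u K x z = trans
    (cong₂ (λ a b → ½ * (a + b)) (U-Av t u (λ _ x _ y → K x y) z false x) (U-Av t u (λ _ x _ y → K x y) z true x))
    (trans (c₁ (Av u F z) (Av u G z)) (trans (sym (Av-linear u ½ ½ F G z))
      (Av-cong u (λ c y → sym (c₁ (F c y) (G c y))) z)))
    where
    F G : St
    F c y = U t (λ _ x → K x y) false x
    G c y = U t (λ _ x → K x y) true x

-- From P to means of sg, and their splitting by parity.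

module Expansion where

  open import Data.Rational
  open import Data.Rational.Properties
  open import Tactic.RingSolver using (solve-∀)
  open Operators
  open CarryWalk
  open Variance
  open Coins
  open Scales
  open Symmetry

  Δ≡½∇² : ∀ f x → ⟦ Δ ⟧ f x ≡ ½ * ⟦ ∇ ^ᵒ 2 ⟧ f (ℤ.pred x)
  Δ≡½∇² f x rewrite ℤₚ.suc-pred x = e (f x) (f (ℤ.suc x)) (f (ℤ.pred x))
    where
    e : ∀ a b c → ½ * (b + c) + - 1ℚ * a ≡ ½ * ((b + - 1ℚ * a) + - 1ℚ * (a + - 1ℚ * c))
    e = solve-∀ ring

  half-bd : ∀ {x B} → ∣ x ∣ ≤ B → ∣ ½ * x ∣ ≤ B
  half-bd {x} {B} p = abs-mono (≤-trans (*-mono₂ 0≤½ (abs⇒0≤ p) ½≤1 ≤-refl) (≤-reflexive (*-identityˡ B)))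
    (abs-scale 0≤½ p)

  ∇²⇒Δ : ∀ f {B} → Bd (⟦ ∇ ^ᵒ 2 ⟧ f) B → Bd (⟦ Δ ⟧ f) B
  ∇²⇒Δ f b x = abs-subst (Δ≡½∇² f x) (half-bd (b (ℤ.pred x)))

  ∇³⇒∇Δ : ∀ f {B} → Bd (⟦ ∇ ^ᵒ 3 ⟧ f) B → Bd (⟦ ∇ ⟧ (⟦ Δ ⟧ f)) B
  ∇³⇒∇Δ f b = Bd-resp (⟦⟧-comm ∇ Δ f) (∇²⇒Δ (⟦ ∇ ⟧ f) (Bd-resp (λ x → ⟦⟧-comm (∇ ^ᵒ 2) ∇ f x) b))

  ∇⁴⇒ΔΔ : ∀ f {B} → Bd (⟦ ∇ ^ᵒ 4 ⟧ f) B → Bd (⟦ Δ ⟧ (⟦ Δ ⟧ f)) B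
  ∇⁴⇒ΔΔ f b = ∇²⇒Δ (⟦ Δ ⟧ f) (Bd-resp (⟦⟧-comm (∇ ^ᵒ 2) Δ f) (∇²⇒Δ (⟦ ∇ ^ᵒ 2 ⟧ f) b))

  pred-reflection : ∀ {ρ} → Reflection ρ → Reflection (λ x → ℤ.pred (ρ x))
  pred-reflection R .Reflection.ρ-suc x = cong ℤ.pred (Reflection.ρ-suc R x)
  pred-reflection {ρ} R .Reflection.ρ-pred x = trans (cong ℤ.pred (Reflection.ρ-pred R x))
    (trans (ℤₚ.pred-suc (ρ x)) (sym (ℤₚ.suc-pred (ρ x))))

  -- A reflection turns a forward difference into minus the forward difference one place lower. The
  -- centre thereby moves, so the induction runs over all reflections.
  ∇^-reflect-bd : ∀ j {ρ} → Reflection ρ → ∀ f {B} → Bd (⟦ ∇ ^ᵒ j ⟧ f) B →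
    Bd (⟦ ∇ ^ᵒ j ⟧ (λ x → f (ρ x))) B
  ∇^-reflect-bd zero {ρ} R f b x = b (ρ x)
  ∇^-reflect-bd (suc j) {ρ} R f b x = abs-subst
    (trans (⟦⟧-comm ∇ (∇ ^ᵒ j) (λ x → f (ρ x)) x)
      (trans (⟦⟧-cong (∇ ^ᵒ j) turn x) (⟦⟧-neg (∇ ^ᵒ j) (λ y → ⟦ ∇ ⟧ f (ℤ.pred (ρ y))) x)))
    (abs-neg (∇^-reflect-bd j (pred-reflection R) (⟦ ∇ ⟧ f) (Bd-resp (⟦⟧-comm (∇ ^ᵒ j) ∇ f) b) x))
    where
    e : ∀ a b → a + - 1ℚ * b ≡ - (b + - 1ℚ * a)
    e = solve-∀ ring
    turn : ∀ y → ⟦ ∇ ⟧ (λ x → f (ρ x)) y ≡ - ⟦ ∇ ⟧ f (ℤ.pred (ρ y))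
    turn y = trans (cong₂ (λ a b → f a + - 1ℚ * f b) (Reflection.ρ-suc R y) (sym (ℤₚ.suc-pred (ρ y))))
      (e (f (ℤ.pred (ρ y))) (f (ℤ.suc (ℤ.pred (ρ y)))))

  oddPart : (ℤ → ℤ) → (ℤ → ℚ) → ℤ → ℚ
  oddPart ρ f x = ½ * f x + (- ½) * f (ρ x)

  oddPart-odd : ∀ ρ → (∀ x → ρ (ρ x) ≡ x) → ∀ f → Odd ρ (oddPart ρ f)
  oddPart-odd ρ inv f x = trans (cong (λ z → ½ * f (ρ x) + (- ½) * f z) (inv x)) (e (f x) (f (ρ x)))
    where
    e : ∀ a b → ½ * b + (- ½) * a ≡ - (½ * a + (- ½) * b)
    e = solve-∀ ring

  opp-opp : ∀ x → opp (opp x) ≡ x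
  opp-opp = ℤₚ.neg-involutive

  mirror-mirror : ∀ x → mirror (mirror x) ≡ x
  mirror-mirror x = trans (cong ℤ.pred (trans (Reflection.ρ-pred opp-reflection (ℤ.- x)) (cong ℤ.suc (opp-opp x))))
    (ℤₚ.pred-suc x)

  oddPart-bd : ∀ j {ρ} → Reflection ρ → ∀ f {B} → Bd (⟦ ∇ ^ᵒ j ⟧ f) B → Bd (⟦ ∇ ^ᵒ j ⟧ (oddPart ρ f)) B
  oddPart-bd j {ρ} R f {B} b x = abs-subst
    (trans (⟦⟧-linear (∇ ^ᵒ j) ½ (- ½) f (λ y → f (ρ y)) x) (e (⟦ ∇ ^ᵒ j ⟧ f x) (⟦ ∇ ^ᵒ j ⟧ (λ y → f (ρ y)) x)))
    (abs-avg (b x) (abs-neg (∇^-reflect-bd j R f b x)))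
    where
    e : ∀ a b → ½ * a + (- ½) * b ≡ ½ * (a + - b)
    e = solve-∀ ring

  ng : ℤ → ℚ
  ng (ℤ.+ n) = 0ℚ
  ng ℤ.-[1+ n ] = 1ℚ

  ∣ng∣≤1 : Bd ng 1ℚ
  ∣ng∣≤1 (ℤ.+ n) = 0≤1
  ∣ng∣≤1 ℤ.-[1+ n ] = ≤-refl

  is : Bool → Bool → ℚ
  is false false = 1ℚ
  is true true = 1ℚ
  is _ _ = 0ℚ

  ∣is∣≤1 : ∀ a c → ∣ is a c ∣ ≤ 1ℚ
  ∣is∣≤1 false false = ≤-refl
  ∣is∣≤1 false true = 0≤1
  ∣is∣≤1 true false = 0≤1
  ∣is∣≤1 true true = ≤-refl

  negAt : Bool → St
  negAt a c x = is a c * ng x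

  -- The proportion P_{t,k}: with x = 2^k - 1 - a, the condition w(a) + w(b) < k says that adding t to x
  -- cyclically lowers the weight, and in cyclic addition the carry out of the top digit is the carry in.
  Pr : Bits → ℚ
  Pr t = U t (negAt false) false ℤ.0ℤ + U t (negAt true) true ℤ.0ℤ

  U-one : ∀ t c x → U t (λ _ _ → 1ℚ) c x ≡ 1ℚ
  U-one [] c x = refl
  U-one (τ ∷ t) c x = trans (U-cong t (one τ) c x) (U-one t c x)
    where
    one : ∀ τ c x → step τ (λ _ _ → 1ℚ) c x ≡ 1ℚ
    one false false x = refl
    one false true x = refl
    one true false x = refl
    one true true x = refl

  α-ng : ∀ t x → α t ng x ≡ ½ * (1ℚ - α t sg x)
  α-ng t x = trans (Av-cong t (λ _ → split) x)
    (trans (Av-linear t ½ (- ½) (λ _ _ → 1ℚ) (const sg) x)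
      (trans (cong (λ z → ½ * z + (- ½) * α t sg x) (cong₂ (λ a b → ½ * (a + b)) (U-one t false x) (U-one t true x)))
        (e (α t sg x))))
    where
    split : ∀ y → ng y ≡ ½ * 1ℚ + (- ½) * sg y
    split (ℤ.+ n) = refl
    split ℤ.-[1+ n ] = refl
    e : ∀ a → ½ * (½ * (1ℚ + 1ℚ)) + (- ½) * a ≡ ½ * (1ℚ - a)
    e = solve-∀ ring

  module Estimates (ν : ℕ) (1≤ν : 1 ℕ.≤ ν) (r : ℚ) (0≤r : 0ℚ ≤ r) (rν≡1 : r * ι ν ≡ 1ℚ) where

    open Scale ν 1≤ν r 0≤r rν≡1 public

    Good : Bits → Set
    Good t = 60 ℕ.* N ℕ.≤ cnt t

    smooth-U : ∀ j t u (c : Bool → ℚ) g → j ℕ.≤ 4 → Good t → (∀ b → ∣ c b ∣ ≤ 1ℚ) → Bd g 1ℚ →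
      BdS (∇ ^ᵒ j ⟨$⟩ U (t ++ u) (λ b x → c b * g x)) (A * pow r j)
    smooth-U j t u c g j≤4 good c≤1 g≤1 b x = abs-subst
      (trans (U-op (t ++ u) (∇ ^ᵒ j) h b x) (trans (U-++ t u (∇ ^ᵒ j ⟨$⟩ h) b x)
        (U-cong u (U-cong t (λ b → ⟦⟧-* (∇ ^ᵒ j) (c b) g)) b x)))
      (U-bd u (smooth j t c g j≤4 good c≤1 g≤1) b x)
      where
      h : St
      h b x = c b * g x

    smooth-α : ∀ j t u g → j ℕ.≤ 4 → Good t → Bd g 1ℚ → Bd (⟦ ∇ ^ᵒ j ⟧ (α (t ++ u) g)) (A * pow r j)
    smooth-α j t u g j≤4 good g≤1 x = abs-subst
      (trans (⟦⟧-cong (∇ ^ᵒ j) (Av-cong (t ++ u) (λ _ y → sym (*-identityˡ (g y)))) x)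
        (trans (⟦⟧-* (∇ ^ᵒ j) ½ (λ y → U (t ++ u) h false y + U (t ++ u) h true y) x)
          (cong (½ *_) (⟦⟧-+ (∇ ^ᵒ j) (U (t ++ u) h false) (U (t ++ u) h true) x))))
      (abs-avg (sm false x) (sm true x))
      where
      h : St
      h _ y = 1ℚ * g y
      sm = smooth-U j t u (λ _ → 1ℚ) g j≤4 good (λ _ → ≤-refl) g≤1

    -- The cost of ignoring a carry, of order r² and so negligible against a mean of order r: twice
    -- the bound on `Δ` from `forget`, and 2 r² for the initial gap after `N` digits.
    D : ℚ
    D = A * pow r 2 + A * pow r 2 + (r * r + r * r)

    2≤4 : 2 ℕ.≤ 4
    2≤4 = ℕ.s≤s (ℕ.s≤s ℕ.z≤n)
    3≤4 : 3 ℕ.≤ 4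
    3≤4 = ℕ.s≤s (ℕ.s≤s (ℕ.s≤s ℕ.z≤n))

    -- The top part t smooths, the bottom part v forgets the incoming carry, and u is arbitrary.
    carry-gap : ∀ t u v (c : Bool → ℚ) g → Good t → N ℕ.≤ length v → (∀ b → ∣ c b ∣ ≤ 1ℚ) → Bd g 1ℚ →
      Bd (λ x → U ((t ++ u) ++ v) (λ b x → c b * g x) true x - U ((t ++ u) ++ v) (λ b x → c b * g x) false x) D
    carry-gap t u v c g good n≤ c≤1 g≤1 x = abs-subst
      (cong₂ _-_ (U-++ (t ++ u) v h true x) (U-++ (t ++ u) v h false x))
      (abs-mono (+-monoʳ-≤ (B + B) tail≤)
        (forget v (U (t ++ u) h) B (1ℚ + 1ℚ)
          (λ b → ∇²⇒Δ (U (t ++ u) h b) (smooth-U 2 t u c g 2≤4 good c≤1 g≤1 b))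
          (λ y → abs-mono (≤-by (0≤+ 0≤B 0≤B) (+-comm (B + B) (1ℚ + 1ℚ)))
            (abs-- (U-bd (t ++ u) h≤1 true y) (U-bd (t ++ u) h≤1 false y))) x))
      where
      h : St
      h b x = c b * g x
      B = A * pow r 2
      0≤B : 0ℚ ≤ B
      0≤B = 0≤* 0≤A (0≤pow 0≤r 2)
      h≤1 : BdS h 1ℚ
      h≤1 b y = abs-mono (≤-reflexive (*-identityˡ 1ℚ)) (abs-* (c≤1 b) (g≤1 y))
      e : ∀ a → a * (1ℚ + 1ℚ) ≡ a + a
      e = solve-∀ ring
      tail≤ : pow ½ (length v) * (1ℚ + 1ℚ) ≤ r * r + r * r
      tail≤ = ≤-trans (≤-reflexive (e (pow ½ (length v)))) (+-mono-≤ p p)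
        where p = ≤-trans (pow-antimono 0≤½ ½≤1 n≤) ½^N≤r²

    private
      half-gap : ∀ {p q} → ∣ p - q ∣ ≤ D → ∣ q - ½ * (q + p) ∣ ≤ ½ * D
      half-gap {p} {q} b = abs-subst (e p q) (abs-scale 0≤½ (abs-neg b))
        where
        e : ∀ p q → q - ½ * (q + p) ≡ ½ * (- (p - q))
        e = solve-∀ ring
      half-gap′ : ∀ {p q} → ∣ p - q ∣ ≤ D → ∣ p - ½ * (q + p) ∣ ≤ ½ * D
      half-gap′ {p} {q} b = abs-subst (e p q) (abs-scale 0≤½ b)
        where
        e : ∀ p q → p - ½ * (q + p) ≡ ½ * (p - q)
        e = solve-∀ ring

    -- For either outgoing carry the incoming one matters by at most `D`, so the condition that they
    -- agree can be traded for a fair incoming carry at a cost of ½ `D` each.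
    open-cycle : ∀ t u v → Good t → N ℕ.≤ length v →
      ∣ Pr ((t ++ u) ++ v) - α ((t ++ u) ++ v) ng ℤ.0ℤ ∣ ≤ D
    open-cycle t u v good n≤ = abs-subst
      (trans (cong (λ y → Pr w - y) both) (e (U w (negAt false) false z) (U w (negAt true) true z) (Av w (negAt false) z) (Av w (negAt true) z)))
      (abs-mono (≤-reflexive (f D)) (abs-+ (half-gap {U w (negAt false) true z} {U w (negAt false) false z} (gap false)) (half-gap′ {U w (negAt true) true z} {U w (negAt true) false z} (gap true))))
      where
      w = (t ++ u) ++ v
      z = ℤ.0ℤ
      gap : ∀ a → ∣ U w (negAt a) true z - U w (negAt a) false z ∣ ≤ D
      gap a = carry-gap t u v (is a) ng good n≤ (∣is∣≤1 a) ∣ng∣≤1 z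
      split : ∀ c y → ng y ≡ negAt false c y + negAt true c y
      split false y = e₁ (ng y)
        where
        e₁ : ∀ a → a ≡ 1ℚ * a + 0ℚ * a
        e₁ = solve-∀ ring
      split true y = e₁ (ng y)
        where
        e₁ : ∀ a → a ≡ 0ℚ * a + 1ℚ * a
        e₁ = solve-∀ ring
      both : α w ng z ≡ Av w (negAt false) z + Av w (negAt true) z
      both = trans (Av-cong w split z) (Av-+ w (negAt false) (negAt true) z)
      e : ∀ a b c d → (a + b) - (c + d) ≡ (a - c) + (b - d)
      e = solve-∀ ring
      f : ∀ D → ½ * D + ½ * D ≡ D
      f = solve-∀ ring

    -- The carry from v into u is replaced by a fair one, which u forgets; this makes the walks of
    -- the lower and the upper part independent.
    cut : ∀ t u v → Good t → N ℕ.≤ length u →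
      ∣ α ((t ++ u) ++ v) sg ℤ.0ℤ - α v (α (t ++ u) sg) ℤ.0ℤ ∣ ≤ ½ * D
    cut t u v good n≤ = abs-subst
      (trans (cong (λ z → z - α v F ℤ.0ℤ) (cong₂ (λ a b → ½ * (a + b)) (U-++ (t ++ u) v (const sg) false ℤ.0ℤ) (U-++ (t ++ u) v (const sg) true ℤ.0ℤ)))
        (trans (e (Av v H ℤ.0ℤ) (α v F ℤ.0ℤ)) (sym (Av-linear v 1ℚ (- 1ℚ) H (const F) ℤ.0ℤ))))
      (Av-bd v near ℤ.0ℤ)
      where
      H : St
      H = U (t ++ u) (const sg)
      F : ℤ → ℚ
      F = α (t ++ u) sg
      e : ∀ a b → a - b ≡ 1ℚ * a + - 1ℚ * b
      e = solve-∀ ring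
      gap : ∀ x → ∣ H true x - H false x ∣ ≤ D
      gap x = abs-subst (cong₂ _-_ (same true) (same false))
        (carry-gap t [] u (λ _ → 1ℚ) sg good n≤ (λ _ → ≤-refl) ∣sg∣≤1 x)
        where
        same : ∀ c → H c x ≡ U ((t ++ []) ++ u) (λ _ y → 1ℚ * sg y) c x
        same c = trans (U-++ t u (const sg) c x)
          (trans (U-cong u (λ c y → trans (U-cong t (λ _ y → sym (*-identityˡ (sg y))) c y)
              (sym (U-++ t [] (λ _ y → 1ℚ * sg y) c y))) c x)
            (sym (U-++ (t ++ []) u (λ _ y → 1ℚ * sg y) c x)))
      near : BdS (λ c x → 1ℚ * H c x + - 1ℚ * F x) (½ * D)
      near false x = abs-subst (sym (e (H false x) (F x))) (half-gap {H true x} {H false x} (gap x))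
      near true x = abs-subst (sym (e (H true x) (F x))) (half-gap′ {H true x} {H false x} (gap x))

  -- The part of α T sg that is even under mirror becomes odd when the order of averaging is exchanged.
  split-odd : ∀ T t → α t (α T sg) ℤ.0ℤ ≡
    α t (oddPart mirror (α T sg)) ℤ.0ℤ + α T (oddPart opp (α t sg)) ℤ.0ℤ
  split-odd T t = trans (Av-cong t (λ _ → halves) o)
    (trans (Av-+ t (const (oddPart mirror F)) (const even) o)
      (cong (α t (oddPart mirror F) o +_) (trans (Av-cong t (λ _ → even-form) o)
        (trans (Av-swap t T K o o) (Av-cong T (λ _ → odd-form) o)))))
    where
    o = ℤ.0ℤ
    F = α T sg
    even : ℤ → ℚ
    even x = ½ * F x + ½ * F (mirror x)
    e₁ : ∀ a b → a ≡ (½ * a + (- ½) * b) + (½ * a + ½ * b)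
    e₁ = solve-∀ ring
    halves : ∀ x → F x ≡ oddPart mirror F x + even x
    halves x = e₁ (F x) (F (mirror x))
    -- Odd in y: evenness in x under `mirror` has become oddness in y under `opp`.
    K : ℤ → ℤ → ℚ
    K x y = ½ * sg (x ℤ.+ y) + (- ½) * sg (x ℤ.+ opp y)
    mirror-+ : ∀ x y → mirror (mirror x ℤ.+ y) ≡ x ℤ.+ opp y
    mirror-+ x y = trans (cong ℤ.pred (ℤₚ.neg-distrib-+ (mirror x) y))
      (trans (sym (ℤₚ.+-assoc ℤ.-1ℤ (opp (mirror x)) (opp y))) (cong (ℤ._+ opp y) (mirror-mirror x)))
    e₂ : ∀ a → a ≡ - (- a)
    e₂ = solve-∀ ring
    e₃ : ∀ a b → ½ * a + ½ * (- b) ≡ ½ * a + (- ½) * b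
    e₃ = solve-∀ ring
    sg-mirror : ∀ x y → sg (mirror x ℤ.+ y) ≡ - sg (x ℤ.+ opp y)
    sg-mirror x y = trans (e₂ (sg (mirror x ℤ.+ y)))
      (cong (-_) (trans (sym (sg-odd (mirror x ℤ.+ y))) (cong sg (mirror-+ x y))))
    even-form : ∀ x → even x ≡ α T (K x) o
    even-form x = trans (cong₂ (λ a b → ½ * a + ½ * b) (sym (Av-translate T sg x)) (sym (Av-translate T sg (mirror x))))
      (trans (sym (Av-linear T ½ ½ (const (λ y → sg (x ℤ.+ y))) (const (λ y → sg (mirror x ℤ.+ y))) o))
        (Av-cong T (λ _ y → trans (cong (λ z → ½ * sg (x ℤ.+ y) + ½ * z) (sg-mirror x y))
          (e₃ (sg (x ℤ.+ y)) (sg (x ℤ.+ opp y)))) o))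
    odd-form : ∀ y → α t (λ x → K x y) o ≡ oddPart opp (α t sg) y
    odd-form y = trans (Av-linear t ½ (- ½) (const (λ x → sg (x ℤ.+ y))) (const (λ x → sg (x ℤ.+ opp y))) o)
      (cong₂ (λ a b → ½ * a + (- ½) * b) (at y) (at (opp y)))
      where
      at : ∀ y → Av t (const (λ x → sg (x ℤ.+ y))) o ≡ α t sg y
      at y = trans (Av-cong t (λ _ x → cong sg (ℤₚ.+-comm x y)) o) (Av-translate t sg y)

  -- Twice the probability that n steps of `L` lead to -1, because `∇` of `sg` is 2 at -1 and 0
  -- elsewhere.
  bump : ℕ → ℤ → ℚ
  bump n = ⟦ ∇ ⟧ (⟦ L ^ᵒ n ⟧ sg)

  -- The odd part at 0 is half a difference between 0 and -1. This mean still depends on T, but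
  -- through a function that is already a difference.
  mean-oddPart : ∀ n T → ⟦ L ^ᵒ n ⟧ (oddPart mirror (α T sg)) ℤ.0ℤ ≡ ½ * α T (bump n) ℤ.-1ℤ
  mean-oddPart n T = trans (⟦⟧-linear (L ^ᵒ n) ½ (- ½) F (λ y → F (mirror y)) ℤ.0ℤ)
    (trans (cong (λ z → ½ * ⟦ L ^ᵒ n ⟧ F ℤ.0ℤ + (- ½) * z) (sym (L^-reflect mirror-reflection n F ℤ.0ℤ)))
      (trans (e (⟦ L ^ᵒ n ⟧ F ℤ.0ℤ) (⟦ L ^ᵒ n ⟧ F ℤ.-1ℤ))
        (cong (½ *_) (Av-op T (∇ ⊙ L ^ᵒ n) (const sg) ℤ.-1ℤ))))
    where
    F = α T sg
    e : ∀ a b → ½ * a + (- ½) * b ≡ ½ * (a + - 1ℚ * b)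
    e = solve-∀ ring

  mean-bump : ∀ m n → ½ * ⟦ L ^ᵒ m ⟧ (bump n) ℤ.-1ℤ ≡ ⟦ L ^ᵒ (m ℕ.+ n) ⟧ sg ℤ.0ℤ
  mean-bump m n = trans (cong (½ *_) (trans (⟦⟧-comm (L ^ᵒ m) ∇ (⟦ L ^ᵒ n ⟧ sg) ℤ.-1ℤ)
      (⟦⟧-cong ∇ (λ x → sym (pow-+ L m n sg x)) ℤ.-1ℤ)))
    (trans (cong (λ z → ½ * (g ℤ.0ℤ + - 1ℚ * z)) (L^-odd mirror-reflection (m ℕ.+ n) sg-odd ℤ.0ℤ)) (e (g ℤ.0ℤ)))
    where
    g = ⟦ L ^ᵒ (m ℕ.+ n) ⟧ sg
    e : ∀ a → ½ * (a + - 1ℚ * (- a)) ≡ a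
    e = solve-∀ ring

-- Second moments of the three error terms.

module SecondMoments where

  open import Data.Rational
  open import Data.Rational.Properties
  open import Tactic.RingSolver using (solve-∀)
  open Operators
  open CarryWalk
  open Variance
  open Coins
  open Scales
  open Symmetry
  open Expansion

  avg-mono-length : ∀ n {X Y} → (∀ t → length t ≡ n → X t ≤ Y t) → avg n X ≤ avg n Y
  avg-mono-length zero p = p [] refl
  avg-mono-length (suc n) p = *-mono 0≤½ (+-mono-≤
    (avg-mono-length n (λ t e → p (false ∷ t) (cong suc e)))
    (avg-mono-length n (λ t e → p (true ∷ t) (cong suc e))))

  Threefold : Set
  Threefold = Bits → Bits → Bits → ℚ

  avg³ : ℕ → ℕ → ℕ → Threefold → ℚ
  avg³ a b c X = avg a (λ t → avg b (λ u → avg c (X t u)))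

  module _ (a b c : ℕ) where

    avg³-+ : ∀ X Y → avg³ a b c (λ t u v → X t u v + Y t u v) ≡ avg³ a b c X + avg³ a b c Y
    avg³-+ X Y = trans (avg-cong a (λ t → trans (avg-cong b (λ u → avg-+ c (X t u) (Y t u)))
        (avg-+ b (λ u → avg c (X t u)) (λ u → avg c (Y t u)))))
      (avg-+ a (λ t → avg b (λ u → avg c (X t u))) (λ t → avg b (λ u → avg c (Y t u))))

    avg³-* : ∀ q X → avg³ a b c (λ t u v → q * X t u v) ≡ q * avg³ a b c X
    avg³-* q X = trans (avg-cong a (λ t → trans (avg-cong b (λ u → avg-* c q (X t u)))
        (avg-* b q (λ u → avg c (X t u))))) (avg-* a q (λ t → avg b (λ u → avg c (X t u))))

    avg-++³ : ∀ X → avg ((a ℕ.+ b) ℕ.+ c) X ≡ avg³ a b c (λ t u v → X ((t ++ u) ++ v))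
    avg-++³ X = trans (avg-++ (a ℕ.+ b) c X) (avg-++ a b (λ t → avg c (λ v → X (t ++ v))))

    avg³-last : ∀ X B → (∀ t u → avg c (X t u) ≤ B) → avg³ a b c X ≤ B
    avg³-last X B p = avg-≤-const a (λ t → avg-≤-const b (λ u → p t u))

    avg³-first : ∀ (X : Bits → Bits → ℚ) B → (∀ v → avg (a ℕ.+ b) (λ T → X T v) ≤ B) →
      avg³ a b c (λ t u v → X (t ++ u) v) ≤ B
    avg³-first X B p = ≤-trans
      (≤-reflexive (trans (sym (avg-++ a b (λ T → avg c (X T)))) (avg-swap (a ℕ.+ b) c X)))
      (avg-≤-const c p)

    avg³-head : ∀ (X : Bits → ℚ) → avg³ a b c (λ t _ _ → X t) ≡ avg a X
    avg³-head X = avg-cong a (λ t → trans (avg-cong b (λ _ → avg-const c (X t))) (avg-const b (X t)))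

    avg³-tail : ∀ (X : Bits → ℚ) → avg³ a b c (λ _ _ v → X v) ≡ avg c X
    avg³-tail X = trans (avg-const a _) (avg-const b (avg c X))

  -- The pointwise half of Chebyshev's inequality: V² X², with V for 1/η, is at least 1 where X
  -- exceeds η in absolute value.
  chebyshev : ∀ V η X → 0ℚ ≤ η → V * η ≡ 1ℚ → V * V * sq X < 1ℚ → ∣ X ∣ ≤ η
  chebyshev V η X 0≤η Vη≡1 p with ∣ X ∣ ≤? η
  ... | yes q = q
  ... | no q = ⊥-elim (<-irrefl refl (≤-<-trans 1≤ p))
    where
    η≤ : η * η ≤ sq X
    η≤ = ≤-trans (*-mono₂ 0≤η (0≤∣p∣ X) (<⇒≤ (≰⇒> q)) (<⇒≤ (≰⇒> q)))
      (≤-reflexive (trans (sym (∣p*q∣≡∣p∣*∣q∣ X X)) (0≤p⇒∣p∣≡p (0≤sq X))))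
    e : ∀ V η → V * V * (η * η) ≡ (V * η) * (V * η)
    e = solve-∀ ring
    1≤ : 1ℚ ≤ V * V * sq X
    1≤ = ≤-trans (≤-reflexive (sym (trans (e V η) (cong (λ z → z * z) Vη≡1)))) (*-mono (0≤sq V) η≤)

  9ℚ : ℚ
  9ℚ = 4ℚ + 4ℚ + 1ℚ

  0≤9 : 0ℚ ≤ 9ℚ
  0≤9 = ≤ᵇ⇒≤ _

  module Moments (ν : ℕ) (1≤ν : 1 ℕ.≤ ν) (r : ℚ) (0≤r : 0ℚ ≤ r) (rν≡1 : r * ι ν ≡ 1ℚ)
    (K : ℕ) (Q : ℚ) (0≤Q : 0ℚ ≤ Q) (Kr²≤Q : ι K * (r * r) ≤ Q) where

    open Estimates ν 1≤ν r 0≤r rν≡1 public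

    -- `incr` is 17/2 G² + ⅛ K B². As B = r G and K r² ≤ Q, it is at most (9 + Q) G²; up to K
    -- increments then give C₁ r⁴.
    C₁ : ℚ
    C₁ = Q * ((9ℚ + Q) * (A * A))

    0≤C₁ : 0ℚ ≤ C₁
    0≤C₁ = 0≤* 0≤Q (0≤* (0≤+ 0≤9 0≤Q) (0≤sq A))

    G B : ℚ
    G = A * pow r 3
    B = A * pow r 4

    0≤G : 0ℚ ≤ G
    0≤G = 0≤* 0≤A (0≤pow 0≤r 3)

    ιr² : ∀ {n} → n ℕ.≤ K → ι n * (r * r) ≤ Q
    ιr² {n} p = ≤-trans (*-mono₂ (0≤ι n) (0≤sq r) (ι-mono p) ≤-refl) Kr²≤Q

    ι-incr : ∀ {n} → n ℕ.≤ K → ι n * incr K G B ≤ C₁ * pow r 4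
    ι-incr {n} n≤K = ≤-trans (*-mono (0≤ι n) incr≤)
      (≤-trans (≤-reflexive (e₂ (ι n) A r Q))
        (*-mono₂ (0≤* (0≤* (0≤ι n) (0≤sq r)) (0≤* (0≤+ 0≤9 0≤Q) (0≤sq A))) (0≤pow 0≤r 4)
          (*-mono₂ (0≤* (0≤ι n) (0≤sq r)) (0≤* (0≤+ 0≤9 0≤Q) (0≤sq A)) (ιr² n≤K) ≤-refl) ≤-refl))
      where
      expand : ∀ G B k → ¼ * (((G + G) + (G + G)) * ((G + G) + (G + G)) + ((G + G) + (G + G)) * ((G + G) + (G + G))
          + ((G * G + k * (¼ * (B * B))) + (G * G + k * (¼ * (B * B)))))
        ≡ (4ℚ + 4ℚ + ½) * (G * G) + ⅛ * (k * (B * B))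
      expand = solve-∀ ring
      e₁ : ∀ A p r Q k → (9ℚ + Q) * (A * A) * (p * p) ≡
        ((4ℚ + 4ℚ + ½) * ((A * p) * (A * p)) + ⅛ * (k * ((A * (r * p)) * (A * (r * p)))))
        + (½ * ((A * p) * (A * p)) + (⅞ * Q + ⅛ * (Q - k * (r * r))) * ((A * p) * (A * p)))
      e₁ = solve-∀ ring
      incr≤ : incr K G B ≤ (9ℚ + Q) * (A * A) * (pow r 3 * pow r 3)
      incr≤ = ≤-by (0≤+ (0≤* 0≤½ (0≤sq G)) (0≤* (0≤+ (0≤* 0≤⅞ 0≤Q) (0≤* 0≤⅛ (≤⇒0≤ Kr²≤Q))) (0≤sq G)))
        (trans (e₁ A (pow r 3) r Q (ι K)) (cong (_+ (½ * sq G + (⅞ * Q + ⅛ * (Q - ι K * (r * r))) * sq G)) (sym (expand G B (ι K)))))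
      e₂ : ∀ n A r Q → n * ((9ℚ + Q) * (A * A) * ((r * (r * (r * 1ℚ))) * (r * (r * (r * 1ℚ)))))
        ≡ (n * (r * r)) * ((9ℚ + Q) * (A * A)) * (r * (r * (r * (r * 1ℚ))))
      e₂ = solve-∀ ring

    -- In `X₁` the lower part t is random and T smooths; in `X₂` the roles are exchanged. The mean
    -- subtracted in `X₁` depends on T, and half of `X₃` is the deviation of that mean.
    X₁ X₂ : Bits → Bits → ℕ → ℚ
    X₁ T t n = α t (oddPart mirror (α T sg)) ℤ.0ℤ - ⟦ L ^ᵒ n ⟧ (oddPart mirror (α T sg)) ℤ.0ℤ
    X₂ T t n = α T (oddPart opp (α t sg)) ℤ.0ℤ - ⟦ L ^ᵒ n ⟧ (oddPart opp (α t sg)) ℤ.0ℤ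

    X₃ : Bits → ℕ → ℕ → ℚ
    X₃ T m n = α T (bump n) ℤ.-1ℤ - ⟦ L ^ᵒ m ⟧ (bump n) ℤ.-1ℤ

    private
      commute : ∀ p f x → ⟦ ∇ ⟧ (⟦ L ^ᵒ p ⟧ (⟦ Δ ⟧ f)) x ≡ ⟦ L ^ᵒ p ⟧ (⟦ ∇ ⟧ (⟦ Δ ⟧ f)) x
      commute p f x = ⟦⟧-comm ∇ (L ^ᵒ p) (⟦ Δ ⟧ f) x

    EX₁ : ∀ t u n → Good t → n ℕ.≤ K → avg n (λ v → sq (X₁ (t ++ u) v n)) ≤ C₁ * pow r 4
    EX₁ t u n good n≤K = ≤-trans
      (α-variance-odd n K f ℤ.0ℤ G B n≤K centre ∇Δ (∇⁴⇒ΔΔ f (sm 4 ℕₚ.≤-refl)))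
      (ι-incr n≤K)
      where
      f = oddPart mirror (α (t ++ u) sg)
      sm : ∀ j → j ℕ.≤ 4 → Bd (⟦ ∇ ^ᵒ j ⟧ f) (A * pow r j)
      sm j p = oddPart-bd j mirror-reflection (α (t ++ u) sg) (smooth-α j t u sg p good ∣sg∣≤1)
      ∇Δ : Bd (⟦ ∇ ⟧ (⟦ Δ ⟧ f)) G
      ∇Δ = ∇³⇒∇Δ f (sm 3 3≤4)
      centre : ∀ p → ∣ ⟦ L ^ᵒ p ⟧ (⟦ Δ ⟧ f) ℤ.0ℤ ∣ ≤ G
      centre p = odd-mirror-0 (⟦ L ^ᵒ p ⟧ (⟦ Δ ⟧ f)) G
        (L^-odd mirror-reflection p {⟦ Δ ⟧ f} (Δ-odd mirror-reflection {f} (oddPart-odd mirror mirror-mirror (α (t ++ u) sg))))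
        (Bd-resp (commute p f) (pow-contraction L-contraction p ∇Δ))

    EX₂ : ∀ t n → Good t → n ℕ.≤ K → avg n (λ T → sq (X₂ T t n)) ≤ C₁ * pow r 4
    EX₂ t n good n≤K = ≤-trans
      (α-variance-odd n K f ℤ.0ℤ G B n≤K centre (∇³⇒∇Δ f (sm 3 3≤4)) (∇⁴⇒ΔΔ f (sm 4 ℕₚ.≤-refl)))
      (ι-incr n≤K)
      where
      f = oddPart opp (α t sg)
      sm : ∀ j → j ℕ.≤ 4 → Bd (⟦ ∇ ^ᵒ j ⟧ f) (A * pow r j)
      sm j p = oddPart-bd j opp-reflection (α t sg)
        (subst (λ w → Bd (⟦ ∇ ^ᵒ j ⟧ (α w sg)) (A * pow r j)) (Listₚ.++-identityʳ t) (smooth-α j t [] sg p good ∣sg∣≤1))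
      centre : ∀ p → ∣ ⟦ L ^ᵒ p ⟧ (⟦ Δ ⟧ f) ℤ.0ℤ ∣ ≤ G
      centre p = abs-subst (odd-opp-0 (⟦ L ^ᵒ p ⟧ (⟦ Δ ⟧ f))
        (L^-odd opp-reflection p {⟦ Δ ⟧ f} (Δ-odd opp-reflection {f} (oddPart-odd opp opp-opp (α t sg))))) 0≤G

    bump-smooth : ∀ n → 3 ℕ.* N ℕ.≤ n → Bd (⟦ Δ ⟧ (bump n)) G
    bump-smooth n p = ∇²⇒Δ (bump n) (λ x → abs-mono
      (≤-trans (≤-reflexive (trans (*-identityʳ (pow (4ℚ * r) 3)) (pow-mul 4ℚ r 3)))
        (*-mono₂ (0≤pow 0≤4 3) (0≤pow 0≤r 3)
          (≤-trans (pow-inflate 1≤4 3≤4) (≤-by 0≤1 refl)) ≤-refl))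
      (∇^L^-bd 3 n p ∣sg∣≤1 x))

    -- The difference inside `bump` supplies the factor r that oddness supplies elsewhere: `Δ` of it
    -- is of order r³, and `α-variance` suffices.
    EX₃ : ∀ m n → 3 ℕ.* N ℕ.≤ n → m ℕ.≤ K → avg m (λ T → sq (X₃ T m n)) ≤ C₁ * pow r 4
    EX₃ m n p m≤K = ≤-trans
      (α-variance m (bump n) ℤ.-1ℤ (⟦ L ^ᵒ m ⟧ (bump n) ℤ.-1ℤ) G (bump-smooth n p))
      (≤-trans (≤-reflexive (e₁ (⟦ L ^ᵒ m ⟧ (bump n) ℤ.-1ℤ) (ι m) A r))
        (≤-trans (*-mono₂ (0≤* 0≤A² (0≤* (0≤ι m) (0≤sq r))) (0≤pow 0≤r 4) (*-mono 0≤A² (ιr² m≤K)) ≤-refl)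
          (*-mono₂ (0≤* 0≤A² 0≤Q) (0≤pow 0≤r 4) (≤-by 0≤rest (e₂ A Q)) ≤-refl)))
      where
      0≤A² : 0ℚ ≤ ¼ * (A * A)
      0≤A² = 0≤* 0≤¼ (0≤sq A)
      e₁ : ∀ a m A r → (a - a) * (a - a) + m * (¼ * ((A * (r * (r * (r * 1ℚ)))) * (A * (r * (r * (r * 1ℚ))))))
        ≡ ¼ * (A * A) * (m * (r * r)) * (r * (r * (r * (r * 1ℚ))))
      e₁ = solve-∀ ring
      0≤rest : 0ℚ ≤ Q * (A * A) * (4ℚ + 4ℚ + ¾ + Q)
      0≤rest = 0≤* (0≤* 0≤Q (0≤sq A)) (0≤+ (0≤+ (0≤+ 0≤4 0≤4) (0≤+ 0≤½ 0≤¼)) 0≤Q)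
      e₂ : ∀ A Q → Q * ((9ℚ + Q) * (A * A)) ≡ ¼ * (A * A) * Q + Q * (A * A) * (4ℚ + 4ℚ + ¾ + Q)
      e₂ = solve-∀ ring

    -- An exponential moment that is at least 1 whenever t is not `Good`.
    few : Bits → ℚ
    few t = pow 2ℚ (60 ℕ.* N) * pow ½ (cnt t)

    0≤few : ∀ t → 0ℚ ≤ few t
    0≤few t = 0≤* (0≤pow (≤-trans 0≤1 1≤2) (60 ℕ.* N)) (0≤pow 0≤½ (cnt t))

    few<1⇒Good : ∀ t → few t < 1ℚ → Good t
    few<1⇒Good t p with ℕₚ.≤-total (60 ℕ.* N) (cnt t)
    ... | inj₁ q = q
    ... | inj₂ q = ⊥-elim (<-irrefl refl (≤-<-trans (≤-trans (≤-reflexive (sym (2^-½^ (cnt t))))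
      (*-mono₂ (0≤pow (≤-trans 0≤1 1≤2) (cnt t)) (0≤pow 0≤½ (cnt t)) (pow-inflate 1≤2 q) ≤-refl)) p))

    -- A random string of ℓ digits is Good except with probability at most 2^(60 N) (15/16)^(ℓ/3) ≤ r².
    ℓ : ℕ
    ℓ = 61 ℕ.* N ℕ.* 11 ℕ.* 3

    Efew : avg ℓ few ≤ r * r
    Efew = ≤-trans (≤-reflexive (trans (avg-* ℓ (pow 2ℚ (60 ℕ.* N)) (λ t → pow ½ (cnt t)))
        (cong (pow 2ℚ (60 ℕ.* N) *_) (trans (avg-cnt (61 ℕ.* N ℕ.* 11)) (pow-exp-* 15/16 (61 ℕ.* N) 11)))))
      (≤-trans (*-mono (0≤pow (≤-trans 0≤1 1≤2) (60 ℕ.* N)) (pow-mono (0≤pow 0≤15/16 11) 15/16^11≤½ (61 ℕ.* N)))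
        (≤-trans (≤-reflexive (trans (cong (pow 2ℚ (60 ℕ.* N) *_) split) (trans (e (pow 2ℚ (60 ℕ.* N)) (pow ½ (60 ℕ.* N)) (pow ½ N))
          (trans (cong (_* pow ½ N) (2^-½^ (60 ℕ.* N))) (*-identityˡ (pow ½ N)))))) ½^N≤r²))
      where
      split : pow ½ (61 ℕ.* N) ≡ pow ½ N * pow ½ (60 ℕ.* N)
      split = pow-exp-+ ½ N (60 ℕ.* N)
      e : ∀ a b c → a * (c * b) ≡ (a * b) * c
      e = solve-∀ ring

    N≤ℓ : N ℕ.≤ ℓ
    N≤ℓ = ℕₚ.≤-trans (ℕₚ.m≤m+n N (60 ℕ.* N))
      (ℕₚ.≤-trans (ℕₚ.m≤m*n (61 ℕ.* N) 11) (ℕₚ.m≤m*n (61 ℕ.* N ℕ.* 11) 3))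

    3N≤ℓ : 3 ℕ.* N ℕ.≤ ℓ
    3N≤ℓ = ℕₚ.≤-trans (ℕₚ.*-monoʳ-≤ 3 (ℕₚ.≤-trans (ℕₚ.m≤m+n N (60 ℕ.* N)) (ℕₚ.m≤m*n (61 ℕ.* N) 11)))
      (ℕₚ.≤-reflexive (ℕₚ.*-comm 3 (61 ℕ.* N ℕ.* 11)))

-- One majorant for all exceptional t.

module Majorant where

  open import Data.Rational
  open import Data.Rational.Properties
  open import Tactic.RingSolver using (solve-∀)
  open Operators
  open CarryWalk
  open Variance
  open Coins
  open Scales
  open Symmetry
  open Expansion
  open SecondMoments

  <-0≤ : ∀ {a b c} → 0ℚ ≤ b → a + b < c → a < c
  <-0≤ {a} {b} p q = ≤-<-trans (≤-by p refl) q

  module Concentration (ν : ℕ) (1≤ν : 1 ℕ.≤ ν) (r : ℚ) (0≤r : 0ℚ ≤ r) (rν≡1 : r * ι ν ≡ 1ℚ)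
    (K : ℕ) (Q : ℚ) (0≤Q : 0ℚ ≤ Q) (Kr²≤Q : ι K * (r * r) ≤ Q)
    (Θ θ : ℚ) (0≤θ : 0ℚ ≤ θ) (Θθ≡1 : Θ * θ ≡ 1ℚ) (θ-small : (6ℚ * Q + 1ℚ) * (θ * θ) ≤ 1ℚ)
    where

    open Moments ν 1≤ν r 0≤r rν≡1 K Q 0≤Q Kr²≤Q public

    -- The centre is at least `q`; each of the three errors is allowed a quarter of it, and `V` is
    -- 1/`η`.
    q η V : ℚ
    q = θ * r
    η = ¼ * q
    V = 4ℚ * (Θ * ι ν)

    0≤q : 0ℚ ≤ q
    0≤q = 0≤* 0≤θ 0≤r

    0≤η : 0ℚ ≤ η
    0≤η = 0≤* 0≤¼ 0≤q

    Vη≡1 : V * η ≡ 1ℚ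
    Vη≡1 = trans (e Θ (ι ν) θ r) (trans (cong₂ _*_ Θθ≡1 rν≡1) (*-identityˡ 1ℚ))
      where
      e : ∀ a n b r → 4ℚ * (a * n) * (¼ * (b * r)) ≡ (a * b) * (r * n)
      e = solve-∀ ring

    centre-lower : ∀ n → n ℕ.≤ K → q ≤ ⟦ L ^ᵒ n ⟧ sg ℤ.0ℤ
    centre-lower n n≤K = L^sg-lower n q 0≤q (≤-trans (≤-reflexive (e (ι n) θ r))
      (≤-trans (*-mono₂ (0≤+ (0≤* 0≤6 (0≤* (0≤ι n) (0≤sq r))) (0≤sq r)) (0≤sq θ)
        (+-mono-≤ (*-mono 0≤6 (ιr² n≤K)) r²≤1) ≤-refl) θ-small))
      where
      0≤6 : 0ℚ ≤ 6ℚ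
      0≤6 = ≤ᵇ⇒≤ _
      r²≤1 : r * r ≤ 1ℚ
      r²≤1 = ≤-trans (*-mono₂ 0≤r 0≤1 r≤1 r≤1) (≤-reflexive (*-identityˡ 1ℚ))
      e : ∀ n t r → (6ℚ * n + 1ℚ) * ((t * r) * (t * r)) ≡ (6ℚ * (n * (r * r)) + r * r) * (t * t)
      e = solve-∀ ring

    centre-upper : ∀ n → N ℕ.≤ n → ⟦ L ^ᵒ n ⟧ sg ℤ.0ℤ ≤ 4ℚ * r
    centre-upper n p = ≤-trans (abs-upper (odd-mirror-0 (⟦ L ^ᵒ n ⟧ sg) (pow (4ℚ * r) 1 * 1ℚ)
        (L^-odd mirror-reflection n sg-odd) (∇^L^-bd 1 n (subst (ℕ._≤ n) (sym (ℕₚ.+-identityʳ N)) p) ∣sg∣≤1)))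
      (≤-reflexive (e r))
      where
      e : ∀ r → 4ℚ * r * 1ℚ * 1ℚ ≡ 4ℚ * r
      e = solve-∀ ring

    module Parts (m : ℕ) (N≤m : N ℕ.≤ m) (k≤K : (ℓ ℕ.+ m) ℕ.+ ℓ ℕ.≤ K) where

      k ℓm : ℕ
      ℓm = ℓ ℕ.+ m
      k = ℓm ℕ.+ ℓ

      ℓm≤K : ℓm ℕ.≤ K
      ℓm≤K = ℕₚ.≤-trans (ℕₚ.m≤m+n ℓm ℓ) k≤K

      ℓ≤K : ℓ ℕ.≤ K
      ℓ≤K = ℕₚ.≤-trans (ℕₚ.m≤n+m ℓ ℓm) k≤K

      -- The mean of the first odd part is evaluated by `mean-oddPart` and `mean-bump`; that of the
      -- second is 0, being the value at 0 of a function odd under `opp`.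
      expansion : ∀ T v → α v (α T sg) ℤ.0ℤ ≡ X₁ T v ℓ + ½ * X₃ T ℓm ℓ + ⟦ L ^ᵒ k ⟧ sg ℤ.0ℤ + X₂ T v ℓm
      expansion T v = trans (split-odd T v)
        (cong₂ _+_ (trans (e₁ (α v f₁ o) (⟦ L ^ᵒ ℓ ⟧ f₁ o) (α T (bump ℓ) ℤ.-1ℤ) (⟦ L ^ᵒ ℓm ⟧ (bump ℓ) ℤ.-1ℤ))
            (trans (cong (λ z → X₁ T v ℓ + ½ * X₃ T ℓm ℓ + ½ * ⟦ L ^ᵒ ℓm ⟧ (bump ℓ) ℤ.-1ℤ + z)
                     (trans (cong (λ z → z - ½ * α T (bump ℓ) ℤ.-1ℤ) (mean-oddPart ℓ T)) (+-inverseʳ (½ * α T (bump ℓ) ℤ.-1ℤ))))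
              (trans (+-identityʳ (X₁ T v ℓ + ½ * X₃ T ℓm ℓ + ½ * ⟦ L ^ᵒ ℓm ⟧ (bump ℓ) ℤ.-1ℤ)) (cong (X₁ T v ℓ + ½ * X₃ T ℓm ℓ +_) (mean-bump ℓm ℓ)))))
          (trans (e₂ (α T f₂ o) (⟦ L ^ᵒ ℓm ⟧ f₂ o)) (trans (cong (X₂ T v ℓm +_)
            (odd-opp-0 (⟦ L ^ᵒ ℓm ⟧ f₂) (L^-odd opp-reflection ℓm (oddPart-odd opp opp-opp (α v sg)))))
            (+-identityʳ (X₂ T v ℓm)))))
        where
        o = ℤ.0ℤ
        f₁ = oddPart mirror (α T sg)
        f₂ = oddPart opp (α v sg)
        e₁ : ∀ a b c d → a ≡ (a - b) + ½ * (c - d) + ½ * d + (b - ½ * c)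
        e₁ = solve-∀ ring
        e₂ : ∀ a b → a ≡ (a - b) + b
        e₂ = solve-∀ ring

      private
        lower-form : ∀ x₁ x₂ x₃ Z q h D s e₀ → s + (- 1ℚ) * (e₀ + e₀) ≡
          (q - (h + h + h) - (D + D + D))
          + ((x₁ + h) + (x₂ + h) + ½ * (x₃ + h) + ½ * h + (Z - q)
            + ((s - (x₁ + ½ * x₃ + Z + x₂)) + D) + (D - e₀) + (D - e₀))
        lower-form = solve-∀ ring
        upper-form : ∀ x₁ x₂ x₃ Z u h D s e₀ → (u + (h + h + h) + (D + D + D)) ≡
          (s + (- 1ℚ) * (e₀ + e₀))
          + ((h - x₁) + (h - x₂) + ½ * (h - x₃) + ½ * h + (u - Z)
            + (D - (s - (x₁ + ½ * x₃ + Z + x₂))) + (D + e₀) + (D + e₀))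
        upper-form = solve-∀ ring
        up : ∀ {x h} → ∣ x ∣ ≤ h → 0ℚ ≤ h - x
        up p = ≤⇒0≤ (abs-upper p)
        lo : ∀ {x h} → ∣ x ∣ ≤ h → 0ℚ ≤ x + h
        lo {x} {h} p = subst (0ℚ ≤_) (e x h) (≤⇒0≤ (abs-lower p))
          where
          e : ∀ x h → h - - x ≡ x + h
          e = solve-∀ ring
        lo′ : ∀ {x h} → ∣ x ∣ ≤ h → 0ℚ ≤ h + x
        lo′ {x} {h} p = subst (0ℚ ≤_) (+-comm x h) (lo p)
        bias-form : ∀ p a → 1ℚ - (p + p) ≡ a + (- 1ℚ) * ((p - ½ * (1ℚ - a)) + (p - ½ * (1ℚ - a)))
        bias-form = solve-∀ ring

      -- Three `η` for the deviations, and three `D`: one for `cut`, and two for `open-cycle`, whose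
      -- error is doubled in 1 - 2 `Pr`.
      bias : ∀ t u v → length u ≡ m → length v ≡ ℓ → Good t → Good v →
        ∣ X₁ (t ++ u) v ℓ ∣ ≤ η → ∣ X₂ (t ++ u) v ℓm ∣ ≤ η → ∣ X₃ (t ++ u) ℓm ℓ ∣ ≤ η →
        (q - (η + η + η) - (D + D + D) ≤ 1ℚ - (Pr ((t ++ u) ++ v) + Pr ((t ++ u) ++ v)))
        × (1ℚ - (Pr ((t ++ u) ++ v) + Pr ((t ++ u) ++ v)) ≤ 4ℚ * r + (η + η + η) + (D + D + D))
      bias t u v lu lv gt gv b₁ b₂ b₃ =
          subst (q - (η + η + η) - (D + D + D) ≤_) (sym form)
            (≤-by (0≤+ (0≤+ (0≤+ (0≤+ (0≤+ (0≤+ (0≤+ (lo b₁) (lo b₂)) (0≤* 0≤½ (lo b₃))) (0≤* 0≤½ 0≤η))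
                (≤⇒0≤ (centre-lower k k≤K))) (lo e₁)) (up e₀)) (up e₀))
              (lower-form (X₁ tu v ℓ) (X₂ tu v ℓm) (X₃ tu ℓm ℓ) Z q η D (α w sg ℤ.0ℤ) E₀))
        , subst (_≤ 4ℚ * r + (η + η + η) + (D + D + D)) (sym form)
            (≤-by (0≤+ (0≤+ (0≤+ (0≤+ (0≤+ (0≤+ (0≤+ (up b₁) (up b₂)) (0≤* 0≤½ (up b₃))) (0≤* 0≤½ 0≤η))
                (≤⇒0≤ (centre-upper k N≤k))) (up e₁)) (lo′ e₀)) (lo′ e₀))
              (upper-form (X₁ tu v ℓ) (X₂ tu v ℓm) (X₃ tu ℓm ℓ) Z (4ℚ * r) η D (α w sg ℤ.0ℤ) E₀))
        where
        tu = t ++ u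
        w = tu ++ v
        Z = ⟦ L ^ᵒ k ⟧ sg ℤ.0ℤ
        E₀ = Pr w - ½ * (1ℚ - α w sg ℤ.0ℤ)
        N≤k : N ℕ.≤ k
        N≤k = ℕₚ.≤-trans N≤ℓ (ℕₚ.m≤n+m ℓ ℓm)
        e₀ : ∣ E₀ ∣ ≤ D
        e₀ = abs-subst (cong (λ z → Pr w - z) (sym (α-ng w ℤ.0ℤ))) (open-cycle t u v gt (subst (N ℕ.≤_) (sym lv) N≤ℓ))
        e₁ : ∣ α w sg ℤ.0ℤ - (X₁ tu v ℓ + ½ * X₃ tu ℓm ℓ + Z + X₂ tu v ℓm) ∣ ≤ D
        e₁ = abs-subst (cong (λ z → α w sg ℤ.0ℤ - z) (sym (expansion tu v)))
          (abs-mono (≤-trans (*-mono₂ 0≤½ (abs⇒0≤ e₀) ½≤1 ≤-refl) (≤-reflexive (*-identityˡ D)))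
            (cut t u v gt (subst (N ℕ.≤_) (sym lu) N≤m)))
        form : 1ℚ - (Pr w + Pr w) ≡ α w sg ℤ.0ℤ + (- 1ℚ) * (E₀ + E₀)
        form = bias-form (Pr w) (α w sg ℤ.0ℤ)

      -- Second moments are controlled for `Good` strings only; the others are left to `few`.
      ifGood : Bits → ℚ → ℚ
      ifGood t x with 60 ℕ.* N ℕ.≤? cnt t
      ... | yes _ = x
      ... | no _ = 0ℚ

      0≤ifGood : ∀ t {x} → 0ℚ ≤ x → 0ℚ ≤ ifGood t x
      0≤ifGood t p with 60 ℕ.* N ℕ.≤? cnt t
      ... | yes _ = p
      ... | no _ = ≤-refl

      ifGood-yes : ∀ t x → Good t → ifGood t x ≡ x
      ifGood-yes t x p with 60 ℕ.* N ℕ.≤? cnt t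
      ... | yes _ = refl
      ... | no ¬p = ⊥-elim (¬p p)

      avg-ifGood : ∀ t n X B → 0ℚ ≤ B → (Good t → avg n X ≤ B) → avg n (λ u → ifGood t (X u)) ≤ B
      avg-ifGood t n X B 0≤B p with 60 ℕ.* N ℕ.≤? cnt t
      ... | yes g = p g
      ... | no _ = ≤-trans (≤-reflexive (avg-const n 0ℚ)) 0≤B

      W : ℚ
      W = V * V

      few₂ dev : Threefold
      few₂ t u v = few t + few v
      dev t u v = ifGood t (sq (X₁ (t ++ u) v ℓ)) + ifGood v (sq (X₂ (t ++ u) v ℓm)) + sq (X₃ (t ++ u) ℓm ℓ)

      majorant : Threefold
      majorant t u v = few₂ t u v + W * dev t u v

      C₂ : ℚ
      C₂ = 2ℚ + (4ℚ * Θ) * (4ℚ * Θ) * (C₁ + C₁ + C₁)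

      -- `W` is of order r⁻² and the second moments are of order r⁴, which leaves r², the density
      -- 1/k that is claimed.
      E-majorant : avg³ ℓ m ℓ majorant ≤ C₂ * (r * r)
      E-majorant = ≤-trans (≤-reflexive (trans (avg³-+ ℓ m ℓ few₂ (λ t u v → W * dev t u v))
          (cong₂ _+_ (trans (avg³-+ ℓ m ℓ (λ t _ _ → few t) (λ _ _ v → few v))
              (cong₂ _+_ (avg³-head ℓ m ℓ few) (avg³-tail ℓ m ℓ few)))
            (trans (avg³-* ℓ m ℓ W dev) (cong (W *_)
              (trans (avg³-+ ℓ m ℓ (λ t u v → d₁ t u v + d₂ t u v) d₃) (cong (_+ avg³ ℓ m ℓ d₃) (avg³-+ ℓ m ℓ d₁ d₂))))))))
        (≤-trans (+-mono-≤ (+-mono-≤ Efew Efew) (*-mono (0≤sq V) (+-mono-≤ (+-mono-≤ E₁ E₂) E₃)))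
          (≤-reflexive (trans (e Θ (ι ν) r C₁)
            (trans (cong (λ z → 2ℚ * (r * r) + (4ℚ * Θ) * (4ℚ * Θ) * (C₁ + C₁ + C₁) * (r * r) * (z * z)) rν≡1)
              (e′ Θ r C₁)))))
        where
        d₁ d₂ d₃ : Threefold
        d₁ t u v = ifGood t (sq (X₁ (t ++ u) v ℓ))
        d₂ t u v = ifGood v (sq (X₂ (t ++ u) v ℓm))
        d₃ t u v = sq (X₃ (t ++ u) ℓm ℓ)
        b = C₁ * pow r 4
        0≤b : 0ℚ ≤ b
        0≤b = 0≤* 0≤C₁ (0≤pow 0≤r 4)
        E₁ : avg³ ℓ m ℓ d₁ ≤ b
        E₁ = avg³-last ℓ m ℓ d₁ b (λ t u → avg-ifGood t ℓ (λ v → sq (X₁ (t ++ u) v ℓ)) b 0≤b (λ g → EX₁ t u ℓ g ℓ≤K))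
        E₂ : avg³ ℓ m ℓ d₂ ≤ b
        E₂ = avg³-first ℓ m ℓ (λ T v → ifGood v (sq (X₂ T v ℓm))) b
          (λ v → avg-ifGood v ℓm (λ T → sq (X₂ T v ℓm)) b 0≤b (λ g → EX₂ v ℓm g ℓm≤K))
        E₃ : avg³ ℓ m ℓ d₃ ≤ b
        E₃ = avg³-first ℓ m ℓ (λ T _ → sq (X₃ T ℓm ℓ)) b (λ _ → EX₃ ℓm ℓ 3N≤ℓ ℓm≤K)
        e : ∀ Θ n r C → r * r + r * r + (4ℚ * (Θ * n)) * (4ℚ * (Θ * n))
            * (C * (r * (r * (r * (r * 1ℚ)))) + C * (r * (r * (r * (r * 1ℚ)))) + C * (r * (r * (r * (r * 1ℚ)))))
          ≡ 2ℚ * (r * r) + (4ℚ * Θ) * (4ℚ * Θ) * (C + C + C) * (r * r) * ((r * n) * (r * n))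
        e = solve-∀ ring
        e′ : ∀ Θ r C → 2ℚ * (r * r) + (4ℚ * Θ) * (4ℚ * Θ) * (C + C + C) * (r * r) * (1ℚ * 1ℚ)
          ≡ (2ℚ + (4ℚ * Θ) * (4ℚ * Θ) * (C + C + C)) * (r * r)
        e′ = solve-∀ ring

      majorant<1 : ∀ t u v → length u ≡ m → length v ≡ ℓ → majorant t u v < 1ℚ →
        (q - (η + η + η) - (D + D + D) ≤ 1ℚ - (Pr ((t ++ u) ++ v) + Pr ((t ++ u) ++ v)))
        × (1ℚ - (Pr ((t ++ u) ++ v) + Pr ((t ++ u) ++ v)) ≤ 4ℚ * r + (η + η + η) + (D + D + D))
      majorant<1 t u v lu lv p = bias t u v lu lv gt gv
        (chebyshev V η (X₁ (t ++ u) v ℓ) 0≤η Vη≡1 (subst (λ z → W * z < 1ℚ) (ifGood-yes t _ gt) small₁))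
        (chebyshev V η (X₂ (t ++ u) v ℓm) 0≤η Vη≡1 (subst (λ z → W * z < 1ℚ) (ifGood-yes v _ gv) small₂))
        (chebyshev V η (X₃ (t ++ u) ℓm ℓ) 0≤η Vη≡1 small₃)
        where
        d₁ = ifGood t (sq (X₁ (t ++ u) v ℓ))
        d₂ = ifGood v (sq (X₂ (t ++ u) v ℓm))
        d₃ = sq (X₃ (t ++ u) ℓm ℓ)
        0≤W = 0≤sq V
        0≤d₁ = 0≤ifGood t (0≤sq (X₁ (t ++ u) v ℓ))
        0≤d₂ = 0≤ifGood v (0≤sq (X₂ (t ++ u) v ℓm))
        0≤d₃ = 0≤sq (X₃ (t ++ u) ℓm ℓ)
        pick : ∀ {x y} → 0ℚ ≤ y → majorant t u v ≡ x + y → x < 1ℚ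
        pick {x} {y} 0≤y eq = <-0≤ {x} {y} 0≤y (subst (_< 1ℚ) eq p)
        f₁ : ∀ a b w x y z → a + b + w * (x + y + z) ≡ a + (b + w * (x + y + z))
        f₁ = solve-∀ ring
        f₂ : ∀ a b w x y z → a + b + w * (x + y + z) ≡ b + (a + w * (x + y + z))
        f₂ = solve-∀ ring
        f₃ : ∀ a b w x y z → a + b + w * (x + y + z) ≡ w * x + (a + b + w * (y + z))
        f₃ = solve-∀ ring
        f₄ : ∀ a b w x y z → a + b + w * (x + y + z) ≡ w * y + (a + b + w * (x + z))
        f₄ = solve-∀ ring
        f₅ : ∀ a b w x y z → a + b + w * (x + y + z) ≡ w * z + (a + b + w * (x + y))
        f₅ = solve-∀ ring
        0≤f = 0≤+ (0≤few t) (0≤few v)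
        gt : Good t
        gt = few<1⇒Good t (pick (0≤+ (0≤few v) (0≤* 0≤W (0≤+ (0≤+ 0≤d₁ 0≤d₂) 0≤d₃))) (f₁ (few t) (few v) W d₁ d₂ d₃))
        gv : Good v
        gv = few<1⇒Good v (pick (0≤+ (0≤few t) (0≤* 0≤W (0≤+ (0≤+ 0≤d₁ 0≤d₂) 0≤d₃))) (f₂ (few t) (few v) W d₁ d₂ d₃))
        small₁ : W * d₁ < 1ℚ
        small₁ = pick (0≤+ 0≤f (0≤* 0≤W (0≤+ 0≤d₂ 0≤d₃))) (f₃ (few t) (few v) W d₁ d₂ d₃)
        small₂ : W * d₂ < 1ℚ
        small₂ = pick (0≤+ 0≤f (0≤* 0≤W (0≤+ 0≤d₁ 0≤d₃))) (f₄ (few t) (few v) W d₁ d₂ d₃)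
        small₃ : W * d₃ < 1ℚ
        small₃ = pick (0≤+ 0≤f (0≤* 0≤W (0≤+ 0≤d₁ 0≤d₂))) (f₅ (few t) (few v) W d₁ d₂ d₃)

      0≤majorant : ∀ t u v → 0ℚ ≤ majorant t u v
      0≤majorant t u v = 0≤+ (0≤+ (0≤few t) (0≤few v)) (0≤* (0≤sq V)
        (0≤+ (0≤+ (0≤ifGood t (0≤sq (X₁ (t ++ u) v ℓ))) (0≤ifGood v (0≤sq (X₂ (t ++ u) v ℓm)))) (0≤sq (X₃ (t ++ u) ℓm ℓ))))

-- Binary digits and addition with carry.

module Binary where

  open import Data.Nat.Divisibility using (divides)
  open import Data.Nat.DivMod
  open import Defs
  open CarryWalk using (Bits)

  ind : ∀ {p} {P : Set p} → Dec P → ℕ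
  ind (yes _) = 1
  ind (no _) = 0

  ind-yes : ∀ {p} {P : Set p} (d : Dec P) → P → ind d ≡ 1
  ind-yes (yes _) p = refl
  ind-yes (no ¬p) p = ⊥-elim (¬p p)

  ind-no : ∀ {p} {P : Set p} (d : Dec P) → ¬ P → ind d ≡ 0
  ind-no (yes p) ¬p = ⊥-elim (¬p p)
  ind-no (no _) ¬p = refl

  ind-cong : ∀ {p q} {P : Set p} {Q : Set q} (d : Dec P) (e : Dec Q) → (P → Q) → (Q → P) → ind d ≡ ind e
  ind-cong (yes p) e f g = sym (ind-yes e (f p))
  ind-cong (no ¬p) e f g = sym (ind-no e (¬p ∘ g))

  sumN : ℕ → (ℕ → ℕ) → ℕ
  sumN zero f = 0
  sumN (suc n) f = f 0 ℕ.+ sumN n (f ∘ suc)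

  sumN-cong : ∀ n {f g} → (∀ i → i ℕ.< n → f i ≡ g i) → sumN n f ≡ sumN n g
  sumN-cong zero e = refl
  sumN-cong (suc n) e = cong₂ ℕ._+_ (e 0 (ℕ.s≤s ℕ.z≤n)) (sumN-cong n (λ i p → e (suc i) (ℕ.s≤s p)))

  sumN-+ : ∀ m n f → sumN (m ℕ.+ n) f ≡ sumN m f ℕ.+ sumN n (λ i → f (m ℕ.+ i))
  sumN-+ zero n f = refl
  sumN-+ (suc m) n f = trans (cong (f 0 ℕ.+_) (sumN-+ m n (f ∘ suc)))
    (sym (ℕₚ.+-assoc (f 0) (sumN m (f ∘ suc)) (sumN n (λ i → f (suc (m ℕ.+ i))))))

  sumN-∷ʳ : ∀ n f → sumN (suc n) f ≡ sumN n f ℕ.+ f n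
  sumN-∷ʳ zero f = ℕₚ.+-comm (f 0) 0
  sumN-∷ʳ (suc n) f = trans (cong (f 0 ℕ.+_) (sumN-∷ʳ n (f ∘ suc)))
    (sym (ℕₚ.+-assoc (f 0) (sumN n (f ∘ suc)) (f (suc n))))

  sumN-zero : ∀ n {f} → (∀ i → i ℕ.< n → f i ≡ 0) → sumN n f ≡ 0
  sumN-zero zero e = refl
  sumN-zero (suc n) e = cong₂ ℕ._+_ (e 0 (ℕ.s≤s ℕ.z≤n)) (sumN-zero n (λ i p → e (suc i) (ℕ.s≤s p)))

  sumN-single : ∀ n f i → i ℕ.< n → (∀ j → j ℕ.< n → j ≢ i → f j ≡ 0) → sumN n f ≡ f i
  sumN-single (suc n) f zero p e = trans
    (cong (f 0 ℕ.+_) (sumN-zero n (λ j q → e (suc j) (ℕ.s≤s q) (λ ())))) (ℕₚ.+-identityʳ (f 0))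
  sumN-single (suc n) f (suc i) (ℕ.s≤s p) e = trans
    (cong (ℕ._+ sumN n (f ∘ suc)) (e 0 (ℕ.s≤s ℕ.z≤n) (λ ())))
    (sumN-single n (f ∘ suc) i p (λ j q ne → e (suc j) (ℕ.s≤s q) (ne ∘ ℕₚ.suc-injective)))

  sumN-reverse : ∀ n f → sumN n f ≡ sumN n (λ i → f (n ℕ.∸ suc i))
  sumN-reverse zero f = refl
  sumN-reverse (suc n) f = trans (sumN-∷ʳ n f)
    (trans (ℕₚ.+-comm (sumN n f) (f n)) (cong (f n ℕ.+_) (sumN-reverse n f)))

  module _ {a p} {X : Set a} {P : X → Set p} (P? : ∀ x → Dec (P x)) where

    filter-∷ : ∀ x xs → length (filter P? (x ∷ xs)) ≡ ind (P? x) ℕ.+ length (filter P? xs)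
    filter-∷ x xs with P? x
    ... | yes _ = refl
    ... | no _ = refl

    filter-length-++ : ∀ xs ys → length (filter P? (xs ++ ys)) ≡ length (filter P? xs) ℕ.+ length (filter P? ys)
    filter-length-++ xs ys = trans (cong length (Listₚ.filter-++ P? xs ys)) (Listₚ.length-++ (filter P? xs))

    filter-applyUpTo : ∀ n (f : ℕ → X) → length (filter P? (applyUpTo f n)) ≡ sumN n (λ i → ind (P? (f i)))
    filter-applyUpTo zero f = refl
    filter-applyUpTo (suc n) f = trans (filter-∷ (f 0) (applyUpTo (f ∘ suc) n))
      (cong (ind (P? (f 0)) ℕ.+_) (filter-applyUpTo n (f ∘ suc)))

    filter-concatMap : ∀ n (F : ℕ → List X) (g : ℕ → ℕ) →
      length (filter P? (concatMap F (applyUpTo g n))) ≡ sumN n (λ i → length (filter P? (F (g i))))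
    filter-concatMap zero F g = refl
    filter-concatMap (suc n) F g = trans (filter-length-++ (F (g 0)) (concatMap F (applyUpTo (g ∘ suc) n)))
      (cong (length (filter P? (F (g 0))) ℕ.+_) (filter-concatMap n F (g ∘ suc)))

  bit : Bool → ℕ
  bit false = 0
  bit true = 1

  val wt : Bits → ℕ
  val [] = 0
  val (b ∷ l) = bit b ℕ.* 2 ℕ.^ length l ℕ.+ val l
  wt [] = 0
  wt (b ∷ l) = bit b ℕ.+ wt l

  val<2^ : ∀ l → val l ℕ.< 2 ℕ.^ length l
  val<2^ [] = ℕ.s≤s ℕ.z≤n
  val<2^ (false ∷ l) = ℕₚ.<-≤-trans (val<2^ l) (ℕₚ.m≤m+n _ _)
  val<2^ (true ∷ l) = subst₂ ℕ._<_ (cong (ℕ._+ val l) (sym (ℕₚ.*-identityˡ (2 ℕ.^ length l))))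
    (cong (2 ℕ.^ length l ℕ.+_) (sym (ℕₚ.+-identityʳ (2 ℕ.^ length l))))
    (ℕₚ.+-monoʳ-< (2 ℕ.^ length l) (val<2^ l))

  private
    half≤ : ∀ n → suc n / 2 ℕ.≤ n
    half≤ n = ℕₚ.≤-pred (m/n<m (suc n) 2 (ℕ.s≤s (ℕ.s≤s ℕ.z≤n)))

  weightFuel-irrelevant : ∀ f g n → n ℕ.≤ f → n ℕ.≤ g → weightFuel f n ≡ weightFuel g n
  weightFuel-irrelevant zero zero n p q = refl
  weightFuel-irrelevant zero (suc g) zero p q = refl
  weightFuel-irrelevant (suc f) zero zero p q = refl
  weightFuel-irrelevant (suc f) (suc g) zero p q = refl
  weightFuel-irrelevant (suc f) (suc g) (suc n) (ℕ.s≤s p) (ℕ.s≤s q) =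
    cong (suc n % 2 ℕ.+_) (weightFuel-irrelevant f g (suc n / 2)
      (ℕₚ.≤-trans (half≤ n) p) (ℕₚ.≤-trans (half≤ n) q))

  w-half : ∀ n → w n ≡ n % 2 ℕ.+ w (n / 2)
  w-half zero = refl
  w-half (suc n) = cong (suc n % 2 ℕ.+_) (weightFuel-irrelevant n (suc n / 2) (suc n / 2) (half≤ n) ℕₚ.≤-refl)

  -- `w` peels off the lowest digit, whereas digit strings begin with the highest; this reconciles
  -- the two.
  w-high : ∀ n v → v ℕ.< 2 ℕ.^ n → w (2 ℕ.^ n ℕ.+ v) ≡ suc (w v)
  w-high zero zero p = refl
  w-high zero (suc v) (ℕ.s≤s ())
  w-high (suc n) v p = trans (w-half x)
    (trans (cong₂ (λ a b → a ℕ.+ w b) low high)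
    (trans (cong (v % 2 ℕ.+_) (w-high n (v / 2) half<))
    (trans (ℕₚ.+-suc (v % 2) (w (v / 2))) (cong suc (sym (w-half v))))))
    where
    x = 2 ℕ.^ suc n ℕ.+ v
    x≡ : x ≡ v ℕ.+ 2 ℕ.^ n ℕ.* 2
    x≡ = trans (ℕₚ.+-comm (2 ℕ.^ suc n) v) (cong (v ℕ.+_) (ℕₚ.*-comm 2 (2 ℕ.^ n)))
    low : x % 2 ≡ v % 2
    low = trans (cong (_% 2) x≡) ([m+kn]%n≡m%n v (2 ℕ.^ n) 2)
    high : x / 2 ≡ 2 ℕ.^ n ℕ.+ v / 2
    high = trans (cong (_/ 2) x≡) (trans (+-distrib-/-∣ʳ v (divides (2 ℕ.^ n) refl))
      (trans (cong (v / 2 ℕ.+_) (m*n/n≡m (2 ℕ.^ n) 2)) (ℕₚ.+-comm (v / 2) (2 ℕ.^ n))))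
    half< : v / 2 ℕ.< 2 ℕ.^ n
    half< = m<n*o⇒m/o<n (subst (v ℕ.<_) (ℕₚ.*-comm 2 (2 ℕ.^ n)) p)

  w-val : ∀ l → w (val l) ≡ wt l
  w-val [] = refl
  w-val (false ∷ l) = w-val l
  w-val (true ∷ l) = trans (cong (λ z → w (z ℕ.+ val l)) (ℕₚ.*-identityˡ (2 ℕ.^ length l)))
    (trans (w-high (length l) (val l) (val<2^ l)) (cong suc (w-val l)))

  bits : ∀ k x → x ℕ.< 2 ℕ.^ k → Σ Bits λ l → length l ≡ k × val l ≡ x
  bits zero zero p = [] , refl , refl
  bits zero (suc x) (ℕ.s≤s ())
  bits (suc k) x p with x ℕ.<? 2 ℕ.^ k
  ... | yes q = let l , a , b = bits k x q in false ∷ l , cong suc a , b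
  ... | no q = let l , a , b = bits k (x ℕ.∸ 2 ℕ.^ k) lt in
        true ∷ l , cong suc a ,
        trans (cong₂ ℕ._+_ (trans (ℕₚ.*-identityˡ (2 ℕ.^ length l)) (cong (2 ℕ.^_) a)) b) (ℕₚ.m+[n∸m]≡n ≤x)
    where
    ≤x = ℕₚ.≮⇒≥ q
    lt : x ℕ.∸ 2 ℕ.^ k ℕ.< 2 ℕ.^ k
    lt = ℕₚ.m<n+o⇒m∸n<o x (2 ℕ.^ k) {{ℕₚ.m^n≢0 2 k}} (subst (x ℕ.<_) (cong (2 ℕ.^ k ℕ.+_) (ℕₚ.+-identityʳ (2 ℕ.^ k))) p)

  private
    comp-f : ∀ P a b → (1 ℕ.* P ℕ.+ a) ℕ.+ (0 ℕ.* P ℕ.+ b) ℕ.+ 1 ≡ P ℕ.+ (a ℕ.+ b ℕ.+ 1)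
    comp-f = ℕ-Solver.solve-∀
    comp-t : ∀ P a b → (0 ℕ.* P ℕ.+ a) ℕ.+ (1 ℕ.* P ℕ.+ b) ℕ.+ 1 ≡ P ℕ.+ (a ℕ.+ b ℕ.+ 1)
    comp-t = ℕ-Solver.solve-∀

  val-complement : ∀ l → val (map not l) ℕ.+ val l ℕ.+ 1 ≡ 2 ℕ.^ length l
  val-complement [] = refl
  val-complement (b ∷ l) = trans (cong (λ z → bit (not b) ℕ.* 2 ℕ.^ z ℕ.+ val (map not l) ℕ.+ val (b ∷ l) ℕ.+ 1) (Listₚ.length-map not l))
    (trans (one b) (cong (2 ℕ.^ length l ℕ.+_) (trans (val-complement l) (sym (ℕₚ.+-identityʳ (2 ℕ.^ length l))))))
    where
    one : ∀ b → bit (not b) ℕ.* 2 ℕ.^ length l ℕ.+ val (map not l) ℕ.+ (bit b ℕ.* 2 ℕ.^ length l ℕ.+ val l) ℕ.+ 1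
      ≡ 2 ℕ.^ length l ℕ.+ (val (map not l) ℕ.+ val l ℕ.+ 1)
    one false = comp-f (2 ℕ.^ length l) (val (map not l)) (val l)
    one true = comp-t (2 ℕ.^ length l) (val (map not l)) (val l)

  wt-complement : ∀ l → wt (map not l) ℕ.+ wt l ≡ length l
  wt-complement [] = refl
  wt-complement (false ∷ l) = cong suc (wt-complement l)
  wt-complement (true ∷ l) = trans (ℕₚ.+-suc (wt (map not l)) (wt l)) (cong suc (wt-complement l))

  w-complement : ∀ k a x → a ℕ.+ x ℕ.+ 1 ≡ 2 ℕ.^ k → w a ℕ.+ w x ≡ k
  w-complement k a x e with bits k x (ℕₚ.≤-trans (ℕₚ.≤-reflexive (ℕₚ.+-comm 1 x)) (subst (x ℕ.+ 1 ℕ.≤_) e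
      (ℕₚ.≤-trans (ℕₚ.m≤n+m (x ℕ.+ 1) a) (ℕₚ.≤-reflexive (sym (ℕₚ.+-assoc a x 1))))))
  ... | l , lk , refl = trans (cong₂ ℕ._+_ (trans (cong w a≡) (w-val (map not l))) (w-val l)) (trans (wt-complement l) lk)
    where
    a≡ : a ≡ val (map not l)
    a≡ = ℕₚ.+-cancelʳ-≡ (val l) a (val (map not l)) (ℕₚ.+-cancelʳ-≡ 1 (a ℕ.+ val l) (val (map not l) ℕ.+ val l)
      (trans e (sym (trans (val-complement l) (cong (2 ℕ.^_) lk)))))

  mv : Bool → ℤ → ℤ
  mv false d = ℤ.suc d
  mv true d = ℤ.pred d

  addBit : Bool → Bool → Bool × ℤ → Bool × ℤ
  addBit false ξ (false , d) = false , d
  addBit false ξ (true , d) = ξ , mv ξ d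
  addBit true ξ (true , d) = true , d
  addBit true ξ (false , d) = ξ , mv ξ d

  -- The carry out of the top digit of X + t + c, and the change of weight, not counting that carry
  add : Bool → Bits → Bits → Bool × ℤ
  add c [] X = c , ℤ.0ℤ
  add c (τ ∷ t) [] = c , ℤ.0ℤ
  add c (τ ∷ t) (ξ ∷ X) = addBit τ ξ (add c t X)

  -- Ties the pair `add c t X` to arithmetic: its carry is the overflow and its integer the change
  -- of weight of an actual sum.
  record Sum (c : Bool) (t X : Bits) : Set where
    field
      digits : Bits
      digits-length : length digits ≡ length t
      digits-val : val X ℕ.+ val t ℕ.+ bit c ≡ val digits ℕ.+ bit (proj₁ (add c t X)) ℕ.* 2 ℕ.^ length t
      digits-wt : ℤ.+ wt digits ≡ ℤ.+ wt X ℤ.+ proj₂ (add c t X)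

  open Sum

  private
    digit-arith : ∀ {x t c y P} ξ τ c′ δ o → x ℕ.+ t ℕ.+ c ≡ y ℕ.+ c′ ℕ.* P → ξ ℕ.+ τ ℕ.+ c′ ≡ δ ℕ.+ 2 ℕ.* o →
      (ξ ℕ.* P ℕ.+ x) ℕ.+ (τ ℕ.* P ℕ.+ t) ℕ.+ c ≡ (δ ℕ.* P ℕ.+ y) ℕ.+ o ℕ.* (2 ℕ.* P)
    digit-arith {x} {t} {c} {y} {P} ξ τ c′ δ o e₁ e₂ = trans (f ξ τ P x t c)
      (trans (cong (ξ ℕ.* P ℕ.+ τ ℕ.* P ℕ.+_) e₁) (trans (g ξ τ c′ P y) (trans (cong (λ z → z ℕ.* P ℕ.+ y) e₂) (h δ o P y))))
      where
      f : ∀ ξ τ P x t c → (ξ ℕ.* P ℕ.+ x) ℕ.+ (τ ℕ.* P ℕ.+ t) ℕ.+ c ≡ ξ ℕ.* P ℕ.+ τ ℕ.* P ℕ.+ (x ℕ.+ t ℕ.+ c)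
      f = ℕ-Solver.solve-∀
      g : ∀ ξ τ c P y → ξ ℕ.* P ℕ.+ τ ℕ.* P ℕ.+ (y ℕ.+ c ℕ.* P) ≡ (ξ ℕ.+ τ ℕ.+ c) ℕ.* P ℕ.+ y
      g = ℕ-Solver.solve-∀
      h : ∀ δ o P y → (δ ℕ.+ 2 ℕ.* o) ℕ.* P ℕ.+ y ≡ (δ ℕ.* P ℕ.+ y) ℕ.+ o ℕ.* (2 ℕ.* P)
      h = ℕ-Solver.solve-∀

    wt-keep : ∀ b {y x d} → ℤ.+ y ≡ ℤ.+ x ℤ.+ d → ℤ.+ (bit b ℕ.+ y) ≡ ℤ.+ (bit b ℕ.+ x) ℤ.+ d
    wt-keep b {y} {x} {d} e = trans (ℤₚ.pos-+ (bit b) y) (trans (cong (λ z → ℤ.+ bit b ℤ.+ z) e)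
      (trans (sym (ℤₚ.+-assoc (ℤ.+ bit b) (ℤ.+ x) d)) (cong (λ z → z ℤ.+ d) (sym (ℤₚ.pos-+ (bit b) x)))))

    wt-flip : ∀ ξ {y x d} → ℤ.+ y ≡ ℤ.+ x ℤ.+ d → ℤ.+ (bit (not ξ) ℕ.+ y) ≡ ℤ.+ (bit ξ ℕ.+ x) ℤ.+ mv ξ d
    wt-flip false {y} {x} {d} e = trans (cong ℤ.suc e) (trans (sym (ℤₚ.+-assoc (ℤ.+ 1) (ℤ.+ x) d))
      (trans (cong (λ z → z ℤ.+ d) (ℤₚ.+-comm (ℤ.+ 1) (ℤ.+ x))) (ℤₚ.+-assoc (ℤ.+ x) (ℤ.+ 1) d)))
    wt-flip true {y} {x} {d} e = trans e (trans (cong (λ z → z ℤ.+ d) (ℤₚ.+-comm ℤ.-1ℤ (ℤ.+ suc x)))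
      (ℤₚ.+-assoc (ℤ.+ suc x) ℤ.-1ℤ d))

  sumOf : ∀ c t X → length t ≡ length X → Sum c t X
  sumOf c [] [] e = record { digits = [] ; digits-length = refl ; digits-val = sym (ℕₚ.*-identityʳ (bit c)) ; digits-wt = refl }
  sumOf c (τ ∷ t) (ξ ∷ X) e = build τ
    where
    S : Sum c t X
    S = sumOf c t X (ℕₚ.suc-injective e)
    c′ = proj₁ (add c t X)
    d = proj₂ (add c t X)
    lX : length X ≡ length t
    lX = sym (ℕₚ.suc-injective e)
    value : ∀ τ δ o → bit ξ ℕ.+ bit τ ℕ.+ bit c′ ≡ bit δ ℕ.+ 2 ℕ.* bit o →
      val (ξ ∷ X) ℕ.+ val (τ ∷ t) ℕ.+ bit c ≡ val (δ ∷ digits S) ℕ.+ bit o ℕ.* 2 ℕ.^ suc (length t)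
    value τ δ o eq = trans (cong (λ z → bit ξ ℕ.* 2 ℕ.^ z ℕ.+ val X ℕ.+ val (τ ∷ t) ℕ.+ bit c) lX)
      (trans (digit-arith (bit ξ) (bit τ) (bit c′) (bit δ) (bit o) (digits-val S) eq)
        (cong (λ z → bit δ ℕ.* 2 ℕ.^ z ℕ.+ val (digits S) ℕ.+ bit o ℕ.* 2 ℕ.^ suc (length t)) (sym (digits-length S))))
    assemble : ∀ τ δ o D → addBit τ ξ (add c t X) ≡ (o , D) →
      bit ξ ℕ.+ bit τ ℕ.+ bit c′ ≡ bit δ ℕ.+ 2 ℕ.* bit o →
      ℤ.+ wt (δ ∷ digits S) ≡ ℤ.+ wt (ξ ∷ X) ℤ.+ D → Sum c (τ ∷ t) (ξ ∷ X)
    assemble τ δ o D eq e₁ e₂ = record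
      { digits = δ ∷ digits S
      ; digits-length = cong suc (digits-length S)
      ; digits-val = trans (value τ δ o e₁)
          (cong (λ z → val (δ ∷ digits S) ℕ.+ bit (proj₁ z) ℕ.* 2 ℕ.^ suc (length t)) (sym eq))
      ; digits-wt = trans e₂ (cong (λ z → ℤ.+ wt (ξ ∷ X) ℤ.+ proj₂ z) (sym eq))
      }
    keep : ∀ ξ τ → bit ξ ℕ.+ bit τ ℕ.+ bit τ ≡ bit ξ ℕ.+ 2 ℕ.* bit τ
    keep false false = refl
    keep false true = refl
    keep true false = refl
    keep true true = refl
    flip₁ : ∀ ξ → bit ξ ℕ.+ 0 ℕ.+ 1 ≡ bit (not ξ) ℕ.+ 2 ℕ.* bit ξ
    flip₁ false = refl
    flip₁ true = refl
    flip₂ : ∀ ξ → bit ξ ℕ.+ 1 ℕ.+ 0 ≡ bit (not ξ) ℕ.+ 2 ℕ.* bit ξ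
    flip₂ false = refl
    flip₂ true = refl
    add≡ : ∀ {b} → c′ ≡ b → add c t X ≡ (b , d)
    add≡ refl = refl
    build : ∀ τ → Sum c (τ ∷ t) (ξ ∷ X)
    build τ with c′ in eq
    build false | false = assemble false ξ false d (cong (addBit false ξ) (add≡ eq))
      (trans (cong (λ z → bit ξ ℕ.+ 0 ℕ.+ bit z) eq) (keep ξ false)) (wt-keep ξ {wt (digits S)} {wt X} {d} (digits-wt S))
    build false | true = assemble false (not ξ) ξ (mv ξ d) (cong (addBit false ξ) (add≡ eq))
      (trans (cong (λ z → bit ξ ℕ.+ 0 ℕ.+ bit z) eq) (flip₁ ξ)) (wt-flip ξ {wt (digits S)} {wt X} {d} (digits-wt S))
    build true | true = assemble true ξ true d (cong (addBit true ξ) (add≡ eq))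
      (trans (cong (λ z → bit ξ ℕ.+ 1 ℕ.+ bit z) eq) (keep ξ true)) (wt-keep ξ {wt (digits S)} {wt X} {d} (digits-wt S))
    build true | false = assemble true (not ξ) ξ (mv ξ d) (cong (addBit true ξ) (add≡ eq))
      (trans (cong (λ z → bit ξ ℕ.+ 1 ℕ.+ bit z) eq) (flip₂ ξ)) (wt-flip ξ {wt (digits S)} {wt X} {d} (digits-wt S))

-- Counting S as descents of the weight under cyclic addition.

module CyclicSums where

  open import Data.Nat.DivMod
  open import Defs
  open CarryWalk using (Bits)
  open Binary

  open Sum

  isNeg : ℤ → ℕ
  isNeg (ℤ.+ n) = 0
  isNeg ℤ.-[1+ n ] = 1

  hit : Bool → Bool × ℤ → ℕ
  hit false (false , d) = isNeg d
  hit true (true , d) = isNeg d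
  hit _ _ = 0

  private
    isNeg-compare : ∀ {y x} d → ℤ.+ y ≡ ℤ.+ x ℤ.+ d → isNeg d ≡ ind (y ℕ.<? x)
    isNeg-compare {y} {x} (ℤ.+ n) e = sym (ind-no (y ℕ.<? x) (ℕₚ.≤⇒≯
      (subst (x ℕ.≤_) (sym (ℤₚ.+-injective (trans e (sym (ℤₚ.pos-+ x n))))) (ℕₚ.m≤m+n x n))))
    isNeg-compare {y} {x} ℤ.-[1+ n ] e = sym (ind-yes (y ℕ.<? x)
      (subst (y ℕ.<_) (ℤₚ.+-injective eq) (ℕₚ.m<m+n y (ℕ.s≤s ℕ.z≤n))))
      where
      eq : ℤ.+ (y ℕ.+ suc n) ≡ ℤ.+ x
      eq = trans (ℤₚ.pos-+ y (suc n)) (trans (cong (λ z → z ℤ.+ ℤ.+ suc n) e)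
        (trans (ℤₚ.+-assoc (ℤ.+ x) ℤ.-[1+ n ] (ℤ.+ suc n))
          (trans (cong (λ z → ℤ.+ x ℤ.+ z) (ℤₚ.+-inverseˡ (ℤ.+ suc n))) (ℤₚ.+-identityʳ (ℤ.+ x)))))

  sumB : ℕ → (Bits → ℕ) → ℕ
  sumB zero X = X []
  sumB (suc n) X = sumB n (X ∘ (false ∷_)) ℕ.+ sumB n (X ∘ (true ∷_))

  sumB-cong : ∀ n {X Y} → (∀ l → length l ≡ n → X l ≡ Y l) → sumB n X ≡ sumB n Y
  sumB-cong zero e = e [] refl
  sumB-cong (suc n) e = cong₂ ℕ._+_ (sumB-cong n (λ l p → e (false ∷ l) (cong suc p)))
    (sumB-cong n (λ l p → e (true ∷ l) (cong suc p)))

  sumB-val : ∀ n f → sumB n (f ∘ val) ≡ sumN (2 ℕ.^ n) f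
  sumB-val zero f = sym (ℕₚ.+-identityʳ (f 0))
  sumB-val (suc n) f = trans
    (cong₂ ℕ._+_ (sumB-val n f)
      (trans (sumB-cong n (λ l p → cong (λ z → f (z ℕ.+ val l)) (trans (ℕₚ.*-identityˡ (2 ℕ.^ length l)) (cong (2 ℕ.^_) p))))
        (sumB-val n (λ i → f (2 ℕ.^ n ℕ.+ i)))))
    (trans (sym (sumN-+ (2 ℕ.^ n) (2 ℕ.^ n) f))
      (cong (λ z → sumN (2 ℕ.^ n ℕ.+ z) f) (sym (ℕₚ.+-identityʳ (2 ℕ.^ n)))))

  -- In this form the modulus 2^k - 1 is visibly a successor, and subtraction disappears from it.
  module Cyclic (k M : ℕ) (2^k≡ : 2 ℕ.^ k ≡ suc (suc M)) where

    m : ℕ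
    m = suc M

    descend : ℕ → ℕ → ℕ
    descend t x = ind (w ((x ℕ.+ t) % m) ℕ.<? w x)

    module _ (T : Bits) (lT : length T ≡ k) (t<m : val T ℕ.< m) where

      t : ℕ
      t = val T

      2^lT : 2 ℕ.^ length T ≡ suc m
      2^lT = trans (cong (2 ℕ.^_) lT) 2^k≡

      module _ (X : Bits) (lX : length X ≡ k) where

        private
          x = val X
          lTX : length T ≡ length X
          lTX = trans lT (sym lX)
          S₀ = sumOf false T X lTX
          S₁ = sumOf true T X lTX

          digits< : ∀ {c} (S : Sum c T X) → val (digits S) ℕ.< suc m
          digits< S = subst (val (digits S) ℕ.<_) (trans (cong (2 ℕ.^_) (digits-length S)) 2^lT) (val<2^ (digits S))

          x<2^ : x ℕ.< suc m
          x<2^ = subst (x ℕ.<_) (trans (cong (2 ℕ.^_) lX) 2^k≡) (val<2^ X)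

          eq₀ : x ℕ.+ t ≡ val (digits S₀) ℕ.+ bit (proj₁ (add false T X)) ℕ.* suc m
          eq₀ = trans (sym (ℕₚ.+-identityʳ (x ℕ.+ t))) (trans (digits-val S₀) (cong (λ z → val (digits S₀) ℕ.+ bit (proj₁ (add false T X)) ℕ.* z) 2^lT))

          eq₁ : suc (x ℕ.+ t) ≡ val (digits S₁) ℕ.+ bit (proj₁ (add true T X)) ℕ.* suc m
          eq₁ = trans (ℕₚ.+-comm 1 (x ℕ.+ t)) (trans (digits-val S₁) (cong (λ z → val (digits S₁) ℕ.+ bit (proj₁ (add true T X)) ℕ.* z) 2^lT))

          compare : ∀ {c} (S : Sum c T X) y → val (digits S) ≡ y → isNeg (proj₂ (add c T X)) ≡ ind (w y ℕ.<? w x)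
          compare {c} S y refl = trans (isNeg-compare (proj₂ (add c T X)) (digits-wt S))
            (cong₂ (λ a b → ind (a ℕ.<? b)) (sym (w-val (digits S))) (sym (w-val X)))

          wx≤k : w x ℕ.≤ k
          wx≤k = subst (ℕ._≤ k) (sym (w-val X)) (subst (wt X ℕ.≤_) (trans (wt-complement X) lX) (ℕₚ.m≤n+m (wt X) (wt (map not X))))

          w-max : w m ≡ k
          w-max = trans (sym (ℕₚ.+-identityʳ (w m))) (w-complement k m 0 (trans (cong (ℕ._+ 1) (ℕₚ.+-identityʳ m)) (trans (ℕₚ.+-comm m 1) (sym 2^k≡))))

        -- Modulo 2^k - 1 an overflow returns as incoming carry. Exactly one carry is consistent,
        -- except for x + t = 2^k - 1, where both are.
        carry-hits : hit false (add false T X) ℕ.+ hit true (add true T X) ≡ descend t x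
        carry-hits with add false T X in a₀ | add true T X in a₁ | eq₀ | eq₁ | (λ y → compare S₀ y) | (λ y → compare S₁ y)
        ... | false , d₀ | false , d₁ | e₀ | e₁ | cmp₀ | cmp₁ =
          trans (ℕₚ.+-identityʳ (isNeg d₀)) (cmp₀ ((x ℕ.+ t) % m) (trans (sym e₀′) (sym (m<n⇒m%n≡m small))))
          where
          e₀′ : x ℕ.+ t ≡ val (digits S₀)
          e₀′ = trans e₀ (ℕₚ.+-identityʳ (val (digits S₀)))
          small : x ℕ.+ t ℕ.< m
          small = ℕₚ.≤-pred (subst (ℕ._< suc m) (sym (trans e₁ (ℕₚ.+-identityʳ (val (digits S₁))))) (digits< S₁))
        ... | true , d₀ | false , d₁ | e₀ | e₁ | cmp₀ | cmp₁ = ⊥-elim (ℕₚ.<⇒≱ (digits< S₁)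
          (subst (suc m ℕ.≤_) (trans e₁ (ℕₚ.+-identityʳ (val (digits S₁))))
            (ℕₚ.m≤n⇒m≤1+n (subst (suc m ℕ.≤_) (sym e₀) (ℕₚ.≤-trans (ℕₚ.≤-reflexive (sym (ℕₚ.*-identityˡ (suc m)))) (ℕₚ.m≤n+m (1 ℕ.* suc m) (val (digits S₀))))))))
        ... | c₀ , d₀ | true , d₁ | e₀ | e₁ | cmp₀ | cmp₁ =
          cong₂ ℕ._+_ (none c₀ d₀ e₀ cmp₀) (cmp₁ ((x ℕ.+ t) % m) (sym wrap))
          where
          y = val (digits S₁)
          e₁′ : x ℕ.+ t ≡ y ℕ.+ m
          e₁′ = ℕₚ.suc-injective (trans e₁ (trans (cong (y ℕ.+_) (ℕₚ.*-identityˡ (suc m))) (ℕₚ.+-suc y m)))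
          y<m : y ℕ.< m
          y<m = ℕₚ.+-cancelʳ-< m y m (subst (ℕ._< m ℕ.+ m) e₁′ (ℕₚ.+-mono-≤-< (ℕₚ.≤-pred x<2^) t<m))
          wrap : (x ℕ.+ t) % m ≡ y
          wrap = trans (cong (_% m) e₁′) (trans ([m+n]%n≡m%n y m) (m<n⇒m%n≡m y<m))
          none : ∀ c₀ d₀ → x ℕ.+ t ≡ val (digits S₀) ℕ.+ bit c₀ ℕ.* suc m →
            (∀ z → val (digits S₀) ≡ z → isNeg d₀ ≡ ind (w z ℕ.<? w x)) → hit false (c₀ , d₀) ≡ 0
          none true d₀ _ _ = refl
          -- The doubly consistent case: the sum without carry has all k digits 1, so it is no
          -- descent, and the residue 0 is counted once, through the other carry.
          none false d₀ e₀ cmp₀ = trans (cmp₀ m full) (ind-no (w m ℕ.<? w x) (ℕₚ.≤⇒≯ (subst (w x ℕ.≤_) (sym w-max) wx≤k)))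
            where
            full : val (digits S₀) ≡ m
            full = ℕₚ.≤-antisym (ℕₚ.≤-pred (digits< S₀))
              (subst (m ℕ.≤_) (trans (sym e₁′) (trans e₀ (ℕₚ.+-identityʳ (val (digits S₀))))) (ℕₚ.m≤n+m m y))

      private
        congruent : ∀ a x b → a ℕ.+ x ≡ m → b ℕ.< m → (a ℕ.+ b) % m ≡ t % m → b ≡ (x ℕ.+ t) % m
        congruent a x b ax b<m e = trans (sym (m<n⇒m%n≡m b<m))
          (trans (sym ([m+n]%n≡m%n b m))
          (trans (cong (_% m) (trans (cong (b ℕ.+_) (trans (sym ax) (ℕₚ.+-comm a x))) (trans (ℕₚ.+-comm b (x ℕ.+ a)) (ℕₚ.+-assoc x a b))))
          (trans (%-distribˡ-+ x (a ℕ.+ b) m) (trans (cong (λ z → (x % m ℕ.+ z) % m) e) (sym (%-distribˡ-+ x t m))))))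

        solution : ∀ a x → a ℕ.+ x ≡ m → (a ℕ.+ (x ℕ.+ t) % m) % m ≡ t % m
        solution a x ax = trans (%-distribˡ-+ a ((x ℕ.+ t) % m) m)
          (trans (cong (λ z → (a % m ℕ.+ z) % m) (m%n%n≡m%n (x ℕ.+ t) m))
          (trans (sym (%-distribˡ-+ a (x ℕ.+ t) m))
          (trans (cong (_% m) (trans (sym (ℕₚ.+-assoc a x t)) (trans (cong (ℕ._+ t) ax) (ℕₚ.+-comm m t)))) ([m+n]%n≡m%n t m))))

        InS? : ∀ ab → Dec (((proj₁ ab ℕ.+ proj₂ ab) % m ≡ t % m) × (w (proj₁ ab) ℕ.+ w (proj₂ ab) ℕ.< k))
        InS? ab = ((proj₁ ab ℕ.+ proj₂ ab) % m ℕₚ.≟ t % m) ×-dec (w (proj₁ ab) ℕ.+ w (proj₂ ab) ℕₚ.<? k)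

        -- Here x = suc i is the complement of a. The congruence determines b as the residue of x +
        -- t, and w a + w x = k turns the weight condition into w b < w x.
        inner : ∀ i → i ℕ.< m → sumN m (λ b → ind (InS? (m ℕ.∸ suc i , b))) ≡ descend t (suc i)
        inner i i<m = trans
          (sumN-single m (λ b → ind (InS? (a , b))) b₀ (m%n<n (suc i ℕ.+ t) m)
            (λ b b<m ne → ind-no (InS? (a , b)) (λ p → ne (congruent a (suc i) b ax b<m (proj₁ p)))))
          (ind-cong (InS? (a , b₀)) (w b₀ ℕ.<? w (suc i))
            (λ p → ℕₚ.+-cancelˡ-< (w a) (w b₀) (w (suc i)) (subst (w a ℕ.+ w b₀ ℕ.<_) (sym ww) (proj₂ p)))
            (λ p → solution a (suc i) ax , subst (w a ℕ.+ w b₀ ℕ.<_) ww (ℕₚ.+-monoʳ-< (w a) p)))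
          where
          a = m ℕ.∸ suc i
          b₀ = (suc i ℕ.+ t) % m
          ax : a ℕ.+ suc i ≡ m
          ax = ℕₚ.m∸n+n≡m i<m
          ww : w a ℕ.+ w (suc i) ≡ k
          ww = w-complement k a (suc i) (trans (cong (ℕ._+ 1) ax) (trans (ℕₚ.+-comm m 1) (sym 2^k≡)))

      size-descend : sizeS t k ≡ sumB k (λ X → hit false (add false T X) ℕ.+ hit true (add true T X))
      size-descend = trans unfold (trans (filter-concatMap InS? m (λ a → map (a ,_) (upTo m)) id)
        (trans (sumN-cong m (λ a _ → trans (cong (length ∘ filter InS?) (Listₚ.map-upTo (a ,_) m)) (filter-applyUpTo InS? m (a ,_))))
        (trans (sumN-reverse m (λ a → sumN m (λ b → ind (InS? (a , b)))))
        (trans (sumN-cong m inner)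
        (trans (sym (cong (ℕ._+ sumN m (descend t ∘ suc)) at-zero))
        (trans (cong (λ z → sumN z (descend t)) (sym 2^k≡))
        (trans (sym (sumB-val k (descend t)))
          (sumB-cong k (λ X lX → sym (carry-hits X lX))))))))))
        where
        at-zero : descend t 0 ≡ 0
        at-zero = ind-no (w (t % m) ℕ.<? 0) (λ ())
        unfold : sizeS t k ≡ length (filter InS? (concatMap (λ a → map (a ,_) (upTo m)) (upTo m)))
        unfold = trans (cong (λ z → length (filter (λ ab → ((proj₁ ab ℕ.+ proj₂ ab) % suc z ℕₚ.≟ t % suc z)
                                     ×-dec (w (proj₁ ab) ℕ.+ w (proj₂ ab) ℕₚ.<? k)) (pairs k))) (cong (ℕ._∸ 2) 2^k≡))
          (cong (λ z → length (filter InS? (concatMap (λ a → map (a ,_) (upTo z)) (upTo z)))) (cong (ℕ._∸ 1) 2^k≡))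

    inRange : ℕ → ℕ → ℕ
    inRange c zero = 0
    inRange c (suc i) with suc i ℕ.<? m
    ... | yes _ = c
    ... | no _ = 0

    bad-≤ : ∀ p q → badCount p q k ℕ.≤ sumB k (λ T → inRange (ind (¬? ((q ℕ.* 2 ℕ.^ k ℕₚ.<? 2 ℕ.* q ℕ.* sizeS (val T) k ℕ.+ 2 ℕ.* p ℕ.* 2 ℕ.^ k)
                                            ×-dec (2 ℕ.* sizeS (val T) k ℕₚ.<? 2 ℕ.^ k)))) (val T))
    bad-≤ p q = ℕₚ.≤-trans (ℕₚ.≤-reflexive count)
      (ℕₚ.≤-trans (ℕₚ.≤-reflexive (sumN-cong M in-range))
      (ℕₚ.≤-trans (ℕₚ.m≤m+n (sumN M (g ∘ suc)) (g (suc M)))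
      (ℕₚ.≤-reflexive (trans (sym (sumN-∷ʳ M (g ∘ suc))) (trans (cong (λ z → sumN z g) (sym 2^k≡)) (sym (sumB-val k g)))))))
      where
      Bad? : ∀ t → Dec _
      Bad? t = ¬? ((q ℕ.* 2 ℕ.^ k ℕₚ.<? 2 ℕ.* q ℕ.* sizeS t k ℕ.+ 2 ℕ.* p ℕ.* 2 ℕ.^ k) ×-dec (2 ℕ.* sizeS t k ℕₚ.<? 2 ℕ.^ k))
      g : ℕ → ℕ
      g x = inRange (ind (Bad? x)) x
      count : badCount p q k ≡ sumN M (λ i → ind (Bad? (suc i)))
      count = trans (cong (length ∘ filter Bad?) (trans (Listₚ.map-upTo suc (2 ℕ.^ k ℕ.∸ 2)) (cong (applyUpTo suc) (cong (ℕ._∸ 2) 2^k≡))))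
        (filter-applyUpTo Bad? M suc)
      in-range : ∀ i → i ℕ.< M → ind (Bad? (suc i)) ≡ g (suc i)
      in-range i i<M with suc i ℕ.<? m
      ... | yes _ = refl
      ... | no ¬p = ⊥-elim (¬p (ℕ.s≤s i<M))

-- Passage to counts, and the choice of constants.

module Assembly where

  open import Data.Rational
  open import Data.Rational.Properties
  open import Tactic.RingSolver using (solve-∀)
  open import Defs
  open Operators
  open CarryWalk
  open Variance
  open Coins
  open Scales
  open Symmetry
  open Expansion
  open SecondMoments
  open Majorant
  open Binary
  open CyclicSums

  0<1 : 0ℚ < 1ℚ
  0<1 = *<* (ℤ.+<+ (ℕ.s≤s ℕ.z≤n))

  0<* : ∀ {p q} → 0ℚ < p → 0ℚ < q → 0ℚ < p * q
  0<* {p} {q} a b = positive⁻¹ (p * q) {{pos*pos⇒pos p {{positive a}} q {{positive b}}}}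

  <-by : ∀ {x y d} → 0ℚ < d → y ≡ x + d → x < y
  <-by {x} {y} {d} p eq = subst₂ _<_ (+-identityʳ x) (sym eq) (+-monoʳ-< x p)

  ι-cancel-≤ : ∀ {m n} → ι m ≤ ι n → m ℕ.≤ n
  ι-cancel-≤ {m} {n} p with m ℕ.≤? n
  ... | yes q = q
  ... | no q = ⊥-elim (<-irrefl refl (<-≤-trans (<-by 0<1 (+-comm 1ℚ (ι n))) (≤-trans (ι-mono (ℕₚ.≰⇒> q)) p)))

  ι-cancel-< : ∀ {m n} → ι m < ι n → m ℕ.< n
  ι-cancel-< {m} {n} p with m ℕ.<? n
  ... | yes q = q
  ... | no q = ⊥-elim (<-irrefl refl (<-≤-trans p (ι-mono (ℕₚ.≮⇒≥ q))))

  ι-1 : ι 1 ≡ 1ℚ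
  ι-1 = +-identityʳ 1ℚ

  0<ι : ∀ {n} → 1 ℕ.≤ n → 0ℚ < ι n
  0<ι p = <-≤-trans 0<1 (≤-trans (≤-reflexive (sym ι-1)) (ι-mono p))

  abstract

    reciprocal : ∀ n → 1 ℕ.≤ n → Σ ℚ λ r → 0ℚ < r × r * ι n ≡ 1ℚ
    reciprocal n p = 1/ ι n , positive⁻¹ (1/ ι n) {{1/pos⇒pos (ι n)}} , *-inverseˡ (ι n)
      where
      instance
        pos-ι : Positive (ι n)
        pos-ι = positive (0<ι p)
        nonZero-ι : NonZero (ι n)
        nonZero-ι = pos⇒nonZero (ι n)

  ι-2^ : ∀ n → ι (2 ℕ.^ n) ≡ pow 2ℚ n
  ι-2^ zero = ι-1
  ι-2^ (suc n) = trans (ι-* 2 (2 ℕ.^ n)) (cong (2ℚ *_) (ι-2^ n))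

  ι-4^ : ∀ n → ι (4 ℕ.^ n) ≡ pow 4ℚ n
  ι-4^ zero = ι-1
  ι-4^ (suc n) = trans (ι-* 4 (4 ℕ.^ n)) (cong (4ℚ *_) (ι-4^ n))

  ι-sumB : ∀ n X → ι (sumB n X) ≡ pow 2ℚ n * avg n (ι ∘ X)
  ι-sumB zero X = sym (*-identityˡ (ι (X [])))
  ι-sumB (suc n) X = trans (ι-+ (sumB n (X ∘ (false ∷_))) (sumB n (X ∘ (true ∷_))))
    (trans (cong₂ _+_ (ι-sumB n (X ∘ (false ∷_))) (ι-sumB n (X ∘ (true ∷_))))
      (e (pow 2ℚ n) (avg n (ι ∘ X ∘ (false ∷_))) (avg n (ι ∘ X ∘ (true ∷_)))))
    where
    e : ∀ p a b → p * a + p * b ≡ 2ℚ * p * (½ * (a + b))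
    e = solve-∀ ring

  -- `add` follows one X, `U` takes the expectation over X one digit at a time, from the top:
  -- averaging the top digit of X turns h into `step τ h`.
  avg-add : ∀ t c (h : St) → avg (length t) (λ X → h (proj₁ (add c t X)) (proj₂ (add c t X))) ≡ U t h c ℤ.0ℤ
  avg-add [] c h = refl
  avg-add (τ ∷ t) c h = trans (cong (½ *_) (sym (avg-+ (length t) _ _)))
    (trans (sym (avg-* (length t) ½ _))
      (trans (avg-cong (length t) (λ X → coin τ (add c t X))) (avg-add t c (step τ h))))
    where
    coin : ∀ τ o → ½ * (h (proj₁ (addBit τ false o)) (proj₂ (addBit τ false o)) + h (proj₁ (addBit τ true o)) (proj₂ (addBit τ true o)))
      ≡ step τ h (proj₁ o) (proj₂ o)
    coin false (false , d) = half-double (h false d)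
    coin false (true , d) = refl
    coin true (true , d) = half-double (h true d)
    coin true (false , d) = refl

  ι-hit : ∀ a o → ι (hit a o) ≡ negAt a (proj₁ o) (proj₂ o)
  ι-hit false (false , ℤ.+ n) = refl
  ι-hit false (false , ℤ.-[1+ n ]) = refl
  ι-hit true (true , ℤ.+ n) = refl
  ι-hit true (true , ℤ.-[1+ n ]) = refl
  ι-hit false (true , d) = sym (*-zeroˡ (ng d))
  ι-hit true (false , d) = sym (*-zeroˡ (ng d))

  ι-size : ∀ k M (e : 2 ℕ.^ k ≡ suc (suc M)) T → length T ≡ k → val T ℕ.< suc M →
    ι (sizeS (val T) k) ≡ pow 2ℚ k * Pr T
  ι-size k M e T lT p = trans (cong ι (Cyclic.size-descend k M e T lT p))
    (trans (ι-sumB k _) (cong (pow 2ℚ k *_)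
      (trans (avg-cong k (λ X → trans (ι-+ (hit false (add false T X)) (hit true (add true T X)))
          (cong₂ _+_ (ι-hit false (add false T X)) (ι-hit true (add true T X)))))
        (trans (avg-+ k _ _) (subst (λ z → avg z (λ X → negAt false (proj₁ (add false T X)) (proj₂ (add false T X)))
            + avg z (λ X → negAt true (proj₁ (add true T X)) (proj₂ (add true T X))) ≡ Pr T) lT
          (cong₂ _+_ (avg-add T false (negAt false)) (avg-add T true (negAt true))))))))

  0<pow2 : ∀ n → 0ℚ < pow 2ℚ n
  0<pow2 zero = 0<1
  0<pow2 (suc n) = 0<* (<-≤-trans 0<1 1≤2) (0<pow2 n)

  ι-inRange : ∀ k M e {P : Set} (d : Dec P) x {Y} → 0ℚ ≤ Y → (x ℕ.< suc M → P → 1ℚ ≤ Y) →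
    ι (Cyclic.inRange k M e (ind d) x) ≤ Y
  ι-inRange k M e d zero 0≤Y f = 0≤Y
  ι-inRange k M e d (suc i) 0≤Y f with suc i ℕ.<? suc M
  ... | no _ = 0≤Y
  ι-inRange k M e (yes p) (suc i) 0≤Y f | yes q = ≤-trans (≤-reflexive ι-1) (f q p)
  ι-inRange k M e (no _) (suc i) 0≤Y f | yes q = 0≤Y

  -- 1 - 2 P ≥ δ > 0 gives P < 1/2, and 1 - 2 P ≤ R with q R < 2 p gives P > 1/2 - p/q.
  not-bad : ∀ k M (e : 2 ℕ.^ k ≡ suc (suc M)) T → length T ≡ k → val T ℕ.< suc M → ∀ p q {δ R} →
    0ℚ < δ → δ ≤ 1ℚ - (Pr T + Pr T) → 1ℚ - (Pr T + Pr T) ≤ R → 0ℚ < 2ℚ * ι p - ι q * R →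
    (q ℕ.* 2 ℕ.^ k ℕ.< 2 ℕ.* q ℕ.* sizeS (val T) k ℕ.+ 2 ℕ.* p ℕ.* 2 ℕ.^ k) × (2 ℕ.* sizeS (val T) k ℕ.< 2 ℕ.^ k)
  not-bad k M e T lT t< p q {δ} {R} 0<δ lower upper gap =
      ι-cancel-< (subst₂ _<_ (sym (trans (ι-* q (2 ℕ.^ k)) (cong (ι q *_) (ι-2^ k)))) (sym right)
        (<-≤-trans (<-by (0<* (0<pow2 k) gap) refl)
          (≤-by (0≤* (<⇒≤ (0<pow2 k)) (0≤* (0≤ι q) (≤⇒0≤ upper))) (f₁ (pow 2ℚ k) (ι p) (ι q) R (Pr T)))))
    , ι-cancel-< (subst₂ _<_ (sym double) (sym (ι-2^ k))
        (<-by (0<* (0<pow2 k) (<-≤-trans 0<δ lower)) (f₂ (pow 2ℚ k) (Pr T))))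
    where
    size = ι-size k M e T lT t<
    double : ι (2 ℕ.* sizeS (val T) k) ≡ 2ℚ * (pow 2ℚ k * Pr T)
    double = trans (ι-* 2 (sizeS (val T) k)) (cong (2ℚ *_) size)
    right : ι (2 ℕ.* q ℕ.* sizeS (val T) k ℕ.+ 2 ℕ.* p ℕ.* 2 ℕ.^ k)
      ≡ 2ℚ * ι q * (pow 2ℚ k * Pr T) + 2ℚ * ι p * pow 2ℚ k
    right = trans (ι-+ (2 ℕ.* q ℕ.* sizeS (val T) k) (2 ℕ.* p ℕ.* 2 ℕ.^ k))
      (cong₂ _+_ (trans (ι-* (2 ℕ.* q) (sizeS (val T) k)) (cong₂ _*_ (ι-* 2 q) size))
        (trans (ι-* (2 ℕ.* p) (2 ℕ.^ k)) (cong₂ _*_ (ι-* 2 p) (ι-2^ k))))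
    f₁ : ∀ P p q R x → 2ℚ * q * (P * x) + 2ℚ * p * P ≡ (q * P + P * (2ℚ * p - q * R)) + P * (q * (R - (1ℚ - (x + x))))
    f₁ = solve-∀ ring
    f₂ : ∀ P x → P ≡ 2ℚ * (P * x) + P * (1ℚ - (x + x))
    f₂ = solve-∀ ring

  square-root : ∀ n → Σ ℕ λ ν → ν ℕ.* ν ℕ.≤ n × n ℕ.< suc ν ℕ.* suc ν
  square-root zero = 0 , ℕ.z≤n , ℕ.s≤s ℕ.z≤n
  square-root (suc n) with square-root n
  ... | ν , lo , hi with suc n ℕ.<? suc ν ℕ.* suc ν
  ... | yes p = ν , ℕₚ.m≤n⇒m≤1+n lo , p
  ... | no p = suc ν , ℕₚ.≮⇒≥ p , ℕₚ.≤-<-trans hi (ℕₚ.*-mono-< (ℕₚ.n<1+n (suc ν)) (ℕₚ.n<1+n (suc ν)))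

  abstract

    -- `aₙ` is `A` as an integer. `κ₀` counts digits in units of `N`: 2013 for each outer part and 1
    -- for the middle part.
    aₙ κ₀ : ℕ
    aₙ = 4 ℕ.^ 4 ℕ.+ 1
    κ₀ = 2013 ℕ.+ 2013 ℕ.+ 1

    ι-aₙ : ι aₙ ≡ pow 4ℚ 4 + 1ℚ
    ι-aₙ = trans (ι-+ (4 ℕ.^ 4) 1) (cong₂ _+_ (ι-4^ 4) ι-1)

    κ₀-large : 2013 ℕ.+ 2013 ℕ.+ 1 ℕ.≤ κ₀
    κ₀-large = ℕₚ.≤-refl

  module Constants (κ : ℕ) where

    -- k < κ (ν + 1)² ≤ 4 κ ν² gives k r² ≤ `Qₙ`. `Θₙ` is the 6 Q + 1 of `θ-small`, and the factor
    -- `Qₙ` in `Cₙ` converts r² into 1/k.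
    Qₙ Θₙ C₁ₙ C₂ₙ Cₙ : ℕ
    Qₙ = 4 ℕ.* κ
    Θₙ = 6 ℕ.* Qₙ ℕ.+ 1
    C₁ₙ = Qₙ ℕ.* ((9 ℕ.+ Qₙ) ℕ.* (aₙ ℕ.* aₙ))
    C₂ₙ = 2 ℕ.+ (4 ℕ.* Θₙ) ℕ.* (4 ℕ.* Θₙ) ℕ.* (C₁ₙ ℕ.+ C₁ₙ ℕ.+ C₁ₙ)
    Cₙ = C₂ₙ ℕ.* Qₙ

    -- The first term makes 3 D = 6 (A + 1) r² smaller than θ r / 4, the quarter of the centre left
    -- over by the three errors; the term 5 q makes 5 r at most 1/q.
    ν₀ : ℕ → ℕ
    ν₀ q = 24 ℕ.* ((aₙ ℕ.+ 1) ℕ.* Θₙ) ℕ.+ 5 ℕ.* q ℕ.+ 1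

    Q Θ : ℚ
    Q = ι Qₙ
    Θ = ι Θₙ

    1≤Θₙ : 1 ℕ.≤ Θₙ
    1≤Θₙ = ℕₚ.m≤n+m 1 (6 ℕ.* Qₙ)

    θ : ℚ
    θ = proj₁ (reciprocal Θₙ 1≤Θₙ)

    0<θ : 0ℚ < θ
    0<θ = proj₁ (proj₂ (reciprocal Θₙ 1≤Θₙ))

    θΘ≡1 : θ * Θ ≡ 1ℚ
    θΘ≡1 = proj₂ (proj₂ (reciprocal Θₙ 1≤Θₙ))

    Θθ≡1 : Θ * θ ≡ 1ℚ
    Θθ≡1 = trans (*-comm Θ θ) θΘ≡1

    θ≤1 : θ ≤ 1ℚ
    θ≤1 = ≤-trans (≤-reflexive (sym (*-identityʳ θ)))
      (≤-trans (*-mono (<⇒≤ 0<θ) (≤-trans (≤-reflexive (sym ι-1)) (ι-mono 1≤Θₙ))) (≤-reflexive θΘ≡1))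

    Θ≡ : Θ ≡ 6ℚ * Q + 1ℚ
    Θ≡ = trans (ι-+ (6 ℕ.* Qₙ) 1) (cong₂ _+_ (ι-* 6 Qₙ) ι-1)

    θ-small : (6ℚ * Q + 1ℚ) * (θ * θ) ≤ 1ℚ
    θ-small = ≤-trans (≤-reflexive (trans (sym (*-assoc (6ℚ * Q + 1ℚ) θ θ))
      (trans (cong (λ z → z * θ * θ) (sym Θ≡)) (trans (cong (_* θ) Θθ≡1) (*-identityˡ θ))))) θ≤1

    module Large (ν : ℕ) (p q : ℕ) (1≤p : 1 ℕ.≤ p) (ν₀≤ν : ν₀ q ℕ.≤ ν) where

      1≤ν : 1 ℕ.≤ ν
      1≤ν = ℕₚ.≤-trans (ℕₚ.m≤n+m 1 (24 ℕ.* ((aₙ ℕ.+ 1) ℕ.* Θₙ) ℕ.+ 5 ℕ.* q)) ν₀≤ν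

      r : ℚ
      r = proj₁ (reciprocal ν 1≤ν)

      0<r : 0ℚ < r
      0<r = proj₁ (proj₂ (reciprocal ν 1≤ν))

      rν≡1 : r * ι ν ≡ 1ℚ
      rν≡1 = proj₂ (proj₂ (reciprocal ν 1≤ν))

      Kₙ : ℕ
      Kₙ = Qₙ ℕ.* (ν ℕ.* ν)

      Kr²≡Q : ι Kₙ * (r * r) ≡ Q
      Kr²≡Q = trans (cong (_* (r * r)) (trans (ι-* Qₙ (ν ℕ.* ν)) (cong (Q *_) (ι-* ν ν))))
        (trans (e Q (ι ν) r) (trans (cong (λ z → Q * (z * z)) rν≡1) (*-identityʳ Q)))
        where
        e : ∀ Q n r → Q * (n * n) * (r * r) ≡ Q * ((r * n) * (r * n))
        e = solve-∀ ring

      open Concentration ν 1≤ν r (<⇒≤ 0<r) rν≡1 Kₙ Q (0≤ι Qₙ) (≤-reflexive Kr²≡Q)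
        Θ θ (<⇒≤ 0<θ) Θθ≡1 θ-small public renaming (q to q₀)

      A≡ : A ≡ ι aₙ
      A≡ = sym ι-aₙ

      margin : ℚ
      margin = ι ν - ι 24 * ((A + 1ℚ) * Θ)

      0<margin : 0ℚ < margin
      0<margin = <-≤-trans 0<1 (≤-trans (≤-reflexive (e (ι 24 * ((A + 1ℚ) * Θ))))
        (+-monoˡ-≤ (- (ι 24 * ((A + 1ℚ) * Θ))) (≤-trans (≤-reflexive count) (ι-mono small))))
        where
        e : ∀ x → 1ℚ ≡ x + 1ℚ - x
        e = solve-∀ ring
        small : 24 ℕ.* ((aₙ ℕ.+ 1) ℕ.* Θₙ) ℕ.+ 1 ℕ.≤ ν
        small = ℕₚ.≤-trans (ℕₚ.+-monoˡ-≤ 1 (ℕₚ.m≤m+n (24 ℕ.* ((aₙ ℕ.+ 1) ℕ.* Θₙ)) (5 ℕ.* q))) ν₀≤ν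
        count : ι 24 * ((A + 1ℚ) * Θ) + 1ℚ ≡ ι (24 ℕ.* ((aₙ ℕ.+ 1) ℕ.* Θₙ) ℕ.+ 1)
        count = sym (trans (ι-+ (24 ℕ.* ((aₙ ℕ.+ 1) ℕ.* Θₙ)) 1) (cong₂ _+_ (trans (ι-* 24 ((aₙ ℕ.+ 1) ℕ.* Θₙ))
          (cong (ι 24 *_) (trans (ι-* (aₙ ℕ.+ 1) Θₙ) (cong (_* Θ) (trans (ι-+ aₙ 1) (cong₂ _+_ (sym A≡) ι-1)))))) ι-1))

      δ R : ℚ
      δ = q₀ - (η + η + η) - (D + D + D)
      R = 4ℚ * r + (η + η + η) + (D + D + D)

      δ-form : δ ≡ ¼ * (θ * (r * r)) * margin
      δ-form = trans (f₀ θ r A) (trans (cong₂ (λ x y → ¼ * θ * r * x - ι 24 * ¼ * (A + 1ℚ) * y * (r * r)) (sym rν≡1) (sym Θθ≡1))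
          (f₁ θ r A (ι ν) Θ (ι 24)))
        where
        f₀ : ∀ θ r A → θ * r - (¼ * (θ * r) + ¼ * (θ * r) + ¼ * (θ * r))
            - ((A * (r * (r * 1ℚ)) + A * (r * (r * 1ℚ)) + (r * r + r * r))
              + (A * (r * (r * 1ℚ)) + A * (r * (r * 1ℚ)) + (r * r + r * r))
              + (A * (r * (r * 1ℚ)) + A * (r * (r * 1ℚ)) + (r * r + r * r)))
          ≡ ¼ * θ * r * 1ℚ - (6ℚ * 4ℚ) * ¼ * (A + 1ℚ) * 1ℚ * (r * r)
        f₀ = solve-∀ ring
        f₁ : ∀ θ r A n Θ c → ¼ * θ * r * (r * n) - c * ¼ * (A + 1ℚ) * (Θ * θ) * (r * r) ≡ ¼ * (θ * (r * r)) * (n - c * ((A + 1ℚ) * Θ))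
        f₁ = solve-∀ ring

      0<δ : 0ℚ < δ
      0<δ = subst (0ℚ <_) (sym δ-form) (0<* (0<* (<-≤-trans (*<* (ℤ.+<+ (ℕ.s≤s ℕ.z≤n))) (≤-refl {¼})) (0<* 0<θ (0<* 0<r 0<r))) 0<margin)

      room : 0ℚ < 2ℚ * ι p - ι q * R
      room = <-≤-trans 0<1 (≤-by
        -- δ > 0 bounds 3 η + 3 D by θ r ≤ r, hence R ≤ 5 r and q R ≤ 1 < 2 p.
        (0≤+ (0≤+ (0≤* (≤-trans 0≤1 1≤2) (≤⇒0≤ 1≤ιp)) (≤⇒0≤ 5qr≤1)) (0≤* (0≤ι q) (0≤+ (0≤* (<⇒≤ 0<r) (≤⇒0≤ θ≤1)) (<⇒≤ 0<δ))))
        (f (ι p) (ι q) r θ (D + D + D)))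
        where
        1≤ιp : 1ℚ ≤ ι p
        1≤ιp = ≤-trans (≤-reflexive (sym ι-1)) (ι-mono 1≤p)
        5q≤ν : 5 ℕ.* q ℕ.≤ ν
        5q≤ν = ℕₚ.≤-trans (ℕₚ.≤-trans (ℕₚ.m≤n+m (5 ℕ.* q) (24 ℕ.* ((aₙ ℕ.+ 1) ℕ.* Θₙ))) (ℕₚ.m≤m+n _ 1)) ν₀≤ν
        5qr≤1 : r * ((4ℚ + 1ℚ) * ι q) ≤ 1ℚ
        5qr≤1 = ≤-trans (*-mono (<⇒≤ 0<r) (≤-trans (≤-reflexive (sym (ι-* 5 q))) (ι-mono 5q≤ν))) (≤-reflexive rν≡1)
        f : ∀ p q r θ D → 2ℚ * p - q * (4ℚ * r + (¼ * (θ * r) + ¼ * (θ * r) + ¼ * (θ * r)) + D)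
          ≡ 1ℚ + (2ℚ * (p - 1ℚ) + (1ℚ - r * ((4ℚ + 1ℚ) * q)) + q * (r * (1ℚ - θ) + (θ * r - (¼ * (θ * r) + ¼ * (θ * r) + ¼ * (θ * r)) - D)))
        f = solve-∀ ring

      module Count (m : ℕ) (N≤m : N ℕ.≤ m) (k≤K : (ℓ ℕ.+ m) ℕ.+ ℓ ℕ.≤ Kₙ) (M : ℕ)
        (2^k≡ : 2 ℕ.^ ((ℓ ℕ.+ m) ℕ.+ ℓ) ≡ suc (suc M)) where

        open Parts m N≤m k≤K

        private
          Fair : Bits → Set
          Fair w = (q ℕ.* 2 ℕ.^ k ℕ.< 2 ℕ.* q ℕ.* sizeS (val w) k ℕ.+ 2 ℕ.* p ℕ.* 2 ℕ.^ k)
            × (2 ℕ.* sizeS (val w) k ℕ.< 2 ℕ.^ k)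

          fair? : ∀ w → Dec (Fair w)
          fair? w = (q ℕ.* 2 ℕ.^ k ℕₚ.<? 2 ℕ.* q ℕ.* sizeS (val w) k ℕ.+ 2 ℕ.* p ℕ.* 2 ℕ.^ k)
            ×-dec (2 ℕ.* sizeS (val w) k ℕₚ.<? 2 ℕ.^ k)

          unfair : Bits → ℕ
          unfair w = Cyclic.inRange k M 2^k≡ (ind (¬? (fair? w))) (val w)

          certain : ∀ t u v → length t ≡ ℓ → length u ≡ m → length v ≡ ℓ →
            val ((t ++ u) ++ v) ℕ.< suc M → ¬ Fair ((t ++ u) ++ v) → 1ℚ ≤ majorant t u v
          certain t u v lt lu lv t< bad = ≮⇒≥ refute
            where
            lw : length ((t ++ u) ++ v) ≡ k
            lw = trans (Listₚ.length-++ (t ++ u)) (cong₂ ℕ._+_ (trans (Listₚ.length-++ t) (cong₂ ℕ._+_ lt lu)) lv)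
            refute : ¬ (majorant t u v < 1ℚ)
            refute small = bad (not-bad k M 2^k≡ ((t ++ u) ++ v) lw t< p q {δ} {R} 0<δ
              (proj₁ (majorant<1 t u v lu lv small)) (proj₂ (majorant<1 t u v lu lv small)) room)

          pointwise : ∀ t u v → length t ≡ ℓ → length u ≡ m → length v ≡ ℓ → ι (unfair ((t ++ u) ++ v)) ≤ majorant t u v
          pointwise t u v lt lu lv = ι-inRange k M 2^k≡ (¬? (fair? ((t ++ u) ++ v))) (val ((t ++ u) ++ v)) {majorant t u v}
            (0≤majorant t u v) (certain t u v lt lu lv)

        bad-average : ι (badCount p q k) ≤ pow 2ℚ k * (C₂ * (r * r))
        bad-average = ≤-trans (ι-mono (Cyclic.bad-≤ k M 2^k≡ p q))
          (≤-trans (≤-reflexive (trans (ι-sumB k unfair) (cong (pow 2ℚ k *_) (avg-++³ ℓ m ℓ (ι ∘ unfair)))))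
          (*-mono (<⇒≤ (0<pow2 k)) (≤-trans
            (avg-mono-length ℓ (λ t lt → avg-mono-length m (λ u lu → avg-mono-length ℓ (λ v lv → pointwise t u v lt lu lv))))
            E-majorant)))

        C₂≡ : C₂ ≡ ι C₂ₙ
        C₂≡ = sym (trans (ι-+ 2 ((4 ℕ.* Θₙ) ℕ.* (4 ℕ.* Θₙ) ℕ.* (C₁ₙ ℕ.+ C₁ₙ ℕ.+ C₁ₙ)))
          (cong (2ℚ +_) (trans (ι-* ((4 ℕ.* Θₙ) ℕ.* (4 ℕ.* Θₙ)) (C₁ₙ ℕ.+ C₁ₙ ℕ.+ C₁ₙ))
            (cong₂ _*_ (trans (ι-* (4 ℕ.* Θₙ) (4 ℕ.* Θₙ)) (cong₂ _*_ (ι-* 4 Θₙ) (ι-* 4 Θₙ)))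
              (trans (ι-+ (C₁ₙ ℕ.+ C₁ₙ) C₁ₙ) (cong₂ _+_ (trans (ι-+ C₁ₙ C₁ₙ) (cong₂ _+_ C₁≡ C₁≡)) C₁≡))))))
          where
          C₁≡ : ι C₁ₙ ≡ C₁
          C₁≡ = trans (ι-* Qₙ ((9 ℕ.+ Qₙ) ℕ.* (aₙ ℕ.* aₙ))) (cong (Q *_)
            (trans (ι-* (9 ℕ.+ Qₙ) (aₙ ℕ.* aₙ)) (cong₂ _*_ (ι-+ 9 Qₙ) (trans (ι-* aₙ aₙ) (cong₂ _*_ (sym A≡) (sym A≡))))))

        bad-bound : k ℕ.* badCount p q k ℕ.≤ Cₙ ℕ.* 2 ℕ.^ k
        bad-bound = ι-cancel-≤ (≤-trans (≤-reflexive (ι-* k (badCount p q k)))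
          (≤-trans (*-mono (0≤ι k) bad-average)
          (≤-trans (≤-reflexive (e (ι k) (pow 2ℚ k) C₂ (r * r)))
          (≤-trans (*-mono₂ (0≤* 0≤C₂ (0≤* (0≤ι k) (0≤sq r))) (<⇒≤ (0<pow2 k)) (*-mono 0≤C₂ (ιr² k≤K)) ≤-refl)
            (≤-reflexive (sym (trans (ι-* Cₙ (2 ℕ.^ k)) (cong₂ _*_ (trans (ι-* C₂ₙ Qₙ) (cong (_* Q) (sym C₂≡))) (ι-2^ k)))))))))
          where
          0≤C₂ : 0ℚ ≤ C₂
          0≤C₂ = subst (0ℚ ≤_) (sym C₂≡) (0≤ι C₂ₙ)
          e : ∀ k P C r → k * (P * (C * r)) ≡ C * (k * r) * P
          e = solve-∀ ring

    -- 2013 = 61 · 11 · 3 is the ratio of ℓ and ν².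
    bound : 2013 ℕ.+ 2013 ℕ.+ 1 ℕ.≤ κ → (p q : ℕ) → 1 ℕ.≤ p → (k : ℕ) → κ ℕ.* (ν₀ q ℕ.* ν₀ q) ℕ.≤ k →
      k ℕ.* badCount p q k ℕ.≤ Cₙ ℕ.* 2 ℕ.^ k
    bound κ-large p q 1≤p k k-large with square-root (ℕ._/_ k κ {{ℕ.>-nonZero (ℕₚ.≤-trans (ℕ.s≤s ℕ.z≤n) κ-large)}})
    ... | ν , lo , hi = subst (λ z → z ℕ.* badCount p q z ℕ.≤ Cₙ ℕ.* 2 ℕ.^ z) k≡
          (Count.bad-bound m N≤m (subst (ℕ._≤ Kₙ) (sym k≡) k≤K) M (trans (cong (2 ℕ.^_) k≡) 2^k≡))
      where
      instance
        κ-nonZero : ℕ.NonZero κ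
        κ-nonZero = ℕ.>-nonZero (ℕₚ.≤-trans (ℕ.s≤s ℕ.z≤n) κ-large)
      ν₀≤ν : ν₀ q ℕ.≤ ν
      ν₀≤ν with ν₀ q ℕ.≤? ν
      ... | yes y = y
      ... | no n = ⊥-elim (ℕₚ.<⇒≱ hi (ℕₚ.≤-trans (ℕₚ.*-mono-≤ (ℕₚ.≰⇒> n) (ℕₚ.≰⇒> n))
        (ℕₚ.≤-trans (ℕₚ.≤-reflexive (sym (ℕ.m*n/n≡m (ν₀ q ℕ.* ν₀ q) κ)))
          (ℕ./-monoˡ-≤ κ (subst (ℕ._≤ k) (ℕₚ.*-comm κ (ν₀ q ℕ.* ν₀ q)) k-large)))))
      open Large ν p q 1≤p ν₀≤ν
      κN≤k : N ℕ.* κ ℕ.≤ k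
      κN≤k = ℕₚ.≤-trans (ℕₚ.*-monoˡ-≤ κ lo) (ℕ.m/n*n≤m k κ)
      e₁ : ∀ N → N ℕ.* (2013 ℕ.+ 2013 ℕ.+ 1) ≡ 61 ℕ.* N ℕ.* 11 ℕ.* 3 ℕ.+ 61 ℕ.* N ℕ.* 11 ℕ.* 3 ℕ.+ N
      e₁ = ℕ-Solver.solve-∀
      parts : ℓ ℕ.+ ℓ ℕ.+ N ℕ.≤ k
      parts = ℕₚ.≤-trans (ℕₚ.≤-reflexive (sym (e₁ N))) (ℕₚ.≤-trans (ℕₚ.*-monoʳ-≤ N κ-large) κN≤k)
      -- The middle part takes all digits that the outer parts leave; it has at least `N` of them,
      -- as `cut` requires.
      m : ℕ
      m = k ℕ.∸ (ℓ ℕ.+ ℓ)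
      N≤m : N ℕ.≤ m
      N≤m = ℕₚ.m+n≤o⇒m≤o∸n N (subst (ℕ._≤ k) (ℕₚ.+-comm (ℓ ℕ.+ ℓ) N) parts)
      k≡ : (ℓ ℕ.+ m) ℕ.+ ℓ ≡ k
      k≡ = trans (e₂ ℓ m) (ℕₚ.m+[n∸m]≡n (ℕₚ.≤-trans (ℕₚ.m≤m+n (ℓ ℕ.+ ℓ) N) parts))
        where
        e₂ : ∀ l m → (l ℕ.+ m) ℕ.+ l ≡ (l ℕ.+ l) ℕ.+ m
        e₂ = ℕ-Solver.solve-∀
      k≤K : k ℕ.≤ Kₙ
      k≤K = ℕₚ.≤-trans (ℕₚ.<⇒≤ (ℕₚ.<-≤-trans below (ℕₚ.*-monoˡ-≤ κ hi)))
        (ℕₚ.≤-trans (ℕₚ.*-monoˡ-≤ κ (ℕₚ.*-mono-≤ twice twice)) (ℕₚ.≤-reflexive (e₃ ν κ)))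
        where
        twice : suc ν ℕ.≤ ν ℕ.+ ν
        twice = ℕₚ.+-monoˡ-≤ ν 1≤ν
        e₃ : ∀ n κ → (n ℕ.+ n) ℕ.* (n ℕ.+ n) ℕ.* κ ≡ 4 ℕ.* κ ℕ.* (n ℕ.* n)
        e₃ = ℕ-Solver.solve-∀
        below : k ℕ.< suc (k ℕ./ κ) ℕ.* κ
        below = subst (ℕ._< suc (k ℕ./ κ) ℕ.* κ) (sym (ℕ.m≡m%n+[m/n]*n k κ)) (ℕₚ.+-monoˡ-< (k ℕ./ κ ℕ.* κ) (ℕ.m%n<n k κ))
      1≤k : 1 ℕ.≤ k
      1≤k = ℕₚ.≤-trans 1≤N (ℕₚ.≤-trans (ℕₚ.m≤n+m N (ℓ ℕ.+ ℓ)) parts)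
      M : ℕ
      M = 2 ℕ.^ k ℕ.∸ 2
      2^k≡ : 2 ℕ.^ k ≡ suc (suc M)
      2^k≡ = sym (ℕₚ.m+[n∸m]≡n (ℕₚ.^-monoʳ-≤ 2 1≤k))

open import Defs
open import Data.Nat using (ℕ; suc; _*_; _^_; _≤_)

theorem1 : (p q : ℕ) → 1 ≤ p → 1 ≤ q →
    Σ ℕ (λ C → Σ ℕ (λ K → (k : ℕ) → K ≤ k → k * badCount p q k ≤ C * 2 ^ k))
theorem1 p q 1≤p 1≤q = Cₙ , κ₀ * (ν₀ q * ν₀ q) , bound κ₀-large p q 1≤p
  where
  open Assembly
  open Constants κ₀
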